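{- Let $p$ be a prime. (1) $\rho_p(2,2)=\frac{7}{12}$ if $p=2$, and $\rho_p(2,2)=1-\frac{3}{2}p^{ -1}\left(\frac{1-p^{ -1}}{1-p^{ -2}}\right)^2$ if $p\neq 2$. (2) $\rho_p(3,2)=\frac{1231}{1296}$ if $p=2$, and $\rho_p(3,2)=1-\frac{3}{2}p^{ -2}\left(\frac{1-p^{ -1}}{1-p^{ -2}}\right)^4$ if $p\ne 2$. (3) If $n\ge 4$, then $\rho_p(n,2)=1$.
   Context: For $n,k\in\mathbb{Z}_{\ge 2}$ and $\mathbf a=(a_0,\dots,a_n)$, let $X^k_{\mathbf a}\subset\mathbb{P}^n$ denote the diagonal hypersurface $\sum_{i=0}^n a_ix_i^k=0$. For a prime $p$ let $\mu_p$ be the Haar measure on $\mathbb{Z}_p$ normalized by $\mu_p(\mathbb{Z}_p)=1$, and also the product measure on $\mathbb{Z}_p^{n+1}$. Define $\rho_p(n,k)=\mu_p(\{\mathbf a\in\mathbb{Z}_p^{n+1}: X^k_{\mathbf a}(\mathbb{Q}_p)\neq\emptyset\})$. -}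

module Defs where

open import Level using (0ℓ)
open import Algebra.Bundles using (RawRing)
import Algebra.Definitions.RawSemiring as RawSemiringDefs
open import Data.Fin.Base using (Fin; toℕ)
open import Data.Integer.Base as ℤ using (ℤ; +_)
import Data.Integer.Properties as ℤ
open import Data.Integer.Divisibility.Signed
  using (_∣_; divides; ∣m∣n⇒∣m+n; ∣m⇒∣-m; ∣m⇒∣m*n; ∣n⇒∣m*n)
import Data.Integer.Tactic.RingSolver as ℤ-Solver
open import Data.Maybe.Base using (Maybe; maybe′)
open import Data.Maybe.Relation.Unary.Any using (Any)
open import Data.Nat.Base as ℕ using (ℕ; suc; NonZero)
import Data.Nat.Properties as ℕ
open import Data.Nat.Primality using (Prime; prime⇒nonZero; prime⇒nonTrivial)
open import Data.Product.Base using (_×_; ∃-syntax; Σ-syntax)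
open import Data.Rational.Base as ℚ using (ℚ; 0ℚ; 1ℚ)
import Data.Rational.Properties as ℚ
import Data.Rational.Unnormalised.Base as ℚᵘ
import Data.Rational.Unnormalised.Properties as ℚᵘ
open import Data.Vec.Functional using (Vector)
open import Relation.Binary.PropositionalEquality
  using (_≡_; refl; sym; subst; subst₂; cong)
open import Relation.Nullary.Negation using (¬_)
open import Relation.Unary using (Pred; ∁)

module ℚ-Semiring = RawSemiringDefs ℚ.+-*-rawSemiring
open ℚ-Semiring using () renaming (_^_ to _^ℚ_) public

-- ℤₚ as the inverse limit of the rings ℤ/pᵐ. An element is given by arbitrary
-- integer representatives of its residues, so equality is the relation _≈ₚ_.

record ℤₚ (p : ℕ) : Set where
  field
    res      : ℕ → ℤ
    coherent : ∀ m → (+ p) ℤ.^ m ∣ res (suc m) ℤ.- res m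

open ℤₚ public

module _ {p : ℕ} where

  infix  4 _≈ₚ_
  infixl 6 _+ₚ_
  infixl 7 _*ₚ_
  infix  8 -ₚ_

  _≈ₚ_ : ℤₚ p → ℤₚ p → Set
  x ≈ₚ y = ∀ m → (+ p) ℤ.^ m ∣ res x m ℤ.- res y m

  fromℤ : ℤ → ℤₚ p
  fromℤ z .res _ = z
  fromℤ z .coherent m =
    divides (+ 0) (ℤ.+-inverseʳ z)

  _+ₚ_ : ℤₚ p → ℤₚ p → ℤₚ p
  (x +ₚ y) .res m = res x m ℤ.+ res y m
  (x +ₚ y) .coherent m =
    subst ((+ p) ℤ.^ m ∣_)
      (regroup (res x (suc m)) (res x m) (res y (suc m)) (res y m))
      (∣m∣n⇒∣m+n (coherent x m) (coherent y m))
    where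
    regroup : ∀ a b c d → (a ℤ.- b) ℤ.+ (c ℤ.- d) ≡ (a ℤ.+ c) ℤ.- (b ℤ.+ d)
    regroup = ℤ-Solver.solve-∀

  -ₚ_ : ℤₚ p → ℤₚ p
  (-ₚ x) .res m = ℤ.- res x m
  (-ₚ x) .coherent m =
    subst ((+ p) ℤ.^ m ∣_) (regroup (res x (suc m)) (res x m))
      (∣m⇒∣-m (coherent x m))
    where
    regroup : ∀ a b → ℤ.- (a ℤ.- b) ≡ (ℤ.- a) ℤ.- (ℤ.- b)
    regroup = ℤ-Solver.solve-∀

  _*ₚ_ : ℤₚ p → ℤₚ p → ℤₚ p
  (x *ₚ y) .res m = res x m ℤ.* res y m
  (x *ₚ y) .coherent m =
    subst ((+ p) ℤ.^ m ∣_)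
      (regroup (res x (suc m)) (res x m) (res y (suc m)) (res y m))
      (∣m∣n⇒∣m+n (∣n⇒∣m*n (res x (suc m)) (coherent y m))
                 (∣m⇒∣m*n (res y m) (coherent x m)))
    where
    regroup : ∀ a b c d →
      a ℤ.* (c ℤ.- d) ℤ.+ (a ℤ.- b) ℤ.* d ≡ a ℤ.* c ℤ.- b ℤ.* d
    regroup = ℤ-Solver.solve-∀

-- ℚₚ = ℤₚ[1/p]: the element  num / p ^ exp.

record ℚₚ (p : ℕ) : Set where
  constructor _/p^_
  field
    num : ℤₚ p
    exp : ℕ

module _ (p : ℕ) where

  pow : ℕ → ℤₚ p
  pow e = fromℤ ((+ p) ℤ.^ e)

  ℚₚ-rawRing : RawRing 0ℓ 0ℓ
  ℚₚ-rawRing = record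
    { Carrier = ℚₚ p
    ; _≈_     = λ { (x /p^ e) (y /p^ f) → x *ₚ pow f ≈ₚ y *ₚ pow e }
    ; _+_     = λ { (x /p^ e) (y /p^ f) → (x *ₚ pow f +ₚ y *ₚ pow e) /p^ (e ℕ.+ f) }
    ; _*_     = λ { (x /p^ e) (y /p^ f) → (x *ₚ y) /p^ (e ℕ.+ f) }
    ; -_      = λ { (x /p^ e) → (-ₚ x) /p^ e }
    ; 0#      = fromℤ (+ 0) /p^ 0
    ; 1#      = fromℤ (+ 1) /p^ 0
    }

ι : ∀ {p} → ℤₚ p → ℚₚ p
ι x = x /p^ 0

-- Homogeneous coordinates of a ℚₚ-point of the diagonal hypersurface
-- ∑ aᵢ xᵢᵏ = 0 in ℙⁿ.
record DiagonalPoint (p n k : ℕ) (a : Vector (ℤₚ p) (suc n)) : Set where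
  open RawRing (ℚₚ-rawRing p)
  open RawSemiringDefs rawSemiring using (sum; _^_)
  field
    coords   : Vector (ℚₚ p) (suc n)
    nonzero  : ¬ (∀ i → coords i ≈ 0#)
    equation : sum (λ i → ι (a i) * coords i ^ k) ≈ 0#

Soluble : (p n k : ℕ) → Pred (Vector (ℤₚ p) (suc n)) 0ℓ
Soluble p n k a = DiagonalPoint p n k a

-- The ball  centre + p ^ level ℤₚ. Integer centres give all balls of positive
-- radius, since ℤ is dense in ℤₚ.
record Ball : Set where
  constructor ball
  field
    centre : ℤ
    level  : ℕ

open Ball public

Box : ℕ → Set
Box d = Vector Ball d

InBall : ∀ {p} → ℤₚ p → Ball → Set
InBall {p} x B = (+ p) ℤ.^ level B ∣ res x (level B) ℤ.- centre B

InBox : ∀ {p d} → Vector (ℤₚ p) d → Pred (Box d) 0ℓ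
InBox x B = ∀ i → InBall (x i) (B i)

module _ (p : ℕ) {{pr : Prime p}} where

  p⁻¹ : ℚ
  p⁻¹ = (+ 1 ℚ./ p) {{prime⇒nonZero pr}}

  volume : ∀ {d} → Box d → ℚ
  volume B = ℚ-Semiring.product (λ i → p⁻¹ ^ℚ level (B i))

  -- The Haar (outer) measure of S is at most q: for every ε > 0 the set S is
  -- covered by a sequence of boxes of total volume at most q + ε, where
  -- `nothing` is the empty box.
  OuterMeasure≤ : ∀ {d} → Pred (Vector (ℤₚ p) d) 0ℓ → ℚ → Set
  OuterMeasure≤ {d} S q =
    ∀ ε → 0ℚ ℚ.< ε →
    Σ[ C ∈ (ℕ → Maybe (Box d)) ]
      (∀ x → S x → ∃[ i ] Any (InBox x) (C i)) ×
      (∀ N → ℚ-Semiring.sum {N} (λ i → maybe′ volume 0ℚ (C (toℕ i))) ℚ.≤ q ℚ.+ ε)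

  -- S is measurable with Haar measure q. As ℤₚᵈ has total mass 1, the outer
  -- measures of S and of its complement add up to at least 1, with equality
  -- exactly when S is measurable; so the two bounds together say that S is
  -- measurable and that both are equalities.
  HaarMeasure : ∀ {d} → Pred (Vector (ℤₚ p) d) 0ℓ → ℚ → Set
  HaarMeasure S q = OuterMeasure≤ S q × OuterMeasure≤ (∁ S) (1ℚ ℚ.- q)

  p⁻¹<1 : p⁻¹ ℚ.< 1ℚ
  p⁻¹<1 = lemma p {{prime⇒nonZero pr}} (ℕ.nonTrivial⇒n>1 p {{prime⇒nonTrivial pr}})
    where
    lemma : ∀ n .{{_ : NonZero n}} → 1 ℕ.< n → (+ 1 ℚ./ n) ℚ.< 1ℚ
    lemma (suc m) 1<n = ℚ.toℚᵘ-cancel-< (ℚᵘ.<-respˡ-≃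
      (ℚᵘ.≃-sym (ℚ.toℚᵘ-fromℚᵘ (ℚᵘ.mkℚᵘ (+ 1) m)))
      (ℚᵘ.*<* (subst₂ ℤ._<_ refl (sym (ℤ.*-identityˡ (+ suc m))) (ℤ.+<+ 1<n))))

  p⁻²<1 : p⁻¹ ^ℚ 2 ℚ.< 1ℚ
  p⁻²<1 = begin-strict
    p⁻¹ ℚ.* (p⁻¹ ℚ.* 1ℚ)  ≡⟨ cong (p⁻¹ ℚ.*_) (ℚ.*-identityʳ p⁻¹) ⟩
    p⁻¹ ℚ.* p⁻¹           ≤⟨ ℚ.*-monoˡ-≤-nonNeg p⁻¹ {{nn}} (ℚ.<⇒≤ p⁻¹<1) ⟩
    p⁻¹ ℚ.* 1ℚ            ≡⟨ ℚ.*-identityʳ p⁻¹ ⟩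
    p⁻¹                   <⟨ p⁻¹<1 ⟩
    1ℚ                    ∎
    where
    open ℚ.≤-Reasoning
    nn : ℚ.NonNegative p⁻¹
    nn = ℚ.normalize-nonNeg 1 p {{prime⇒nonZero pr}}

instance
  1-p⁻²-nonZero : ∀ {p} {{_ : Prime p}} → ℚ.NonZero (1ℚ ℚ.- p⁻¹ p ^ℚ 2)
  1-p⁻²-nonZero {p} = ℚ.>-nonZero (subst (ℚ._< 1ℚ ℚ.- p⁻¹ p ^ℚ 2)
    (ℚ.+-inverseʳ (p⁻¹ p ^ℚ 2)) (ℚ.+-monoˡ-< (ℚ.- (p⁻¹ p ^ℚ 2)) (p⁻²<1 p)))

-- ρₚ(n,k) = q. It is a relation because a measure is in general a real number.
ρ[_][_,_]≡_ : (p : ℕ) → ℕ → ℕ → ℚ → {{Prime p}} → Set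
ρ[ p ][ n , k ]≡ q = HaarMeasure p (Soluble p n k) q

{-# OPTIONS --safe #-}

module Submission where

-- Write aᵢ = p^(2kᵢ + εᵢ) uᵢ with uᵢ a unit and εᵢ ∈ {0, 1}. Whether the diagonal quadric has
-- a point depends only on the parities εᵢ and on the square classes of the uᵢ: if one of the two
-- forms ∑ p^(εᵢ ⊕ b) uᵢ zᵢ² has a zero modulo p (modulo 8 if p = 2) in which some zᵢ with εᵢ = b
-- is a unit, Newton's iteration lifts it to a point; otherwise these zᵢ are all divisible by p,
-- taking p out exchanges the two forms, and by descent every zero is infinitely divisible by p.
-- A parity and a square class together have measure p^(-ε) (1 - p⁻¹) / (1 - p⁻²) divided by the
-- number of square classes of units, so the density is obtained by counting the soluble tuples of
-- labels (εᵢ, square class of uᵢ). The soluble and the insoluble tuples are covered by boxes up to the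
-- small set where some aᵢ is divisible by p^(2M).

-- A Haar measure is certified by two upper bounds, one for the soluble set and one for its
-- complement. Each kind of label tuple yields a cover, and the bounds come out sharp because the
-- two weighted counts add up to 1. The counts are found by evaluation, which has to be uniform in
-- `p`. For `p = 2` the labels are explicit, with the odd residues modulo 8 as classes. For odd `p`
-- the prime enters only through the class of -1 among the two square classes of units: modulo `p`,
-- three unit coefficients always admit a nontrivial zero, two do exactly when one class is -1 times
-- the other, and one never does. Either class of -1 gives the same counts, hence a single formula.
-- This explains the constant 3/2. A class has weight `r / 2`, where `r` is the measure of even
-- valuation. With three coefficients, 12 labellings are insoluble for each of one or two odd
-- labels, and `12 / 2³ = 3/2`. With four coefficients there are 24 insoluble labellings, all with
-- two odd labels, and `24 / 2⁴ = 3/2`.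

open import Defs

-- Congruences of integers, and units modulo a prime.

module Congruence where

  open import Data.Integer.Base using (ℤ; +_; -_; _+_; _-_; _*_; _^_; 0ℤ; 1ℤ)
  import Data.Integer.Base as ℤ
  import Data.Integer.Properties as ℤ
  open import Data.Integer.DivMod using (_%ℕ_; _/ℕ_; a≡a%ℕn+[a/ℕn]*n)
  open import Data.Integer.Divisibility.Signed
  open import Data.Integer.Tactic.RingSolver using (solve-∀)
  open import Data.Nat.Base as ℕ using (ℕ; suc)
  import Data.Nat.Properties as ℕ
  import Data.Nat.Divisibility as ℕ
  open import Data.Nat.Coprimality using (Coprime; coprime-Bézout)
  open import Data.Nat.GCD using (module Bézout)
  open import Data.Nat.Primality using (Prime; prime⇒nonZero; prime⇒nonTrivial; prime⇒irreducible; euclidsLemma)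
  open import Data.Product.Base using (_,_; ∃-syntax)
  open import Data.Sum.Base as Sum using (_⊎_; inj₁; inj₂)
  open import Relation.Binary.PropositionalEquality
  open import Relation.Nullary.Negation using (¬_; contradiction)

  infix 4 _≡_mod_
  -- A record rather than an abbreviation of `n ∣ x - y`, so that `x`, `y` and `n` can be inferred
  -- from the type of a proof.
  record _≡_mod_ (x y n : ℤ) : Set where
    constructor congruent
    field ∣-diff : n ∣ x - y

  open _≡_mod_ public

  module _ {n : ℤ} where

    ≡⇒mod : ∀ {x y} → x ≡ y → x ≡ y mod n
    ≡⇒mod {x} refl = congruent (divides 0ℤ (ℤ.+-inverseʳ x))

    mod-refl : ∀ {x} → x ≡ x mod n
    mod-refl = ≡⇒mod refl

    mod-sym : ∀ {x y} → x ≡ y mod n → y ≡ x mod n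
    mod-sym {x} {y} (congruent d) = congruent (subst (n ∣_) (lemma x y) (∣m⇒∣-m d))
      where
      lemma : ∀ x y → - (x - y) ≡ y - x
      lemma = solve-∀

    mod-trans : ∀ {x y z} → x ≡ y mod n → y ≡ z mod n → x ≡ z mod n
    mod-trans {x} {y} {z} (congruent d) (congruent e) =
      congruent (subst (n ∣_) (lemma x y z) (∣m∣n⇒∣m+n d e))
      where
      lemma : ∀ x y z → (x - y) + (y - z) ≡ x - z
      lemma = solve-∀

    mod-+ : ∀ {x y z w} → x ≡ y mod n → z ≡ w mod n → x + z ≡ y + w mod n
    mod-+ {x} {y} {z} {w} (congruent d) (congruent e) =
      congruent (subst (n ∣_) (lemma x y z w) (∣m∣n⇒∣m+n d e))
      where
      lemma : ∀ x y z w → (x - y) + (z - w) ≡ (x + z) - (y + w)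
      lemma = solve-∀

    mod-* : ∀ {x y z w} → x ≡ y mod n → z ≡ w mod n → x * z ≡ y * w mod n
    mod-* {x} {y} {z} {w} (congruent d) (congruent e) =
      congruent (subst (n ∣_) (lemma x y z w) (∣m∣n⇒∣m+n (∣m⇒∣m*n z d) (∣n⇒∣m*n y e)))
      where
      lemma : ∀ x y z w → (x - y) * z + y * (z - w) ≡ x * z - y * w
      lemma = solve-∀

    mod-neg : ∀ {x y} → x ≡ y mod n → - x ≡ - y mod n
    mod-neg {x} {y} (congruent d) = congruent (subst (n ∣_) (lemma x y) (∣m⇒∣-m d))
      where
      lemma : ∀ x y → - (x - y) ≡ (- x) - (- y)
      lemma = solve-∀

    mod-*ˡ : ∀ x {y z} → y ≡ z mod n → x * y ≡ x * z mod n
    mod-*ˡ x = mod-* (mod-refl {x})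

    ∣⇒mod : ∀ {x} → n ∣ x → x ≡ 0ℤ mod n
    ∣⇒mod {x} d = congruent (subst (n ∣_) (sym (ℤ.+-identityʳ x)) d)

    mod⇒∣ : ∀ {x} → x ≡ 0ℤ mod n → n ∣ x
    mod⇒∣ {x} (congruent d) = subst (n ∣_) (ℤ.+-identityʳ x) d

    ∣-resp-mod : ∀ {x y} → x ≡ y mod n → n ∣ x → n ∣ y
    ∣-resp-mod x≡y n∣x = mod⇒∣ (mod-trans (mod-sym x≡y) (∣⇒mod n∣x))

  mod-weaken : ∀ {m n x y} → m ∣ n → x ≡ y mod n → x ≡ y mod m
  mod-weaken m∣n (congruent d) = congruent (∣-trans m∣n d)

  mod-scale : ∀ k {n x y} → x ≡ y mod n → k * x ≡ k * y mod (k * n)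
  mod-scale k {n} {x} {y} (congruent d) =
    congruent (subst (k * n ∣_) (lemma k x y) (*-monoʳ-∣ k d))
    where
    lemma : ∀ k x y → k * (x - y) ≡ k * x - k * y
    lemma = solve-∀

  *-pres-∣ : ∀ {a b c d} → a ∣ b → c ∣ d → a * c ∣ b * d
  *-pres-∣ {a} {b} {c} {d} (divides q b≡qa) (divides r d≡rc) =
    divides (q * r) (trans (cong₂ _*_ b≡qa d≡rc) (lemma q a r c))
    where
    lemma : ∀ q a r c → (q * a) * (r * c) ≡ (q * r) * (a * c)
    lemma = solve-∀

  ^-monoʳ-∣ : ∀ x {m n} → m ℕ.≤ n → x ^ m ∣ x ^ n
  ^-monoʳ-∣ x {m} {n} m≤n = divides (x ^ (n ℕ.∸ m))
    (trans (cong (x ^_) (sym (ℕ.m∸n+n≡m m≤n))) (ℤ.^-distribˡ-+-* x (n ℕ.∸ m) m))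

  residue : ∀ z n .{{_ : ℕ.NonZero n}} → z ≡ + (z %ℕ n) mod (+ n)
  residue z n = mod-trans (≡⇒mod (a≡a%ℕn+[a/ℕn]*n z n))
    (congruent (divides (z /ℕ n) (lemma (+ (z %ℕ n)) (z /ℕ n) (+ n))))
    where
    lemma : ∀ r q n → r + q * n - r ≡ q * n
    lemma = solve-∀

  module PrimeModulus {p : ℕ} (pr : Prime p) where

    private
      P : ℤ
      P = + p

    P^-nonZero : ∀ k → ℤ.NonZero (P ^ k)
    P^-nonZero k = ℤ.≢-nonZero (λ eq → ℕ.≢-nonZero⁻¹ p {{prime⇒nonZero pr}} (ℤ.+-injective (ℤ.i^n≡0⇒i≡0 P k eq)))

    ^-cancel-∣ : ∀ k {m x} → P ^ (k ℕ.+ m) ∣ P ^ k * x → P ^ m ∣ x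
    ^-cancel-∣ k {m} {x} d =
      *-cancelˡ-∣ (P ^ k) {{P^-nonZero k}} (subst (_∣ P ^ k * x) (ℤ.^-distribˡ-+-* P k m) d)

    p∤1 : ¬ (P ∣ 1ℤ)
    p∤1 d = ℕ.nonTrivial⇒≢1 {{prime⇒nonTrivial pr}} (ℕ.∣1⇒≡1 (∣⇒∣ᵤ d))

    euclid : ∀ x y → P ∣ x * y → P ∣ x ⊎ P ∣ y
    euclid x y d = Sum.map ∣ᵤ⇒∣ ∣ᵤ⇒∣
      (euclidsLemma ℤ.∣ x ∣ ℤ.∣ y ∣ pr (subst (p ℕ.∣_) (ℤ.abs-* x y) (∣⇒∣ᵤ d)))

    ∤* : ∀ {x y} → ¬ (P ∣ x) → ¬ (P ∣ y) → ¬ (P ∣ x * y)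
    ∤* {x} {y} p∤x p∤y d = Sum.[ p∤x , p∤y ]′ (euclid x y d)

    ∣*⇒∣ʳ : ∀ {x y} → ¬ (P ∣ x) → P ∣ x * y → P ∣ y
    ∣*⇒∣ʳ {x} {y} p∤x d = Sum.[ (λ p∣x → contradiction p∣x p∤x) , (λ e → e) ]′ (euclid x y d)

    ∣²⇒∣ : ∀ {x} → P ∣ x * x → P ∣ x
    ∣²⇒∣ {x} d = Sum.[ (λ e → e) , (λ e → e) ]′ (euclid x x d)

    -- Bézout's identity for the absolute value of `x` and `p`, which are coprime because `p` is
    -- prime; the sign of `x` is put back afterwards.
    inverse : ∀ {x} → ¬ (P ∣ x) → ∃[ y ] x * y ≡ 1ℤ mod P
    inverse {x} p∤x = signed x refl (coprime-Bézout coprime)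
      where
      coprime : Coprime ℤ.∣ x ∣ p
      coprime {d} (d∣x , d∣p) with prime⇒irreducible pr d∣p
      ... | inj₁ d≡1 = d≡1
      ... | inj₂ refl = contradiction (∣ᵤ⇒∣ d∣x) p∤x

      unsigned : ∀ n → Bézout.Identity 1 n p → ∃[ y ] (+ n) * y ≡ 1ℤ mod P
      unsigned n (Bézout.+- u v eq) = + u , congruent (divides (+ v) (begin
        (+ n) * (+ u) - 1ℤ                 ≡⟨ cong (_- 1ℤ) (trans (sym (ℤ.pos-* n u)) (cong +_ (trans (ℕ.*-comm n u) (sym eq)))) ⟩
        (+ (1 ℕ.+ v ℕ.* p)) - 1ℤ           ≡⟨ cong (_- 1ℤ) (trans (ℤ.pos-+ 1 (v ℕ.* p)) (cong (_+_ 1ℤ) (ℤ.pos-* v p))) ⟩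
        (1ℤ + (+ v) * P) - 1ℤ              ≡⟨ lemma ((+ v) * P) ⟩
        (+ v) * P                          ∎))
        where
        open ≡-Reasoning
        lemma : ∀ a → (1ℤ + a) - 1ℤ ≡ a
        lemma = solve-∀
      unsigned n (Bézout.-+ u v eq) = - (+ u) , congruent (divides (- (+ v)) (begin
        (+ n) * (- (+ u)) - 1ℤ       ≡⟨ lemma (+ n) (+ u) ⟩
        - (1ℤ + (+ u) * (+ n))       ≡⟨ cong -_ (trans (cong (_+_ 1ℤ) (sym (ℤ.pos-* u n))) (sym (ℤ.pos-+ 1 (u ℕ.* n)))) ⟩
        - (+ (1 ℕ.+ u ℕ.* n))        ≡⟨ cong (λ k → - (+ k)) eq ⟩
        - (+ (v ℕ.* p))              ≡⟨ cong -_ (ℤ.pos-* v p) ⟩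
        - ((+ v) * P)                ≡⟨ ℤ.neg-distribˡ-* (+ v) P ⟩
        (- (+ v)) * P                ∎))
        where
        open ≡-Reasoning
        lemma : ∀ a b → a * (- b) - 1ℤ ≡ - (1ℤ + b * a)
        lemma = solve-∀

      signed : ∀ z → z ≡ x → Bézout.Identity 1 ℤ.∣ x ∣ p → ∃[ y ] z * y ≡ 1ℤ mod P
      signed (+ n) refl b = unsigned n b
      signed ℤ.-[1+ n ] refl b with unsigned (suc n) b
      ... | y , eq = - y , mod-trans (≡⇒mod (lemma (+ suc n) y)) eq
        where
        lemma : ∀ a b → (- a) * (- b) ≡ a * b
        lemma = solve-∀

-- Finite covers, volumes of boxes, and polynomials counting labellings.

module Covers where

  open import Level using (0ℓ)
  open import Algebra.Properties.Monoid.Mult using (×-homo-+)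
  import Data.Integer.Base as ℤ
  import Data.Integer.Properties as ℤ
  open import Data.Bool.Base using (Bool; true; false; if_then_else_)
  open import Data.Fin.Base using (Fin; zero; suc; toℕ)
  open import Data.List.Base as List using (List; []; _∷_; _++_)
  open import Data.List.Relation.Unary.Any as Any using (Any; here; there)
  import Data.List.Relation.Unary.Any.Properties as Any
  open import Data.Maybe.Base using (Maybe; just; nothing; maybe′)
  import Data.Maybe.Relation.Unary.Any as Maybe
  open import Data.Nat.Base as ℕ using (ℕ; zero; suc)
  open import Data.Nat.Primality using (Prime; prime⇒nonZero)
  open import Data.Product.Base using (_×_; _,_; ∃-syntax)
  open import Data.Rational.Base as ℚ using (ℚ; 0ℚ; 1ℚ; _+_; _*_; _-_; _≤_; _<_)
  import Data.Rational.Properties as ℚ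
  open import Data.Sum.Base using (_⊎_; inj₁; inj₂)
  open import Data.Unit.Base using (⊤; tt)
  open import Data.Empty using (⊥)
  open import Data.Vec.Base using (Vec; []; _∷_)
  open import Data.Vec.Functional as Vector using (Vector)
  open import Function.Base using (_∘_; id)
  open import Relation.Binary.PropositionalEquality
  open import Relation.Nullary.Decidable.Core using (dec⇒maybe)
  open import Relation.Unary using (Pred; _⊆_; _∪_)
  open import Tactic.RingSolver using (solve-∀)
  open import Tactic.RingSolver.Core.AlmostCommutativeRing using (AlmostCommutativeRing; fromCommutativeRing)

  ℚ-ring : AlmostCommutativeRing 0ℓ 0ℓ
  ℚ-ring = fromCommutativeRing ℚ.+-*-commutativeRing (λ x → dec⇒maybe (0ℚ ℚ.≟ x))

  *-mono-≤ : ∀ {a b c d} → 0ℚ ≤ a → 0ℚ ≤ d → a ≤ b → c ≤ d → a * c ≤ b * d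
  *-mono-≤ {a} {b} {c} {d} 0≤a 0≤d a≤b c≤d = ℚ.≤-trans
    (ℚ.*-monoˡ-≤-nonNeg a {{ℚ.nonNegative 0≤a}} c≤d)
    (ℚ.*-monoʳ-≤-nonNeg d {{ℚ.nonNegative 0≤d}} a≤b)

  0≤* : ∀ {a b} → 0ℚ ≤ a → 0ℚ ≤ b → 0ℚ ≤ a * b
  0≤* {a} {b} 0≤a 0≤b = subst (_≤ a * b) (ℚ.*-zeroˡ b)
    (ℚ.*-monoʳ-≤-nonNeg b {{ℚ.nonNegative 0≤b}} 0≤a)

  0≤+ : ∀ {a b} → 0ℚ ≤ a → 0ℚ ≤ b → 0ℚ ≤ a + b
  0≤+ = ℚ.+-mono-≤

  0≤^ : ∀ {a} n → 0ℚ ≤ a → 0ℚ ≤ a ^ℚ n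
  0≤^ zero    _   = ℚ.nonNegative⁻¹ 1ℚ
  0≤^ (suc n) 0≤a = 0≤* 0≤a (0≤^ n 0≤a)

  ^ℚ-+ : ∀ a m n → a ^ℚ (m ℕ.+ n) ≡ a ^ℚ m * a ^ℚ n
  ^ℚ-+ a zero    n = sym (ℚ.*-identityˡ _)
  ^ℚ-+ a (suc m) n = trans (cong (a *_) (^ℚ-+ a m n)) (sym (ℚ.*-assoc a _ _))

  sum-cong : ∀ {n} {g h : Fin n → ℚ} → (∀ i → g i ≡ h i) → ℚ-Semiring.sum g ≡ ℚ-Semiring.sum h
  sum-cong {zero}  g≗h = refl
  sum-cong {suc n} g≗h = cong₂ _+_ (g≗h zero) (sum-cong (g≗h ∘ suc))

  module Covering {X C : Set} (_∈ᶜ_ : X → C → Set) (vol : C → ℚ) where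

    total : List C → ℚ
    total []       = 0ℚ
    total (c ∷ cs) = vol c + total cs

    total-++ : ∀ cs ds → total (cs ++ ds) ≡ total cs + total ds
    total-++ []       ds = sym (ℚ.+-identityˡ _)
    total-++ (c ∷ cs) ds = trans (cong (vol c +_) (total-++ cs ds)) (sym (ℚ.+-assoc (vol c) _ _))

    -- Lists are enough: for a given ε, all coefficients of high valuation go into one slab per
    -- coordinate, and finitely many cells cover the rest. Points and cells are abstract so that one
    -- calculus serves both balls in `ℤₚ` and boxes.
    record Cover (S : Pred X 0ℓ) (q : ℚ) : Set where
      constructor cover
      field
        cells  : List C
        covers : ∀ {x} → S x → Any (x ∈ᶜ_) cells
        bound  : total cells ≤ q

    open Cover public

    cover-⊆ : ∀ {S T q r} → S ⊆ T → q ≤ r → Cover T q → Cover S r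
    cover-⊆ S⊆T q≤r (cover cs cov b) = cover cs (cov ∘ S⊆T) (ℚ.≤-trans b q≤r)

    cover-∅ : Cover (λ _ → ⊥) 0ℚ
    cover-∅ = cover [] (λ ()) ℚ.≤-refl

    cover-∪ : ∀ {S T q r} → Cover S q → Cover T r → Cover (S ∪ T) (q + r)
    cover-∪ {S} {T} (cover cs cov b) (cover ds cov′ b′) = cover (cs ++ ds) ∪-covers
      (ℚ.≤-trans (ℚ.≤-reflexive (total-++ cs ds)) (ℚ.+-mono-≤ b b′))
      where
      ∪-covers : ∀ {x} → (S ∪ T) x → Any (x ∈ᶜ_) (cs ++ ds)
      ∪-covers (inj₁ s) = Any.++⁺ˡ (cov s)
      ∪-covers (inj₂ t) = Any.++⁺ʳ cs (cov′ t)

    cover-⋃ : ∀ {n} {S : Fin n → Pred X 0ℓ} {q : Fin n → ℚ} →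
      (∀ i → Cover (S i) (q i)) → Cover (λ x → ∃[ i ] S i x) (ℚ-Semiring.sum q)
    cover-⋃ {zero}  c = cover [] (λ ()) ℚ.≤-refl
    cover-⋃ {suc n} {S} c = cover-⊆ split ℚ.≤-refl (cover-∪ (c zero) (cover-⋃ (c ∘ suc)))
      where
      split : (λ x → ∃[ i ] S i x) ⊆ (S zero ∪ (λ x → ∃[ i ] S (suc i) x))
      split (zero  , s) = inj₁ s
      split (suc i , s) = inj₂ (i , s)

  module Measure (p : ℕ) {{pr : Prime p}} where

    t : ℚ
    t = p⁻¹ p

    0≤t : 0ℚ ≤ t
    0≤t = ℚ.nonNegative⁻¹ t {{ℚ.normalize-nonNeg 1 p {{prime⇒nonZero pr}}}}

    module Line = Covering {ℤₚ p} {Ball} InBall (λ B → t ^ℚ level B)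
    module Space {d : ℕ} = Covering {Vector (ℤₚ p) d} {Box d} InBox (volume p)

    volume-nonNeg : ∀ {d} (B : Box d) → 0ℚ ≤ volume p B
    volume-nonNeg {zero}  B = ℚ.nonNegative⁻¹ 1ℚ
    volume-nonNeg {suc d} B = 0≤* (0≤^ (level (B zero)) 0≤t) (volume-nonNeg (B ∘ suc))

    line-total-nonNeg : ∀ bs → 0ℚ ≤ Line.total bs
    line-total-nonNeg []       = ℚ.≤-refl
    line-total-nonNeg (b ∷ bs) = 0≤+ (0≤^ (level b) 0≤t) (line-total-nonNeg bs)

    space-total-nonNeg : ∀ {d} (bs : List (Box d)) → 0ℚ ≤ Space.total bs
    space-total-nonNeg []       = ℚ.≤-refl
    space-total-nonNeg (b ∷ bs) = 0≤+ (volume-nonNeg b) (space-total-nonNeg bs)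

    fill : ∀ {d} → Ball → List (Box d) → List (Box (suc d))
    fill b = List.map (b Vector.∷_)

    prisms : ∀ {d} → List Ball → List (Box d) → List (Box (suc d))
    prisms []       Bs = []
    prisms (b ∷ bs) Bs = fill b Bs ++ prisms bs Bs

    total-fill : ∀ {d} b (Bs : List (Box d)) → Space.total (fill b Bs) ≡ t ^ℚ level b * Space.total Bs
    total-fill b []       = sym (ℚ.*-zeroʳ (t ^ℚ level b))
    total-fill b (B ∷ Bs) = trans (cong (t ^ℚ level b * volume p B +_) (total-fill b Bs))
      (sym (ℚ.*-distribˡ-+ (t ^ℚ level b) _ _))

    total-prisms : ∀ {d} bs (Bs : List (Box d)) →
      Space.total (prisms bs Bs) ≡ Line.total bs * Space.total Bs
    total-prisms []       Bs = sym (ℚ.*-zeroˡ (Space.total Bs))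
    total-prisms (b ∷ bs) Bs = begin
      Space.total (fill b Bs ++ prisms bs Bs)                         ≡⟨ Space.total-++ (fill b Bs) (prisms bs Bs) ⟩
      Space.total (fill b Bs) + Space.total (prisms bs Bs)            ≡⟨ cong₂ _+_ (total-fill b Bs) (total-prisms bs Bs) ⟩
      t ^ℚ level b * Space.total Bs + Line.total bs * Space.total Bs  ≡⟨ ℚ.*-distribʳ-+ (Space.total Bs) (t ^ℚ level b) (Line.total bs) ⟨
      Line.total (b ∷ bs) * Space.total Bs                            ∎
      where open ≡-Reasoning

    prisms-cover : ∀ {d} (x : Vector (ℤₚ p) (suc d)) bs {Bs : List (Box d)} →
      Any (InBall (x zero)) bs → Any (InBox (x ∘ suc)) Bs → Any (InBox x) (prisms bs Bs)
    prisms-cover x (b ∷ bs) (here x∈b) ys = Any.++⁺ˡ (Any.map⁺ (Any.map extend ys))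
      where
      extend : ∀ {B} → InBox (x ∘ suc) B → InBox x (b Vector.∷ B)
      extend y∈B zero    = x∈b
      extend y∈B (suc i) = y∈B i
    prisms-cover x (b ∷ bs) (there xs) ys = Any.++⁺ʳ (fill b _) (prisms-cover x bs xs ys)

    cover-× : ∀ {d S} {T : Pred (Vector (ℤₚ p) d) 0ℓ} {q r} → Line.Cover S q → Space.Cover T r →
      Space.Cover (λ x → S (x zero) × T (x ∘ suc)) (q * r)
    cover-× (Covering.cover bs cov b) (Covering.cover Bs cov′ b′) = Covering.cover (prisms bs Bs)
      (λ {x} (s , s′) → prisms-cover x bs (cov {x zero} s) (cov′ {x ∘ suc} s′))
      (ℚ.≤-trans (ℚ.≤-reflexive (total-prisms bs Bs))
        (*-mono-≤ (line-total-nonNeg bs) (ℚ.≤-trans (space-total-nonNeg Bs) b′) b b′))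

    line-cover-U : Line.Cover (λ _ → ⊤) 1ℚ
    line-cover-U = Covering.cover (ball (ℤ.+ 0) 0 ∷ [])
      (λ {x} _ → here (record { quotient = res x 0 ℤ.- ℤ.+ 0 ; equality = sym (ℤ.*-identityʳ _) }))
      (ℚ.≤-reflexive (ℚ.+-identityʳ 1ℚ))

    space-cover-U : ∀ {d} → Space.Cover {d} (λ _ → ⊤) 1ℚ
    space-cover-U {zero}  = Covering.cover ((λ ()) ∷ []) (λ _ → here (λ ())) (ℚ.≤-reflexive (ℚ.+-identityʳ 1ℚ))
    space-cover-U {suc d} = Space.cover-⊆ (λ _ → tt , tt) (ℚ.≤-reflexive (ℚ.*-identityˡ 1ℚ))
      (cover-× line-cover-U space-cover-U)

    -- The union bound: the condition on a single coordinate defines a slab, the product of a cover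
    -- of `S` with whole lines.
    some-coordinate : ∀ {d S q} → Line.Cover S q →
      Space.Cover {d} (λ x → ∃[ i ] S (x i)) (d ℚ-Semiring.× q)
    some-coordinate {zero}      c = Covering.cover [] (λ ()) ℚ.≤-refl
    some-coordinate {suc d} {S} {q} c = Space.cover-⊆ split (ℚ.≤-reflexive (cong (_+ d ℚ-Semiring.× q) (ℚ.*-identityʳ q)))
      (Space.cover-∪ (cover-× c space-cover-U)
        (Space.cover-⊆ id (ℚ.≤-reflexive (ℚ.*-identityˡ _)) (cover-× line-cover-U (some-coordinate c))))
      where
      split : ∀ {x : Vector (ℤₚ p) (suc d)} → ∃[ i ] S (x i) →
        (S (x zero) × ⊤) ⊎ (⊤ × ∃[ i ] S (x (suc i)))
      split (zero  , s) = inj₁ (s , tt)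
      split (suc i , s) = inj₂ (tt , i , s)

    private
      nth : ∀ {A : Set} → List A → ℕ → Maybe A
      nth []       _       = nothing
      nth (x ∷ xs) zero    = just x
      nth (x ∷ xs) (suc i) = nth xs i

      nth-any : ∀ {A : Set} {P : A → Set} {xs} → Any P xs → ∃[ i ] Maybe.Any P (nth xs i)
      nth-any (here px)  = 0 , Maybe.just px
      nth-any (there px) = let i , pxᵢ = nth-any px in suc i , pxᵢ

      nth-sum : ∀ {d} (Bs : List (Box d)) N →
        ℚ-Semiring.sum {N} (λ i → maybe′ (volume p) 0ℚ (nth Bs (toℕ i))) ≤ Space.total Bs
      nth-sum Bs       zero    = space-total-nonNeg Bs
      nth-sum {d} [] (suc N) = ℚ.≤-trans (ℚ.≤-reflexive (ℚ.+-identityˡ _)) (nth-sum {d} [] N)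
      nth-sum (B ∷ Bs) (suc N) = ℚ.+-monoʳ-≤ (volume p B) (nth-sum Bs N)

    -- A list followed by empty boxes is a sequence; volumes being nonnegative, no partial sum
    -- exceeds the total of the list.
    outerMeasure≤ : ∀ {d} {S : Pred (Vector (ℤₚ p) d) 0ℓ} {q} →
      (∀ ε → 0ℚ < ε → Space.Cover S (q + ε)) → OuterMeasure≤ p S q
    outerMeasure≤ c ε 0<ε with Covering.cover Bs cov b ← c ε 0<ε =
      nth Bs , (λ x s → nth-any (cov {x} s)) , (λ N → ℚ.≤-trans (nth-sum Bs N) b)

  -- Constant term first.
  Poly : Set
  Poly = List ℕ

  infixl 6 _⊕_
  _⊕_ : Poly → Poly → Poly
  []      ⊕ g       = g
  (m ∷ f) ⊕ []      = m ∷ f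
  (m ∷ f) ⊕ (n ∷ g) = (m ℕ.+ n) ∷ (f ⊕ g)

  ⨁ : ∀ {n} → (Fin n → Poly) → Poly
  ⨁ = Vector.foldr _⊕_ []

  eval : Poly → ℚ → ℚ
  eval []      x = 0ℚ
  eval (n ∷ f) x = n ℚ-Semiring.× 1ℚ + x * eval f x

  eval-⊕ : ∀ f g x → eval (f ⊕ g) x ≡ eval f x + eval g x
  eval-⊕ []      g       x = sym (ℚ.+-identityˡ _)
  eval-⊕ (m ∷ f) []      x = sym (ℚ.+-identityʳ _)
  eval-⊕ (m ∷ f) (n ∷ g) x = begin
    (m ℕ.+ n) ℚ-Semiring.× 1ℚ + x * eval (f ⊕ g) x                                   ≡⟨ cong₂ (λ a b → a + x * b) (×-homo-+ ℚ.+-0-monoid 1ℚ m n) (eval-⊕ f g x) ⟩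
    (m ℚ-Semiring.× 1ℚ + n ℚ-Semiring.× 1ℚ) + x * (eval f x + eval g x)              ≡⟨ lemma (m ℚ-Semiring.× 1ℚ) (n ℚ-Semiring.× 1ℚ) x (eval f x) (eval g x) ⟩
    (m ℚ-Semiring.× 1ℚ + x * eval f x) + (n ℚ-Semiring.× 1ℚ + x * eval g x)          ∎
    where
    open ≡-Reasoning
    lemma : ∀ a b x c d → (a + b) + x * (c + d) ≡ (a + x * c) + (b + x * d)
    lemma = solve-∀ ℚ-ring

  eval-⨁ : ∀ {n} (f : Fin n → Poly) x a → ℚ-Semiring.sum (λ i → a * eval (f i) x) ≡ a * eval (⨁ f) x
  eval-⨁ {zero}  f x a = sym (ℚ.*-zeroʳ a)
  eval-⨁ {suc n} f x a = begin
    a * eval (f zero) x + ℚ-Semiring.sum (λ i → a * eval (f (suc i)) x)  ≡⟨ cong (a * eval (f zero) x +_) (eval-⨁ (f ∘ suc) x a) ⟩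
    a * eval (f zero) x + a * eval (⨁ (f ∘ suc)) x                       ≡⟨ ℚ.*-distribˡ-+ a _ _ ⟨
    a * (eval (f zero) x + eval (⨁ (f ∘ suc)) x)                         ≡⟨ cong (a *_) (eval-⊕ (f zero) (⨁ (f ∘ suc)) x) ⟨
    a * eval (⨁ f) x                                                     ∎
    where open ≡-Reasoning

  Label : ℕ → Set
  Label N = Bool × Fin N

  -- The coefficient of xʲ counts the tuples satisfying f in which j labels are odd.
  tally : ∀ {N} d → (Vec (Label N) d → Bool) → Poly
  tally zero    f = (if f [] then 1 else 0) ∷ []
  tally (suc d) f = ⨁ (λ c → tally d (λ ls → f ((false , c) ∷ ls)))
                  ⊕ (0 ∷ ⨁ (λ c → tally d (λ ls → f ((true , c) ∷ ls))))

  data Labelled {p N} (L : Label N → Pred (ℤₚ p) 0ℓ) : ∀ {d} → Vec (Label N) d → Pred (Vector (ℤₚ p) d) 0ℓ where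
    []  : ∀ {x} → Labelled L [] x
    _∷_ : ∀ {d ℓ ls} {x : Vector (ℤₚ p) (suc d)} → L ℓ (x zero) → Labelled L ls (x ∘ suc) → Labelled L (ℓ ∷ ls) x

  module _ (p : ℕ) {{pr : Prime p}} where
    open Measure p

    -- The weight of a label depends on its parity alone, so a tuple with `j` odd labels costs
    -- `w ^ℚ d * t ^ℚ j`. Summing over the accepted tuples gives `w ^ℚ d` times the counting
    -- polynomial at `t`. Splitting off the first label follows the recursion of `tally`.
    cover-labelled : ∀ {N} {L : Label N → Pred (ℤₚ p) 0ℓ} {w} →
      (∀ c → Line.Cover (L (false , c)) w) → (∀ c → Line.Cover (L (true , c)) (t * w)) →
      ∀ {d} (f : Vec (Label N) d → Bool) →
      Space.Cover (λ x → ∃[ ls ] f ls ≡ true × Labelled L ls x) (w ^ℚ d * eval (tally d f) t)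
    cover-labelled even odd {zero} f with f [] in eq
    ... | true  = Space.cover-⊆ (λ _ → tt) (ℚ.≤-reflexive (sym (trans (ℚ.*-identityˡ _) (cong (1ℚ +_) (ℚ.*-zeroʳ t))))) space-cover-U
    ... | false = Space.cover-⊆ (λ { ([] , f≡true , _) → case trans (sym eq) f≡true of λ () })
                    (ℚ.≤-reflexive (sym (trans (ℚ.*-identityˡ _) (trans (ℚ.+-identityˡ _) (ℚ.*-zeroʳ t))))) Space.cover-∅
      where open import Function.Base using (case_of_)
    cover-labelled {N} {L} {w} even odd {suc d} f = Space.cover-⊆ split (ℚ.≤-reflexive (begin
      sumOver (λ c → w * (w ^ℚ d * eval (F false c) t)) + sumOver (λ c → t * w * (w ^ℚ d * eval (F true c) t))
        ≡⟨ cong₂ _+_ (trans (sum-cong {N} (λ c → sym (ℚ.*-assoc w (w ^ℚ d) (eval (F false c) t)))) (eval-⨁ (F false) t (w * w ^ℚ d)))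
                     (trans (sum-cong {N} (λ c → sym (ℚ.*-assoc (t * w) (w ^ℚ d) (eval (F true c) t)))) (eval-⨁ (F true) t (t * w * w ^ℚ d))) ⟩
      w * w ^ℚ d * eval (⨁ (F false)) t + t * w * w ^ℚ d * eval (⨁ (F true)) t
        ≡⟨ lemma w (w ^ℚ d) t (eval (⨁ (F false)) t) (eval (⨁ (F true)) t) ⟩
      w * w ^ℚ d * (eval (⨁ (F false)) t + (0ℚ + t * eval (⨁ (F true)) t))
        ≡⟨ cong (w * w ^ℚ d *_) (eval-⊕ (⨁ (F false)) (0 ∷ ⨁ (F true)) t) ⟨
      w * w ^ℚ d * eval (tally (suc d) f) t
        ∎))
      (Space.cover-∪
        (Space.cover-⋃ (λ c → cover-× (even c) (cover-labelled even odd (λ ls → f ((false , c) ∷ ls)))))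
        (Space.cover-⋃ (λ c → cover-× (odd  c) (cover-labelled even odd (λ ls → f ((true  , c) ∷ ls))))))
      where
      open ≡-Reasoning
      sumOver : (Fin N → ℚ) → ℚ
      sumOver = ℚ-Semiring.sum

      F : Bool → Fin N → Poly
      F ε c = tally d (λ ls → f ((ε , c) ∷ ls))

      lemma : ∀ w W t a b → w * W * a + t * w * W * b ≡ w * W * (a + (0ℚ + t * b))
      lemma = solve-∀ ℚ-ring

      Part : Bool → Fin N → Pred (Vector (ℤₚ p) (suc d)) 0ℓ
      Part ε c x = L (ε , c) (x zero) × ∃[ ls ] f ((ε , c) ∷ ls) ≡ true × Labelled L ls (x ∘ suc)

      split : ∀ {x : Vector (ℤₚ p) (suc d)} → ∃[ ls ] f ls ≡ true × Labelled L ls x →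
        (∃[ c ] Part false c x) ⊎ (∃[ c ] Part true c x)
      split (((false , c) ∷ ls) , eq , (l ∷ ll)) = inj₁ (c , l , ls , eq , ll)
      split (((true  , c) ∷ ls) , eq , (l ∷ ll)) = inj₂ (c , l , ls , eq , ll)

-- Rational estimates: the Archimedean property and the decay of powers of `p⁻¹`.

module Rationals where

  open Covers
  open import Algebra.Properties.Monoid.Mult using (×-homo-+)
  open import Data.Nat.Base as ℕ using (ℕ; zero; suc)
  import Data.Nat.Properties as ℕ
  open import Data.Nat.Coprimality as C using (1-coprimeTo)
  open import Data.Nat.Primality using (Prime; prime⇒nonZero; prime⇒nonTrivial)
  import Data.Integer.Base as ℤ
  import Data.Integer.Properties as ℤ
  open import Data.Product.Base using (_×_; _,_; ∃-syntax)
  open import Data.Rational.Base as ℚ using (ℚ; mkℚ; 0ℚ; 1ℚ; _+_; _*_; _≤_; _<_)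
  import Data.Rational.Properties as ℚ
  import Data.Rational.Unnormalised.Base as ℚᵘ
  import Data.Rational.Unnormalised.Properties as ℚᵘ
  open import Relation.Binary.PropositionalEquality
  open import Tactic.RingSolver using (solve-∀)

  open ℚ-Semiring using () renaming (_×_ to _×ℚ_)

  fromℕ : ℕ → ℚ
  fromℕ n = mkℚ (ℤ.+ n) 0 (C.sym (1-coprimeTo n))

  ×≡fromℕ : ∀ n → n ×ℚ 1ℚ ≡ fromℕ n
  ×≡fromℕ zero    = refl
  ×≡fromℕ (suc n) = trans (cong (1ℚ +_) (×≡fromℕ n)) (ℚ.toℚᵘ-injective
    (ℚᵘ.≃-trans (ℚ.toℚᵘ-homo-+ 1ℚ (fromℕ n)) (ℚᵘ.*≡* (lemma n))))
    where
    lemma : ∀ n → (ℤ.+ 1 ℤ.* ℤ.+ 1 ℤ.+ ℤ.+ n ℤ.* ℤ.+ 1) ℤ.* ℤ.+ 1 ≡ ℤ.+ suc n ℤ.* ℤ.+ 1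
    lemma n = cong (ℤ._* ℤ.+ 1) (trans (cong (ℤ._+_ (ℤ.+ 1)) (ℤ.*-identityʳ (ℤ.+ n))) refl)

  0≤× : ∀ n → 0ℚ ≤ n ×ℚ 1ℚ
  0≤× zero    = ℚ.≤-refl
  0≤× (suc n) = 0≤+ (ℚ.nonNegative⁻¹ 1ℚ) (0≤× n)

  ×-mono-≤ : ∀ {m n} → m ℕ.≤ n → m ×ℚ 1ℚ ≤ n ×ℚ 1ℚ
  ×-mono-≤ {m} {n} m≤n = ℚ.≤-trans (ℚ.≤-reflexive (sym (ℚ.+-identityʳ (m ×ℚ 1ℚ))))
    (ℚ.≤-trans (ℚ.+-monoʳ-≤ (m ×ℚ 1ℚ) (0≤× (n ℕ.∸ m)))
    (ℚ.≤-reflexive (trans (sym (×-homo-+ ℚ.+-0-monoid 1ℚ m (n ℕ.∸ m))) (cong (_×ℚ 1ℚ) (ℕ.m+[n∸m]≡n m≤n)))))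

  ×-as-* : ∀ n x → n ×ℚ x ≡ n ×ℚ 1ℚ * x
  ×-as-* zero    x = sym (ℚ.*-zeroˡ x)
  ×-as-* (suc n) x = trans (cong₂ _+_ (sym (ℚ.*-identityˡ x)) (×-as-* n x)) (sym (ℚ.*-distribʳ-+ x 1ℚ (n ×ℚ 1ℚ)))

  ×1-homo-* : ∀ m n → (m ℕ.* n) ×ℚ 1ℚ ≡ m ×ℚ 1ℚ * n ×ℚ 1ℚ
  ×1-homo-* zero    n = sym (ℚ.*-zeroˡ (n ×ℚ 1ℚ))
  ×1-homo-* (suc m) n = trans (×-homo-+ ℚ.+-0-monoid 1ℚ n (m ℕ.* n))
    (trans (cong₂ _+_ (sym (ℚ.*-identityˡ (n ×ℚ 1ℚ))) (×1-homo-* m n)) (sym (ℚ.*-distribʳ-+ (n ×ℚ 1ℚ) 1ℚ (m ×ℚ 1ℚ))))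

  *-cancel-≡1 : ∀ {x y} → 0ℚ < y → x * y ≡ y → x ≡ 1ℚ
  *-cancel-≡1 {x} {y} 0<y eq = ℚ.≤-antisym
    (ℚ.*-cancelʳ-≤-pos {x} {1ℚ} y {{ℚ.positive 0<y}} (ℚ.≤-reflexive eq′))
    (ℚ.*-cancelʳ-≤-pos {1ℚ} {x} y {{ℚ.positive 0<y}} (ℚ.≤-reflexive (sym eq′)))
    where
    eq′ : x * y ≡ 1ℚ * y
    eq′ = trans eq (sym (ℚ.*-identityˡ y))

  0≤1/ : ∀ x .{{nz : ℚ.NonZero x}} → 0ℚ < x → 0ℚ ≤ ℚ.1/ x
  0≤1/ (mkℚ ℤ.+[1+ n ] d c) _ = ℚ.nonNegative⁻¹ _
  0≤1/ (mkℚ (ℤ.+ zero) d c) (ℚ.*<* (ℤ.+<+ ()))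
  0≤1/ (mkℚ ℤ.-[1+ n ] d c) (ℚ.*<* ())

  -- The Archimedean property, with the denominator of `ε` as witness: its product with `ε` is the
  -- numerator, a positive integer.
  1≤multiple : ∀ ε → 0ℚ < ε → ∃[ D ] 1ℚ ≤ D ×ℚ 1ℚ * ε
  1≤multiple ε@(mkℚ (ℤ.+ zero) b c) (ℚ.*<* (ℤ.+<+ ()))
  1≤multiple ε@(mkℚ (ℤ.+ suc a) b c) 0<ε = suc b , subst (λ n → 1ℚ ≤ n * ε) (sym (×≡fromℕ (suc b)))
    (ℚ.toℚᵘ-cancel-≤ (ℚᵘ.≤-respʳ-≃ (ℚᵘ.≃-sym (ℚ.toℚᵘ-homo-* (fromℕ (suc b)) ε))
      (ℚᵘ.*≤* (subst₂ ℤ._≤_ eq₁ eq₂ (ℤ.+≤+ (ℕ.m≤m*n (suc b) (suc a)))))))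
    where
    eq₁ : ℤ.+ suc b ≡ ℤ.+ 1 ℤ.* ℤ.+ (1 ℕ.* suc b)
    eq₁ = sym (trans (ℤ.*-identityˡ _) (cong ℤ.+_ (ℕ.*-identityˡ (suc b))))
    eq₂ : ℤ.+ (suc b ℕ.* suc a) ≡ (ℤ.+ suc b ℤ.* ℤ.+ suc a) ℤ.* ℤ.+ 1
    eq₂ = trans (ℤ.pos-* (suc b) (suc a)) (sym (ℤ.*-identityʳ _))
  1≤multiple (mkℚ ℤ.-[1+ a ] b c) (ℚ.*<* ())

  module _ (p : ℕ) {{pr : Prime p}} where

    open Measure p using (t; 0≤t)

    p*p⁻¹ : p ×ℚ 1ℚ * t ≡ 1ℚ
    p*p⁻¹ = trans (cong (_* t) (×≡fromℕ p)) (lemma p {{prime⇒nonZero pr}})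
      where
      lemma : ∀ n .{{nz : ℕ.NonZero n}} → fromℕ n * (ℤ.+ 1 ℚ./ n) ≡ 1ℚ
      lemma (suc m) = ℚ.toℚᵘ-injective (ℚᵘ.≃-trans (ℚ.toℚᵘ-homo-* (fromℕ (suc m)) (ℤ.+ 1 ℚ./ suc m))
        (ℚᵘ.≃-trans (ℚᵘ.*-congˡ {ℚᵘ.mkℚᵘ (ℤ.+ suc m) 0} (ℚ.toℚᵘ-fromℚᵘ (ℚᵘ.mkℚᵘ (ℤ.+ 1) m)))
          (ℚᵘ.*≡* (trans (ℤ.*-identityʳ _) (trans (ℤ.*-identityʳ (ℤ.+ suc m))
            (sym (trans (ℤ.*-identityˡ _) (cong ℤ.+_ (ℕ.*-identityˡ (suc m))))))))))

    t+t≤1 : t + t ≤ 1ℚ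
    t+t≤1 = subst₂ _≤_ (lemma t) p*p⁻¹
      (ℚ.*-monoʳ-≤-nonNeg t {{ℚ.nonNegative 0≤t}} (×-mono-≤ {2} {p} (ℕ.nonTrivial⇒n>1 p {{prime⇒nonTrivial pr}})))
      where
      lemma : ∀ t → (1ℚ + (1ℚ + 0ℚ)) * t ≡ t + t
      lemma = solve-∀ ℚ-ring

    t≤1 : t ≤ 1ℚ
    t≤1 = ℚ.<⇒≤ (p⁻¹<1 p)

    t^≤1 : ∀ n → t ^ℚ n ≤ 1ℚ
    t^≤1 zero    = ℚ.≤-refl
    t^≤1 (suc n) = *-mono-≤ 0≤t (ℚ.nonNegative⁻¹ 1ℚ) t≤1 (t^≤1 n)

    -- An explicit rate for the convergence of `t ^ℚ n` to 0. In the step both summands in the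
    -- parenthesis are at most 1, and `t + t ≤ 1` because `p ≥ 2`.
    n*t^n≤1 : ∀ n → n ×ℚ 1ℚ * t ^ℚ n ≤ 1ℚ
    n*t^n≤1 zero    = ℚ.≤-trans (ℚ.≤-reflexive (ℚ.*-zeroˡ 1ℚ)) (ℚ.nonNegative⁻¹ 1ℚ)
    n*t^n≤1 (suc n) = begin
      (1ℚ + n ×ℚ 1ℚ) * (t * t ^ℚ n)        ≡⟨ lemma (n ×ℚ 1ℚ) t (t ^ℚ n) ⟩
      t * (t ^ℚ n + n ×ℚ 1ℚ * t ^ℚ n)      ≤⟨ ℚ.*-monoˡ-≤-nonNeg t {{ℚ.nonNegative 0≤t}} (ℚ.+-mono-≤ (t^≤1 n) (n*t^n≤1 n)) ⟩
      t * (1ℚ + 1ℚ)                        ≡⟨ trans (ℚ.*-distribˡ-+ t 1ℚ 1ℚ) (cong₂ _+_ (ℚ.*-identityʳ t) (ℚ.*-identityʳ t)) ⟩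
      t + t                                ≤⟨ t+t≤1 ⟩
      1ℚ                                   ∎
      where
      open ℚ.≤-Reasoning
      lemma : ∀ n t a → (1ℚ + n) * (t * a) ≡ t * (a + n * a)
      lemma = solve-∀ ℚ-ring

    multiple-of-small-power : ∀ d ε → 0ℚ < ε → ∃[ M ] d ×ℚ (t ^ℚ (M ℕ.+ M)) ≤ ε
    multiple-of-small-power d ε 0<ε with D , 1≤Dε ← 1≤multiple ε 0<ε = M , (begin
      d ×ℚ T                        ≡⟨ ×-as-* d T ⟩
      d ×ℚ 1ℚ * T                   ≡⟨ ℚ.*-identityʳ _ ⟨
      d ×ℚ 1ℚ * T * 1ℚ              ≤⟨ ℚ.*-monoˡ-≤-nonNeg (d ×ℚ 1ℚ * T) {{ℚ.nonNegative (0≤* (0≤× d) 0≤T)}} 1≤Dε ⟩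
      d ×ℚ 1ℚ * T * (D ×ℚ 1ℚ * ε)   ≡⟨ lemma (d ×ℚ 1ℚ) T (D ×ℚ 1ℚ) ε ⟩
      (d ×ℚ 1ℚ * D ×ℚ 1ℚ) * T * ε   ≡⟨ cong (λ a → a * T * ε) (×1-homo-* d D) ⟨
      M ×ℚ 1ℚ * T * ε               ≤⟨ ℚ.*-monoʳ-≤-nonNeg ε {{0≤ε}} (ℚ.*-monoʳ-≤-nonNeg T {{ℚ.nonNegative 0≤T}} (×-mono-≤ (ℕ.m≤m+n M M))) ⟩
      (M ℕ.+ M) ×ℚ 1ℚ * T * ε       ≤⟨ ℚ.*-monoʳ-≤-nonNeg ε {{0≤ε}} (n*t^n≤1 (M ℕ.+ M)) ⟩
      1ℚ * ε                        ≡⟨ ℚ.*-identityˡ ε ⟩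
      ε                             ∎)
      where
      open ℚ.≤-Reasoning
      -- Since `D ε ≥ 1`, the product `d T` is at most `d D T ε = M T ε`, hence at most `2M T ε`; as
      -- `T` is the power of `t` with exponent `2M`, this is at most `ε` by `n*t^n≤1`.
      M = d ℕ.* D
      T = t ^ℚ (M ℕ.+ M)
      0≤T : 0ℚ ≤ T
      0≤T = 0≤^ (M ℕ.+ M) 0≤t
      0≤ε = ℚ.nonNegative (ℚ.<⇒≤ 0<ε)
      lemma : ∀ a T b e → a * T * (b * e) ≡ (a * b) * T * e
      lemma = solve-∀ ℚ-ring

-- p-adic numbers through their residues: division, roots of quadratics, clearing denominators.

module PadicPoints where

  open Congruence
  open import Algebra.Bundles using (RawRing)
  import Algebra.Definitions.RawSemiring as RawSemiringDefs
  open import Data.Fin.Base using (zero; suc)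
  import Data.Integer.Base as ℤ
  open import Data.Integer.Base using (ℤ; +_; -_; _+_; _-_; _*_; _^_; 0ℤ; 1ℤ)
  import Data.Integer.Properties as ℤ
  open import Data.Integer.Divisibility.Signed
  open import Data.Integer.Tactic.RingSolver using (solve-∀)
  open import Data.Nat.Base as ℕ using (ℕ; zero; suc; z≤n; s≤s)
  import Data.Nat.Properties as ℕ
  open import Data.Nat.Primality using (Prime)
  open import Data.Product.Base using (_×_; _,_; ∃-syntax; Σ-syntax; proj₂)
  open import Data.Vec.Functional as Vector using (Vector)
  open import Function.Base using (_∘_)
  open import Relation.Binary.PropositionalEquality
  open import Relation.Nullary.Negation using (¬_)

  ∑ : ∀ {d} → Vector ℤ d → ℤ
  ∑ = Vector.foldr _+_ 0ℤ

  ∑-mod : ∀ {n d} {f g : Vector ℤ d} → (∀ i → f i ≡ g i mod n) → ∑ f ≡ ∑ g mod n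
  ∑-mod {d = zero}  f≡g = mod-refl
  ∑-mod {d = suc d} f≡g = mod-+ (f≡g zero) (∑-mod (f≡g ∘ suc))

  ∑-cong : ∀ {d} {f g : Vector ℤ d} → (∀ i → f i ≡ g i) → ∑ f ≡ ∑ g
  ∑-cong {zero}  f≡g = refl
  ∑-cong {suc d} f≡g = cong₂ _+_ (f≡g zero) (∑-cong (f≡g ∘ suc))

  *-distribˡ-∑ : ∀ {d} k (f : Vector ℤ d) → k * ∑ f ≡ ∑ (λ i → k * f i)
  *-distribˡ-∑ {zero}  k f = ℤ.*-zeroʳ k
  *-distribˡ-∑ {suc d} k f = trans (ℤ.*-distribˡ-+ k (f zero) _) (cong (_+_ (k * f zero)) (*-distribˡ-∑ k (f ∘ suc)))

  module Padic {p : ℕ} (pr : Prime p) where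

    open PrimeModulus pr

    P : ℤ
    P = + p

    P∣P^suc : ∀ k → P ∣ P ^ suc k
    P∣P^suc k = ∣m⇒∣m*n (P ^ k) ∣-refl

    res-+ : ∀ (x : ℤₚ p) m j → res x (j ℕ.+ m) ≡ res x m mod (P ^ m)
    res-+ x m zero    = mod-refl
    res-+ x m (suc j) = mod-trans
      (mod-weaken (^-monoʳ-∣ P (ℕ.m≤n+m m j)) (congruent (coherent x (j ℕ.+ m)))) (res-+ x m j)

    res-≤ : ∀ (x : ℤₚ p) {m n} → m ℕ.≤ n → res x n ≡ res x m mod (P ^ m)
    res-≤ x {m} {n} m≤n =
      subst (λ k → res x k ≡ res x m mod (P ^ m)) (ℕ.m∸n+n≡m m≤n) (res-+ x m (n ℕ.∸ m))

    res-suc-mod-P : ∀ (x : ℤₚ p) m → res x (suc m) ≡ res x 1 mod P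
    res-suc-mod-P x m = mod-weaken (P∣P^suc 0) (res-≤ x (s≤s z≤n))

    infix 4 _≈P^_*_
    _≈P^_*_ : ℤₚ p → ℕ → ℤₚ p → Set
    x ≈P^ v * u = ∀ m → res x m ≡ P ^ v * res u m mod (P ^ m)

    -- Division by `P ^ v` loses `v` digits, so residue `m` of the quotient is read off residue
    -- `m + v` of `x`. The exact equation accompanies the congruence because it transfers
    -- divisibility from `res x (suc v)` to `res u 1` and back.
    divide : ∀ (x : ℤₚ p) v → P ^ v ∣ res x v →
      Σ[ u ∈ ℤₚ p ] x ≈P^ v * u × (∀ m → res x (m ℕ.+ v) ≡ P ^ v * res u m)
    divide x v d = record { res = quot ; coherent = quot-coherent }
      , (λ m → mod-trans (mod-sym (subst (λ k → res x k ≡ res x m mod (P ^ m)) (ℕ.+-comm v m) (res-+ x m v)))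
                         (≡⇒mod (quot-eq m)))
      , quot-eq
      where
      P^v∣ : ∀ m → P ^ v ∣ res x (m ℕ.+ v)
      P^v∣ m = ∣-resp-mod (mod-sym (res-+ x v m)) d

      quot : ℕ → ℤ
      quot m = quotient (P^v∣ m)

      quot-eq : ∀ m → res x (m ℕ.+ v) ≡ P ^ v * quot m
      quot-eq m = trans (_∣_.equality (P^v∣ m)) (ℤ.*-comm (quot m) (P ^ v))

      lemma : ∀ a x y → a * x - a * y ≡ a * (x - y)
      lemma = solve-∀

      quot-coherent : ∀ m → P ^ m ∣ quot (suc m) - quot m
      quot-coherent m = ^-cancel-∣ v (subst₂ _∣_ (cong (P ^_) (ℕ.+-comm m v))
        (trans (cong₂ _-_ (quot-eq (suc m)) (quot-eq m)) (lemma (P ^ v) (quot (suc m)) (quot m)))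
        (coherent x (m ℕ.+ v)))

    -- Newton's iteration for q + b y + c y², with the inverse of b taken mod p only.
    quadratic-root : ∀ (q b c : ℤₚ p) → P ∣ res q 1 → ¬ (P ∣ res b 1) →
      Σ[ y ∈ ℤₚ p ] (∀ m → P ^ m ∣ res q m + res b m * res y m + res c m * (res y m * res y m))
                  × P ∣ res y 1
    quadratic-root q b c P∣q P∤b with β , bβ≡1 ← inverse P∤b =
      record { res = root ; coherent = root-coherent } , root-zero , divides 0ℤ refl
      where
      f : ℕ → ℤ → ℤ
      f m y = res q m + res b m * y + res c m * (y * y)

      Y : ℕ → ℤ
      Y zero    = 0ℤ
      Y (suc k) = Y k - β * f (suc (suc k)) (Y k)

      f-mod : ∀ k y → f (suc (suc k)) y ≡ f (suc k) y mod (P ^ suc k)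
      f-mod k y = mod-+ (mod-+ (res-+ q (suc k) 1) (mod-* (res-+ b (suc k) 1) mod-refl))
                        (mod-* (res-+ c (suc k) 1) mod-refl)

      -- Taylor expansion of one step: the new value is the old value `z` times a bracket divisible
      -- by `P`, because `b β ≡ 1` modulo `P` and `P` divides both `y` and `z`. So every step gains
      -- a factor `P` although `β` stays fixed.
      newton : ∀ q b c β y → let z = q + b * y + c * (y * y) in
        q + b * (y - β * z) + c * ((y - β * z) * (y - β * z))
          ≡ (- (b * β - 1ℤ) + (- ((+ 2) * c * β) * y + c * (β * β) * z)) * z
      newton = solve-∀

      Y-invariant : ∀ k → P ∣ Y k × P ^ suc k ∣ f (suc k) (Y k)
      Y-invariant zero = divides 0ℤ refl
        , subst₂ _∣_ (sym (ℤ.^-identityʳ P)) (lemma (res q 1) (res b 1) (res c 1)) P∣q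
        where
        lemma : ∀ q b c → q ≡ q + b * 0ℤ + c * (0ℤ * 0ℤ)
        lemma = solve-∀
      Y-invariant (suc k) with P∣Y , d ← Y-invariant k =
        ∣m∣n⇒∣m+n P∣Y (∣m⇒∣-m (∣n⇒∣m*n β P∣f))
        , subst (P ^ suc (suc k) ∣_) (sym (newton (res q m) (res b m) (res c m) β (Y k)))
            (*-pres-∣ P∣bracket d′)
        where
        m = suc (suc k)
        d′ : P ^ suc k ∣ f m (Y k)
        d′ = ∣-resp-mod (mod-sym (f-mod k (Y k))) d
        P∣f : P ∣ f m (Y k)
        P∣f = ∣-trans (P∣P^suc k) d′
        P∣bracket : P ∣ - (res b m * β - 1ℤ) + (- ((+ 2) * res c m * β) * Y k + res c m * (β * β) * f m (Y k))
        P∣bracket = ∣m∣n⇒∣m+n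
          (∣m⇒∣-m (∣-diff (mod-trans (mod-* (res-suc-mod-P b (suc k)) (mod-refl {x = β})) bβ≡1)))
          (∣m∣n⇒∣m+n (∣n⇒∣m*n (- ((+ 2) * res c m * β)) P∣Y) (∣n⇒∣m*n (res c m * (β * β)) P∣f))

      root : ℕ → ℤ
      root zero    = 0ℤ
      root (suc k) = Y k

      root-coherent : ∀ m → P ^ m ∣ root (suc m) - root m
      root-coherent zero    = divides (Y 0 - 0ℤ) refl
      root-coherent (suc k) = subst (P ^ suc k ∣_) (lemma (Y k) β (f (suc (suc k)) (Y k)))
        (∣n⇒∣m*n (- β) (∣-resp-mod (mod-sym (f-mod k (Y k))) (proj₂ (Y-invariant k))))
        where
        lemma : ∀ y β z → (- β) * z ≡ (y - β * z) - y
        lemma = solve-∀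

      root-zero : ∀ m → P ^ m ∣ f m (root m)
      root-zero zero    = divides (f 0 0ℤ) (sym (ℤ.*-identityʳ _))
      root-zero (suc k) = proj₂ (Y-invariant k)

    -- At precision m, r is the rational number z / p^G.
    Represents : ℕ → ℕ → ℚₚ p → ℤ → Set
    Represents m G r z = res (ℚₚ.num r) m * P ^ G ≡ z * P ^ ℚₚ.exp r

    open RawRing (ℚₚ-rawRing p) using (0#) renaming (_*_ to _·_; _+_ to _+ᵩ_; _≈_ to _≈ᵩ_; rawSemiring to ℚₚ-rawSemiring) public
    open RawSemiringDefs ℚₚ-rawSemiring using (sum) renaming (_^_ to _^ᵩ_) public

    module _ (m G : ℕ) where

      represents-sum : ∀ {d} {r : Vector (ℚₚ p) d} {z} →
        (∀ i → Represents m G (r i) (z i)) → Represents m G (sum r) (∑ z)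
      represents-sum {zero}          rep = refl
      represents-sum {suc d} {r} {z} rep = begin
        (N * P ^ F′ + N′ * P ^ F) * P ^ G        ≡⟨ lemma₁ N (P ^ F′) N′ (P ^ F) (P ^ G) ⟩
        N * P ^ G * P ^ F′ + N′ * P ^ G * P ^ F  ≡⟨ cong₂ (λ a b → a * P ^ F′ + b * P ^ F) (rep zero) (represents-sum (rep ∘ suc)) ⟩
        z zero * P ^ F * P ^ F′ + z′ * P ^ F′ * P ^ F  ≡⟨ lemma₂ (z zero) (P ^ F) (P ^ F′) z′ ⟩
        (z zero + z′) * (P ^ F * P ^ F′)         ≡⟨ cong ((z zero + z′) *_) (ℤ.^-distribˡ-+-* P F F′) ⟨
        (z zero + z′) * P ^ (F ℕ.+ F′)           ∎
        where
        open ≡-Reasoning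
        N  = res (ℚₚ.num (r zero)) m
        F  = ℚₚ.exp (r zero)
        N′ = res (ℚₚ.num (sum (r ∘ suc))) m
        F′ = ℚₚ.exp (sum (r ∘ suc))
        z′ = ∑ (z ∘ suc)
        lemma₁ : ∀ a b c d g → (a * b + c * d) * g ≡ a * g * b + c * g * d
        lemma₁ = solve-∀
        lemma₂ : ∀ a f f′ b → a * f * f′ + b * f′ * f ≡ (a + b) * (f * f′)
        lemma₂ = solve-∀

    represents-monomial : ∀ m E (a : ℤₚ p) (x : ℚₚ p) y →
      Represents m E x y → Represents m (E ℕ.+ E) (ι a · x ^ᵩ 2) (res a m * (y * y))
    represents-monomial m E a (x /p^ e) y rep = begin
      A * (X * (X * 1ℤ)) * P ^ (E ℕ.+ E)          ≡⟨ cong (A * (X * (X * 1ℤ)) *_) (ℤ.^-distribˡ-+-* P E E) ⟩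
      A * (X * (X * 1ℤ)) * (P ^ E * P ^ E)        ≡⟨ lemma₁ A X (P ^ E) ⟩
      A * ((X * P ^ E) * (X * P ^ E))             ≡⟨ cong (λ s → A * (s * s)) rep ⟩
      A * ((y * P ^ e) * (y * P ^ e))             ≡⟨ lemma₂ A y (P ^ e) ⟩
      A * (y * y) * (P ^ e * P ^ e)               ≡⟨ cong (A * (y * y) *_) (ℤ.^-distribˡ-+-* P e e) ⟨
      A * (y * y) * P ^ (e ℕ.+ e)                 ≡⟨ cong (λ k → A * (y * y) * P ^ (e ℕ.+ k)) (ℕ.+-identityʳ e) ⟨
      A * (y * y) * P ^ (e ℕ.+ (e ℕ.+ 0))         ∎
      where
      open ≡-Reasoning
      A = res a m
      X = res x m
      lemma₁ : ∀ a x e → a * (x * (x * 1ℤ)) * (e * e) ≡ a * ((x * e) * (x * e))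
      lemma₁ = solve-∀
      lemma₂ : ∀ a x e → a * ((x * e) * (x * e)) ≡ a * (x * x) * (e * e)
      lemma₂ = solve-∀

    -- The head and the tail of the sum are separate arguments, so that the tail can be inferred
    -- from DiagonalPoint: comparing two given sums would compare the coherence proofs of their terms.
    sum-zero : ∀ {d} (h : ℚₚ p) (g : Vector (ℚₚ p) d) (z : ℕ → Vector ℤ (suc d)) →
      (∀ m → P ^ m ∣ ∑ (z m)) → (∀ m → Represents m 0 h (z m zero)) →
      (∀ m i → Represents m 0 (g i) (z m (suc i))) → (h +ᵩ sum g) ≈ᵩ 0#
    sum-zero h g z P^m∣z rep₀ rep m = subst (P ^ m ∣_)
      (trans (sym (represents-sum m 0 {r = h Vector.∷ g} {z m} (λ { zero → rep₀ m ; (suc i) → rep m i })))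
        (lemma (res (ℚₚ.num (h +ᵩ sum g)) m * 1ℤ) (P ^ ℚₚ.exp (h +ᵩ sum g))))
      (∣m⇒∣m*n (P ^ ℚₚ.exp (h +ᵩ sum g)) (P^m∣z m))
      where
      lemma : ∀ s f → s ≡ s - 0ℤ * f
      lemma = solve-∀

    -- The numerator of the sum is 0 in `ℤₚ`, whereas the integer sum is reached only after
    -- multiplication by the denominator `P ^ F`. As `F` does not depend on `m`, this costs a fixed
    -- number of digits.
    sum-zero⁻ : ∀ {d} G (h : ℚₚ p) (g : Vector (ℚₚ p) d) (z : ℕ → Vector ℤ (suc d)) →
      (h +ᵩ sum g) ≈ᵩ 0# → (∀ m → Represents m G h (z m zero)) →
      (∀ m i → Represents m G (g i) (z m (suc i))) → ∃[ F ] (∀ m → P ^ m ∣ P ^ F * ∑ (z m))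
    sum-zero⁻ G h g z r≈0 rep₀ rep = ℚₚ.exp (h +ᵩ sum g) , λ m → subst (P ^ m ∣_)
      (trans (represents-sum m G {r = h Vector.∷ g} {z m} (λ { zero → rep₀ m ; (suc i) → rep m i }))
        (ℤ.*-comm (∑ (z m)) (P ^ ℚₚ.exp (h +ᵩ sum g))))
      (∣m⇒∣m*n (P ^ G) (subst (P ^ m ∣_) (lemma (res (ℚₚ.num (h +ᵩ sum g)) m) (P ^ ℚₚ.exp (h +ᵩ sum g))) (r≈0 m)))
      where
      lemma : ∀ s f → s * 1ℤ - 0ℤ * f ≡ s
      lemma = solve-∀

    diagonal-point : ∀ {n} (a : Vector (ℤₚ p) (suc n)) (X : Vector (ℚₚ p) (suc n)) (y : ℕ → Vector ℤ (suc n)) →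
      ¬ (∀ i → X i ≈ᵩ 0#) → (∀ m i → Represents m 0 (X i) (y m i)) →
      (∀ m → P ^ m ∣ ∑ (λ i → res (a i) m * (y m i * y m i))) → DiagonalPoint p n 2 a
    diagonal-point {n} a X y X≢0 rep div = record
      { coords = X
      ; nonzero = X≢0
      ; equation = sum-zero {n} (ι (a zero) · X zero ^ᵩ 2) _ (λ m i → res (a i) m * (y m i * y m i)) div
          (λ m → represents-monomial m 0 (a zero) (X zero) (y m zero) (rep m zero))
          (λ m i → represents-monomial m 0 (a (suc i)) (X (suc i)) (y m (suc i)) (rep m (suc i)))
      }

    diagonal-point⁻ : ∀ {n} (a : Vector (ℤₚ p) (suc n)) (pt : DiagonalPoint p n 2 a) E (y : ℕ → Vector ℤ (suc n)) →
      (∀ m i → Represents m E (DiagonalPoint.coords pt i) (y m i)) →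
      ∃[ F ] (∀ m → P ^ m ∣ P ^ F * ∑ (λ i → res (a i) m * (y m i * y m i)))
    diagonal-point⁻ {n} a pt E y rep =
      sum-zero⁻ {n} (E ℕ.+ E) (ι (a zero) · X zero ^ᵩ 2) _ (λ m i → res (a i) m * (y m i * y m i)) (DiagonalPoint.equation pt)
        (λ m → represents-monomial m E (a zero) (X zero) (y m zero) (rep m zero))
        (λ m i → represents-monomial m E (a (suc i)) (X (suc i)) (y m (suc i)) (rep m (suc i)))
      where
      X = DiagonalPoint.coords pt

-- Diagonal forms graded by parity: descent, lifting, and the passage to points.

module DiagonalForms where

  open Congruence
  open PadicPoints
  open import Data.Bool.Base using (Bool; true; false; not; _∧_; _xor_)
  open import Data.Bool.Properties using (xor-same)
  open import Data.Fin.Base using (Fin; zero; suc)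
  import Data.Integer.Base as ℤ
  open import Data.Integer.Base using (ℤ; +_; -_; _+_; _-_; _*_; _^_; 0ℤ; 1ℤ)
  import Data.Integer.Properties as ℤ
  open import Data.Integer.Divisibility.Signed
  open import Data.Integer.Tactic.RingSolver using (solve-∀)
  open import Data.Nat.Base as ℕ using (ℕ; zero; suc)
  import Data.Nat.Properties as ℕ
  import Data.Nat.Tactic.RingSolver as ℕ-Solver
  open import Data.Nat.Primality using (Prime)
  open import Data.Product.Base using (_×_; _,_; ∃-syntax; Σ-syntax; proj₁; proj₂)
  open import Data.Vec.Functional as Vector using (Vector)
  open import Data.Vec.Functional.Properties using (updateAt-updates)
  open import Function.Base using (_∘_; const)
  open import Relation.Binary.PropositionalEquality
  open import Relation.Nullary.Negation using (¬_)

  bit : Bool → ℕ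
  bit false = 0
  bit true  = 1

  update : ∀ {A : Set} {d} → Vector A d → Fin d → A → Vector A d
  update z j x = Vector.updateAt z j (const x)

  update-self : ∀ {d} (z : Vector ℤ d) j i → update z j (z j) i ≡ z i
  update-self z zero    zero    = refl
  update-self z zero    (suc i) = refl
  update-self z (suc j) zero    = refl
  update-self z (suc j) (suc i) = update-self (z ∘ suc) j i

  module Forms {p : ℕ} (pr : Prime p) where

    open PrimeModulus pr
    open Padic pr

    -- ε records the parities of the valuations of the coefficients of a diagonal form.
    -- Up to squares, the form is form false, and p times it is form true.
    form : ∀ {d} → Bool → Vector Bool d → Vector ℤ d → Vector ℤ d → ℤ
    form b ε u z = ∑ (λ i → P ^ bit (ε i xor b) * (u i * (z i * z i)))

    form-cong : ∀ {d} b (ε : Vector Bool d) u {z w} → (∀ i → z i ≡ w i) → form b ε u z ≡ form b ε u w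
    form-cong b ε u z≡w = ∑-cong (λ i → cong (λ x → P ^ bit (ε i xor b) * (u i * (x * x))) (z≡w i))

    form-mod : ∀ {n d} b (ε : Vector Bool d) u v z w → (∀ i → u i ≡ v i mod n) → (∀ i → z i ≡ w i mod n) →
      form b ε u z ≡ form b ε v w mod n
    form-mod b ε u v z w u≡v z≡w = ∑-mod (λ i →
      mod-*ˡ (P ^ bit (ε i xor b)) (mod-* (u≡v i) (mod-* (z≡w i) (z≡w i))))

    form-update : ∀ {d} b (ε : Vector Bool d) u z j x → ε j ≡ b →
      form b ε u (update z j x) ≡ u j * (x * x) + form b ε u (update z j 0ℤ)
    form-update b ε u z zero x refl rewrite xor-same (ε zero) = lemma (u zero) x _
      where
      lemma : ∀ u x r → 1ℤ * (u * (x * x)) + r ≡ u * (x * x) + (1ℤ * (u * (0ℤ * 0ℤ)) + r)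
      lemma = solve-∀
    form-update b ε u z (suc j) x εj≡b = trans
      (cong (_+_ h) (form-update b (ε ∘ suc) (u ∘ suc) (z ∘ suc) j x εj≡b))
      (lemma h (u (suc j) * (x * x)) _)
      where
      h = P ^ bit (ε zero xor b) * (u zero * (z zero * z zero))
      lemma : ∀ h a r → h + (a + r) ≡ a + (h + r)
      lemma = solve-∀

    -- Only the coordinates with a unit coefficient in `form b` are constrained. Both values of `b`
    -- are included because the descent alternates between the two forms.
    Anisotropic : ∀ {d} → ℕ → Vector Bool d → Vector ℤ d → Set
    Anisotropic n ε u = ∀ b z → P ^ n ∣ form b ε u z → ∀ j → ε j ≡ b → P ∣ z j

    module _ {d n} {ε : Vector Bool d} {u : Vector ℤ d} (aniso : Anisotropic (suc n) ε u) where

      private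
        scale : Bool → Bool → ℤ
        scale b e = P ^ bit (not (e xor b))

        square-scaled : ∀ b e u w →
          P ^ bit (e xor b) * (u * ((scale b e * w) * (scale b e * w))) ≡ P * (P ^ bit (e xor not b) * (u * (w * w)))
        square-scaled false false u w = lemma P u w
          where
          lemma : ∀ P u w → 1ℤ * (u * ((P * 1ℤ * w) * (P * 1ℤ * w))) ≡ P * (P * 1ℤ * (u * (w * w)))
          lemma = solve-∀
        square-scaled true  true  u w = square-scaled false false u w
        square-scaled true  false u w = lemma P u w
          where
          lemma : ∀ P u w → P * 1ℤ * (u * ((1ℤ * w) * (1ℤ * w))) ≡ P * (1ℤ * (u * (w * w)))
          lemma = solve-∀
        square-scaled false true  u w = square-scaled true false u w

        scale-twice : ∀ b e w → scale b e * (scale (not b) e * w) ≡ P * w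
        scale-twice false false w = lemma P w
          where
          lemma : ∀ P w → P * 1ℤ * (1ℤ * w) ≡ P * w
          lemma = solve-∀
        scale-twice true  true  w = scale-twice false false w
        scale-twice true  false w = lemma P w
          where
          lemma : ∀ P w → 1ℤ * (P * 1ℤ * w) ≡ P * w
          lemma = solve-∀
        scale-twice false true  w = scale-twice true false w

        take-out : ∀ b e x → (e ≡ b → P ∣ x) → ∃[ w ] x ≡ scale b e * w
        take-out false false x P∣x = quotient (P∣x refl) , trans (_∣_.equality (P∣x refl)) (lemma P (quotient (P∣x refl)))
          where
          lemma : ∀ P q → q * P ≡ P * 1ℤ * q
          lemma = solve-∀
        take-out true  true  x P∣x = take-out false false x (λ _ → P∣x refl)
        take-out true  false x P∣x = x , sym (ℤ.*-identityˡ x)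
        take-out false true  x P∣x = x , sym (ℤ.*-identityˡ x)

      -- The coordinates of parity b are divisible by p; taking this factor out turns
      -- form b into p times form (not b).
      half-descent : ∀ b z k → P ^ suc (k ℕ.+ suc n) ∣ form b ε u z →
        ∃[ w ] (∀ j → z j ≡ scale b (ε j) * w j) × P ^ (k ℕ.+ suc n) ∣ form (not b) ε u w
      half-descent b z k P∣F = w , z≡ , ^-cancel-∣ 1 {k ℕ.+ suc n} {form (not b) ε u w}
        (subst (P ^ suc (k ℕ.+ suc n) ∣_)
          (trans (form-cong b ε u z≡)
          (trans (∑-cong (λ j → square-scaled b (ε j) (u j) (w j)))
          (trans (sym (*-distribˡ-∑ P (λ j → P ^ bit (ε j xor not b) * (u j * (w j * w j)))))
                 (cong (_* form (not b) ε u w) (sym (ℤ.^-identityʳ P))))))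
          P∣F)
        where
        d′ : P ^ suc n ∣ form b ε u z
        d′ = ∣-trans (^-monoʳ-∣ P (ℕ.m≤n+m (suc n) (suc k))) P∣F

        divided : ∀ j → ∃[ w ] z j ≡ scale b (ε j) * w
        divided j = take-out b (ε j) (z j) (aniso b z d′ j)

        w : Vector ℤ d
        w j = proj₁ (divided j)

        z≡ : ∀ j → z j ≡ scale b (ε j) * w j
        z≡ j = proj₂ (divided j)

      -- Two half-descents lead back to the same form, consume two factors `P` of its value, and
      -- take exactly one factor `P` out of every coordinate, whatever its parity (`scale-twice`).
      -- Hence `r + r` factors pay for `P ^ r`.
      descent : ∀ r b z → P ^ ((r ℕ.+ r) ℕ.+ suc n) ∣ form b ε u z → ∀ j → P ^ r ∣ z j
      descent zero    b z d j = divides (z j) (sym (ℤ.*-identityʳ (z j)))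
      descent (suc r) b z d j =
        subst (P ^ suc r ∣_)
          (sym (trans (z≡w j) (trans (cong (scale b (ε j) *_) (w≡w′ j)) (scale-twice b (ε j) (w′ j)))))
          (*-pres-∣ {P} {P} {P ^ r} {w′ j} ∣-refl (descent r (not (not b)) w′ (proj₂ (proj₂ second)) j))
        where
        first = half-descent b z (r ℕ.+ suc r) d
        w = proj₁ first
        z≡w = proj₁ (proj₂ first)
        second = half-descent (not b) w (r ℕ.+ r)
          (subst (λ k → P ^ (k ℕ.+ suc n) ∣ form (not b) ε u w) (ℕ.+-suc r r) (proj₂ (proj₂ first)))
        w′ = proj₁ second
        w≡w′ = proj₁ (proj₂ second)

    -- `c x² + d` is a form in which one coordinate varies. The precision `n` is left open because
    -- the derivative `2 c z` is a unit for odd `p`, where `n = 1` works, but not for `p = 2`, where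
    -- `n = 3` is used.
    Hensel : ℕ → Set
    Hensel n = ∀ (c d : ℤₚ p) z → ¬ (P ∣ res c 1) → ¬ (P ∣ z) → P ^ n ∣ res c n * (z * z) + res d n →
      Σ[ x ∈ ℤₚ p ] (∀ m → P ^ m ∣ res c m * (res x m * res x m) + res d m) × ¬ (P ∣ res x 1)

    -- All coordinates except `j` are frozen at the integers `z`. What remains is one variable with
    -- leading coefficient `u j`, a unit: since `j` has parity `b`, its coefficient carries no
    -- factor `P`.
    lift : ∀ {n d} → Hensel n → ∀ b (ε : Vector Bool d) (u : Vector (ℤₚ p) d) (z : Vector ℤ d) j →
      ε j ≡ b → ¬ (P ∣ z j) → ¬ (P ∣ res (u j) 1) → P ^ n ∣ form b ε (λ i → res (u i) n) z →
      Σ[ x ∈ Vector (ℤₚ p) d ] (∀ m → P ^ m ∣ form b ε (λ i → res (u i) m) (λ i → res (x i) m)) × ¬ (P ∣ res (x j) 1)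
    lift {n} {d} hensel b ε u z j εj≡b P∤z P∤u div =
      X x
      , (λ m → subst (P ^ m ∣_)
          (trans (sym (form-update b ε (λ i → res (u i) m) z j (res x m) εj≡b)) (form-cong b ε (λ i → res (u i) m) (λ i → sym (res-X x z j i m))))
          (proj₁ (proj₂ corrected) m))
      , subst (λ y → ¬ (P ∣ res y 1)) (sym (updateAt-updates j (λ i → fromℤ (z i)))) (proj₂ (proj₂ corrected))
      where
      rest : ℤₚ p
      rest = record
        { res = λ m → form b ε (λ i → res (u i) m) (update z j 0ℤ)
        ; coherent = λ m → ∣-diff (form-mod b ε (λ i → res (u i) (suc m)) (λ i → res (u i) m) (update z j 0ℤ) (update z j 0ℤ)
          (λ i → congruent (coherent (u i) m)) (λ i → mod-refl)) }

      corrected = hensel (u j) rest (z j) P∤u P∤z (subst (P ^ n ∣_)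
        (trans (form-cong b ε (λ i → res (u i) n) (λ i → sym (update-self z j i))) (form-update b ε (λ i → res (u i) n) z j (z j) εj≡b)) div)

      x : ℤₚ p
      x = proj₁ corrected

      X : ℤₚ p → Vector (ℤₚ p) d
      X x = update (λ i → fromℤ (z i)) j x

      res-X : ∀ {d} x (z : Vector ℤ d) j i m →
        res (update (λ i → fromℤ (z i)) j x i) m ≡ update z j (res x m) i
      res-X x z zero    zero    m = refl
      res-X x z zero    (suc i) m = refl
      res-X x z (suc j) zero    m = refl
      res-X x z (suc j) (suc i) m = res-X x (z ∘ suc) j i m

    valuation : Bool → ℕ → ℕ
    valuation ε k = bit ε ℕ.+ (k ℕ.+ k)

    module _ {n} {a : Vector (ℤₚ p) (suc n)} {ε : Vector Bool (suc n)} {k : Vector ℕ (suc n)} {u : Vector (ℤₚ p) (suc n)}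
      (M : ℕ) (k≤M : ∀ i → k i ℕ.≤ M) (a≈ : ∀ i → a i ≈P^ valuation (ε i) (k i) * u i) where

      -- Rescaling the coordinates by powers of `P` makes the original form equal to
      -- `P ^ (2M + bit b)` times `form b` evaluated at `x`; `k i ≤ M` keeps these powers integral.
      point : ∀ b (x : Vector (ℤₚ p) (suc n)) j →
        (∀ m → P ^ m ∣ form b ε (λ i → res (u i) m) (λ i → res (x i) m)) → ¬ (P ∣ res (x j) 1) →
        DiagonalPoint p n 2 a
      point b x j zero-at P∤x = diagonal-point a X y X≢0 (λ m i → refl) P^m∣∑
        where
        e : Vector ℕ (suc n)
        -- The first summand raises every square part to `P ^ (2M)`. For `b = true` the coordinates
        -- of even parity need one more factor, which turns their coefficient `P ^ 0` into `P ^ 2`,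
        -- the common factor `P` times the `P` of `form true`.
        e i = (M ℕ.∸ k i) ℕ.+ bit (b ∧ not (ε i))

        X : Vector (ℚₚ p) (suc n)
        X i = ι (pow p (e i) *ₚ x i)

        bits : ∀ b ε → bit ε ℕ.+ (bit (b ∧ not ε) ℕ.+ bit (b ∧ not ε)) ≡ bit b ℕ.+ bit (ε xor b)
        bits false false = refl
        bits false true  = refl
        bits true  false = refl
        bits true  true  = refl

        exponents : ∀ i → valuation (ε i) (k i) ℕ.+ (e i ℕ.+ e i) ≡ (M ℕ.+ M ℕ.+ bit b) ℕ.+ bit (ε i xor b)
        exponents i = begin
          (bit (ε i) ℕ.+ (k i ℕ.+ k i)) ℕ.+ (e i ℕ.+ e i)                ≡⟨ lemma (bit (ε i)) (k i) (M ℕ.∸ k i) (bit (b ∧ not (ε i))) ⟩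
          (m ℕ.+ m) ℕ.+ (bit (ε i) ℕ.+ (bit (b ∧ not (ε i)) ℕ.+ bit (b ∧ not (ε i)))) ≡⟨ cong₂ (λ r s → (r ℕ.+ r) ℕ.+ s) (ℕ.m∸n+n≡m (k≤M i)) (bits b (ε i)) ⟩
          (M ℕ.+ M) ℕ.+ (bit b ℕ.+ bit (ε i xor b))                      ≡⟨ ℕ.+-assoc (M ℕ.+ M) (bit b) (bit (ε i xor b)) ⟨
          (M ℕ.+ M ℕ.+ bit b) ℕ.+ bit (ε i xor b)                        ∎
          where
          open ≡-Reasoning
          m = M ℕ.∸ k i ℕ.+ k i
          lemma : ∀ v k l c → (v ℕ.+ (k ℕ.+ k)) ℕ.+ ((l ℕ.+ c) ℕ.+ (l ℕ.+ c)) ≡ ((l ℕ.+ k) ℕ.+ (l ℕ.+ k)) ℕ.+ (v ℕ.+ (c ℕ.+ c))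
          lemma = ℕ-Solver.solve-∀

        monomial : ∀ i U x → P ^ valuation (ε i) (k i) * U * ((P ^ e i * x) * (P ^ e i * x))
          ≡ P ^ (M ℕ.+ M ℕ.+ bit b) * (P ^ bit (ε i xor b) * (U * (x * x)))
        monomial i U x = begin
          P ^ v * U * ((P ^ e i * x) * (P ^ e i * x))         ≡⟨ lemma (P ^ v) U (P ^ e i) x ⟩
          P ^ v * (P ^ e i * P ^ e i) * (U * (x * x))         ≡⟨ cong (_* (U * (x * x))) (cong (P ^ v *_) (ℤ.^-distribˡ-+-* P (e i) (e i))) ⟨
          P ^ v * P ^ (e i ℕ.+ e i) * (U * (x * x))           ≡⟨ cong (_* (U * (x * x))) (ℤ.^-distribˡ-+-* P v (e i ℕ.+ e i)) ⟨
          P ^ (v ℕ.+ (e i ℕ.+ e i)) * (U * (x * x))           ≡⟨ cong (λ s → P ^ s * (U * (x * x))) (exponents i) ⟩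
          P ^ ((M ℕ.+ M ℕ.+ bit b) ℕ.+ bit (ε i xor b)) * (U * (x * x)) ≡⟨ cong (_* (U * (x * x))) (ℤ.^-distribˡ-+-* P (M ℕ.+ M ℕ.+ bit b) (bit (ε i xor b))) ⟩
          P ^ (M ℕ.+ M ℕ.+ bit b) * P ^ bit (ε i xor b) * (U * (x * x)) ≡⟨ ℤ.*-assoc (P ^ (M ℕ.+ M ℕ.+ bit b)) _ _ ⟩
          P ^ (M ℕ.+ M ℕ.+ bit b) * (P ^ bit (ε i xor b) * (U * (x * x))) ∎
          where
          open ≡-Reasoning
          v = valuation (ε i) (k i)
          lemma : ∀ a u e x → a * u * ((e * x) * (e * x)) ≡ a * (e * e) * (u * (x * x))
          lemma = solve-∀

        X≢0 : ¬ (∀ i → X i ≈ᵩ 0#)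
        -- One digit beyond `e j` suffices: `P ^ suc (e j)` would divide `P ^ e j * x j`, so `P`
        -- would divide the unit `x j`.
        X≢0 X≈0 = P∤x (∣-resp-mod (res-suc-mod-P (x j) (e j)) (subst (_∣ res (x j) (suc (e j))) (ℤ.^-identityʳ P)
          (^-cancel-∣ (e j) (subst₂ _∣_ (cong (P ^_) (ℕ.+-comm 1 (e j))) (lemma (P ^ e j) (res (x j) (suc (e j)))) (X≈0 j (suc (e j)))))))
          where
          lemma : ∀ a x → a * x * 1ℤ - 0ℤ * 1ℤ ≡ a * x
          lemma = solve-∀

        y : ℕ → Vector ℤ (suc n)
        y m i = P ^ e i * res (x i) m

        P^m∣∑ : ∀ m → P ^ m ∣ ∑ (λ i → res (a i) m * (y m i * y m i))
        P^m∣∑ m = ∣-resp-mod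
          (mod-sym (mod-trans (∑-mod {f = λ i → res (a i) m * (y m i * y m i)}
              {g = λ i → P ^ valuation (ε i) (k i) * res (u i) m * (y m i * y m i)} (λ i → mod-* (a≈ i m) (mod-refl {x = y m i * y m i})))
            (≡⇒mod (trans (∑-cong (λ i → monomial i (res (u i) m) (res (x i) m)))
              (sym (*-distribˡ-∑ (P ^ (M ℕ.+ M ℕ.+ bit b)) (λ i → P ^ bit (ε i xor b) * (res (u i) m * (res (x i) m * res (x i) m)))))))))
          (∣n⇒∣m*n (P ^ (M ℕ.+ M ℕ.+ bit b)) (zero-at m))

      -- With denominators cleared and the factors `P ^ k i` absorbed into the coordinates, a point
      -- gives zeros of `form false` to every precision. Descent then makes each coordinate
      -- divisible by arbitrarily high powers of `P`, hence zero. Residues of `u` of unbounded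
      -- precision occur, so anisotropy is assumed for all of them.
      no-point : ∀ l → (∀ m → Anisotropic (suc l) ε (λ i → res (u i) (m ℕ.+ suc l))) → ¬ DiagonalPoint p n 2 a
      no-point l aniso pt = nonzero coords≈0
        where
        open DiagonalPoint pt
        total : ∀ {d} → Vector ℕ d → ℕ
        total = Vector.foldr ℕ._+_ 0

        ≤-total : ∀ {d} (e : Vector ℕ d) i → e i ℕ.≤ total e
        ≤-total e zero    = ℕ.m≤m+n (e zero) _
        ≤-total e (suc i) = ℕ.≤-trans (≤-total (e ∘ suc) i) (ℕ.m≤n+m _ (e zero))

        e : Vector ℕ (suc n)
        e i = ℚₚ.exp (coords i)
        E : ℕ
        E = total e

        Y : ℕ → Vector ℤ (suc n)
        Y m i = P ^ (E ℕ.∸ e i) * res (ℚₚ.num (coords i)) m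

        coordinate : ∀ m i → Represents m E (coords i) (Y m i)
        coordinate m i = trans
          (cong (res (ℚₚ.num (coords i)) m *_)
            (trans (cong (P ^_) (sym (ℕ.m∸n+n≡m (≤-total e i)))) (ℤ.^-distribˡ-+-* P (E ℕ.∸ e i) (e i))))
          (lemma (res (ℚₚ.num (coords i)) m) (P ^ (E ℕ.∸ e i)) (P ^ e i))
          where
          lemma : ∀ x a b → x * (a * b) ≡ a * x * b
          lemma = solve-∀

        cleared = diagonal-point⁻ a pt E Y coordinate

        F : ℕ
        F = proj₁ cleared

        coords≈0 : ∀ j → coords j ≈ᵩ 0#
        coords≈0 j m₀ = subst (P ^ m₀ ∣_) (lemma₀ (res (ℚₚ.num (coords j)) m₀) (P ^ e j))
          (∣-resp-mod (res-≤ (ℚₚ.num (coords j)) m₀≤m)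
            (^-cancel-∣ (k j ℕ.+ (E ℕ.∸ e j)) (∣-trans (^-monoʳ-∣ P r≥)
              (subst (P ^ r ∣_) (lemma₁ j) (descent {u = λ i → res (u i) m} (aniso (F ℕ.+ (r ℕ.+ r))) r false z P∣form j)))))
          where
          -- `z j` exceeds the numerator of the coordinate by a power of `P` with exponent at most
          -- `M + E`, so divisibility by `P ^ r` leaves `P ^ m₀` for that numerator.
          r = (M ℕ.+ E) ℕ.+ m₀
          -- `F` digits are lost to the denominator of the sum, and a descent of depth `r` uses the
          -- remaining `r + r + suc l`.
          m = (F ℕ.+ (r ℕ.+ r)) ℕ.+ suc l

          x : Vector ℤ (suc n)
          x i = res (ℚₚ.num (coords i)) m
          y z : Vector ℤ (suc n)
          y = Y m
          z i = P ^ k i * y i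

          r≥ : (k j ℕ.+ (E ℕ.∸ e j)) ℕ.+ m₀ ℕ.≤ r
          r≥ = ℕ.+-monoˡ-≤ m₀ (ℕ.+-mono-≤ (k≤M j) (ℕ.m∸n≤m E (e j)))

          m₀≤m : m₀ ℕ.≤ m
          m₀≤m = ℕ.≤-trans (ℕ.m≤n+m m₀ (M ℕ.+ E)) (ℕ.≤-trans (ℕ.m≤m+n r r)
            (ℕ.≤-trans (ℕ.m≤n+m (r ℕ.+ r) F) (ℕ.m≤m+n (F ℕ.+ (r ℕ.+ r)) (suc l))))

          lemma₀ : ∀ x f → x ≡ x * 1ℤ - 0ℤ * f
          lemma₀ = solve-∀

          lemma₁ : ∀ i → z i ≡ P ^ (k i ℕ.+ (E ℕ.∸ e i)) * x i
          lemma₁ i = trans (sym (ℤ.*-assoc (P ^ k i) _ (x i))) (cong (_* x i) (sym (ℤ.^-distribˡ-+-* P (k i) (E ℕ.∸ e i))))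

          P^m∣ : P ^ m ∣ P ^ F * ∑ (λ i → res (a i) m * (y i * y i))
          P^m∣ = proj₂ cleared m

          m≡ : m ≡ F ℕ.+ ((r ℕ.+ r) ℕ.+ suc l)
          m≡ = ℕ.+-assoc F (r ℕ.+ r) (suc l)

          P∣∑ : P ^ ((r ℕ.+ r) ℕ.+ suc l) ∣ ∑ (λ i → res (a i) m * (y i * y i))
          P∣∑ = ^-cancel-∣ F (subst (λ s → P ^ s ∣ P ^ F * ∑ (λ i → res (a i) m * (y i * y i))) m≡ P^m∣)

          monomial : ∀ i U y → P ^ valuation (ε i) (k i) * U * (y * y)
            ≡ P ^ bit (ε i xor false) * (U * ((P ^ k i * y) * (P ^ k i * y)))
          monomial i U y = trans
            (cong (λ s → s * U * (y * y)) (trans (ℤ.^-distribˡ-+-* P (bit (ε i)) (k i ℕ.+ k i))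
              (cong₂ _*_ (cong (λ b → P ^ bit b) (xor-false (ε i))) (ℤ.^-distribˡ-+-* P (k i) (k i)))))
            (lemma (P ^ bit (ε i xor false)) (P ^ k i) U y)
            where
            xor-false : ∀ b → b ≡ b xor false
            xor-false false = refl
            xor-false true  = refl
            lemma : ∀ a k u y → a * (k * k) * u * (y * y) ≡ a * (u * ((k * y) * (k * y)))
            lemma = solve-∀

          P∣form : P ^ ((r ℕ.+ r) ℕ.+ suc l) ∣ form false ε (λ i → res (u i) m) z
          P∣form = ∣-resp-mod (mod-weaken (^-monoʳ-∣ P (subst ((r ℕ.+ r) ℕ.+ suc l ℕ.≤_) (sym m≡) (ℕ.m≤n+m _ F)))
            (mod-trans (∑-mod {f = λ i → res (a i) m * (y i * y i)}
                {g = λ i → P ^ valuation (ε i) (k i) * res (u i) m * (y i * y i)} (λ i → mod-* (a≈ i m) (mod-refl {x = y i * y i})))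
              (≡⇒mod (∑-cong (λ i → monomial i (res (u i) m) (y i))))))
            P∣∑

-- From a classification of units to the measure of the soluble set.

module UnitClassification where

  open Congruence
  open Covers
  open Rationals
  open DiagonalForms
  open PadicPoints
  open import Level using (0ℓ)
  open import Data.Bool.Base using (Bool; true; false; not; _∧_; _∨_; _xor_)
  open import Data.Bool.Properties using (¬-not; ∨-zeroʳ; ∧-conicalˡ; ∧-conicalʳ)
  open import Data.Fin.Base using (Fin; zero; suc; toℕ)
  open import Data.Fin.Properties using (toℕ≤n)
  import Data.Integer.Base as ℤ
  open import Data.Integer.Base using (ℤ; 0ℤ)
  import Data.Integer.Properties as ℤ
  open import Data.Integer.Divisibility.Signed
  open import Data.Integer.Tactic.RingSolver using () renaming (solve-∀ to ℤ-solve-∀)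
  open import Data.List.Base as List using (List; []; _∷_; length)
  open import Data.List.Relation.Unary.Any as Any using (Any; here)
  import Data.List.Relation.Unary.Any.Properties as Any
  open import Data.Nat.Base as ℕ using (ℕ; zero; suc; s≤s)
  import Data.Nat.Properties as ℕ
  import Data.Nat.Tactic.RingSolver as ℕ-Solver
  open import Data.Nat.Primality using (Prime)
  open import Data.Product.Base using (_×_; _,_; ∃-syntax; proj₁; proj₂)
  open import Data.Rational.Base as ℚ using (ℚ; 0ℚ; 1ℚ; _+_; _*_; _-_; _÷_; _≤_; _<_)
  import Data.Rational.Properties as ℚ
  open import Data.Sum.Base as Sum using (_⊎_; inj₁; inj₂)
  open import Data.Vec.Base as Vec using (Vec; []; _∷_; lookup)
  open import Data.Vec.Functional as Vector using (Vector)
  open import Function.Base using (_∘_; id)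
  open import Relation.Binary.PropositionalEquality
  open import Relation.Nullary.Negation using (¬_; contradiction)
  open import Relation.Nullary.Decidable.Core using (yes; no)
  open import Data.Unit.Base using (tt)
  open import Relation.Unary using (Pred; ∁)
  open import Tactic.RingSolver using (solve-∀)

  open ℚ-Semiring using () renaming (_×_ to _×ℚ_)

  ∨-true⁻ : ∀ x {y} → x ∨ y ≡ true → x ≡ true ⊎ y ≡ true
  ∨-true⁻ true  _  = inj₁ refl
  ∨-true⁻ false eq = inj₂ eq

  ∨-true₁ : ∀ {x} y → x ≡ true → x ∨ y ≡ true
  ∨-true₁ y refl = refl

  ∨-true₂ : ∀ x {y} → y ≡ true → x ∨ y ≡ true
  ∨-true₂ x refl = ∨-zeroʳ x

  everyFin : ∀ {n} → (Fin n → Bool) → Bool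
  everyFin = Vector.foldr _∧_ true

  every : ∀ {N} d → (Vec (Label N) d → Bool) → Bool
  every zero    f = f []
  every (suc d) f = everyFin (λ c → every d (λ ls → f ((false , c) ∷ ls)))
                  ∧ everyFin (λ c → every d (λ ls → f ((true  , c) ∷ ls)))

  everyFin-sound : ∀ {n} (f : Fin n → Bool) → everyFin f ≡ true → ∀ i → f i ≡ true
  everyFin-sound f eq zero    = ∧-conicalˡ (f zero) _ eq
  everyFin-sound f eq (suc i) = everyFin-sound (f ∘ suc) (∧-conicalʳ (f zero) _ eq) i

  every-sound : ∀ {N d} (f : Vec (Label N) d → Bool) → every d f ≡ true → ∀ ls → f ls ≡ true
  every-sound f eq []                 = eq
  every-sound f eq ((false , c) ∷ ls) = every-sound _ (everyFin-sound _ (∧-conicalˡ _ _ eq) c) ls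
  every-sound f eq ((true  , c) ∷ ls) = every-sound _ (everyFin-sound _ (∧-conicalʳ _ _ eq) c) ls

  eval-⨁-zero : ∀ {n} (f : Fin n → Poly) x → (∀ i → eval (f i) x ≡ 0ℚ) → eval (⨁ f) x ≡ 0ℚ
  eval-⨁-zero {zero}  f x f≡0 = refl
  eval-⨁-zero {suc n} f x f≡0 = trans (eval-⊕ (f zero) _ x) (cong₂ _+_ (f≡0 zero) (eval-⨁-zero (f ∘ suc) x (f≡0 ∘ suc)))

  tally-none : ∀ {N} d x → eval (tally {N} d (λ _ → false)) x ≡ 0ℚ
  tally-none     zero    x = trans (ℚ.+-identityˡ _) (ℚ.*-zeroʳ x)
  tally-none {N} (suc d) x = begin
    eval (⨁ F ⊕ (0 ∷ ⨁ F)) x          ≡⟨ eval-⊕ (⨁ F) (0 ∷ ⨁ F) x ⟩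
    eval (⨁ F) x + (0ℚ + x * eval (⨁ F) x)  ≡⟨ cong (λ a → a + (0ℚ + x * a)) (eval-⨁-zero F x (λ _ → tally-none d x)) ⟩
    0ℚ + (0ℚ + x * 0ℚ)                ≡⟨ cong (λ a → 0ℚ + (0ℚ + a)) (ℚ.*-zeroʳ x) ⟩
    0ℚ                                ∎
    where
    open ≡-Reasoning
    F : Fin N → Poly
    F _ = tally d (λ _ → false)

  parity : ∀ {N d} → Vec (Label N) d → Vector Bool d
  parity ls i = proj₁ (lookup ls i)

  class : ∀ {N d} → Vec (Label N) d → Vector (Fin N) d
  class ls i = proj₂ (lookup ls i)

  -- Finitely many classes of units, which decide whether a diagonal form with labelled
  -- coefficients has a zero modulo p^(suc l) in which some unit coordinate has a unit coefficient.
  record UnitClasses (p : ℕ) {{pr : Prime p}} : Set₁ where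
    open Padic pr
    open Forms pr
    field
      N l           : ℕ
      Class         : Fin N → ℤ → Set
      Class-resp    : ∀ {c x y} → x ≡ y mod (P ℤ.^ suc l) → Class c x → Class c y
      classify      : ∀ z → ¬ (P ∣ z) → ∃[ c ] Class c z
      Class-unit    : ∀ {c z} → Class c z → ¬ (P ∣ z)
      hensel        : Hensel (suc l)
      iso           : ∀ {d} → Bool → Vec (Label N) d → Bool
      iso-sound     : ∀ {d} b (ls : Vec (Label N) d) u → (∀ i → Class (class ls i) (u i)) → iso b ls ≡ true →
        ∃[ z ] ∃[ j ] parity ls j ≡ b × ¬ (P ∣ z j) × P ℤ.^ suc l ∣ form b (parity ls) u z
      iso-complete  : ∀ {d} b (ls : Vec (Label N) d) u → (∀ i → Class (class ls i) (u i)) → iso b ls ≡ false →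
        ∀ z → P ℤ.^ suc l ∣ form b (parity ls) u z → ∀ j → parity ls j ≡ b → P ∣ z j
      reps          : Fin N → List ℤ
      reps-cover    : ∀ {c z} → Class c z → Any (λ r → z ≡ r mod (P ℤ.^ suc l)) (reps c)
      -- Since `1 - p⁻¹` is the measure of the units, `share` is the fraction of them allotted to
      -- one class: 1/4 for `p = 2`, 1/2 for odd `p`.
      share         : ℚ
      share-nonNeg  : 0ℚ ≤ share
      reps-size     : ∀ c → length (reps c) ×ℚ 1ℚ * p⁻¹ p ^ℚ suc l ≤ (1ℚ - p⁻¹ p) * share

    soluble? : ∀ {d} → Vec (Label N) d → Bool
    soluble? ls = iso false ls ∨ iso true ls

    -- Every form in five variables with labelled coefficients has a zero. Only the few
    -- labels of length four without a zero need to be extended.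
    universal? : Bool
    universal? = every 4 (λ ls → soluble? ls ∨ every 1 (λ ℓ → soluble? (ℓ Vec.++ ls)))

  module Density (p : ℕ) {{pr : Prime p}} (classes : UnitClasses p) where
    open UnitClasses classes
    open PrimeModulus pr using (^-cancel-∣; P^-nonZero)
    open Padic pr
    open Forms pr
    open Measure p

    -- The measure of the elements of even valuation, `(1 - t)(1 + t² + t⁴ + ...)`, in the shape
    -- used by the density formula; `r*[1+t]` identifies it with `1 / (1 + t)`.
    r : ℚ
    r = (1ℚ - t) ÷ (1ℚ - t ^ℚ 2)

    -- The measure of the elements of even valuation whose unit part lies in a given class.
    weight : ℚ
    weight = r * share

    r-equation : r * (1ℚ - t ^ℚ 2) ≡ 1ℚ - t
    r-equation = trans (ℚ.*-assoc (1ℚ - t) _ _)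
      (trans (cong ((1ℚ - t) *_) (ℚ.*-inverseˡ (1ℚ - t ^ℚ 2))) (ℚ.*-identityʳ (1ℚ - t)))

    0<1-t : 0ℚ < 1ℚ - t
    0<1-t = subst (_< 1ℚ - t) (ℚ.+-inverseʳ t) (ℚ.+-monoˡ-< (ℚ.- t) (p⁻¹<1 p))

    r*[1+t] : r * (1ℚ + t) ≡ 1ℚ
    r*[1+t] = *-cancel-≡1 0<1-t (trans (lemma r t) r-equation)
      where
      lemma : ∀ r t → r * (1ℚ + t) * (1ℚ - t) ≡ r * (1ℚ - t * (t * 1ℚ))
      lemma = solve-∀ ℚ-ring

    0≤1-t : 0ℚ ≤ 1ℚ - t
    0≤1-t = ℚ.<⇒≤ 0<1-t

    0≤r : 0ℚ ≤ r
    0≤r = 0≤* 0≤1-t (0≤1/ (1ℚ - t ^ℚ 2)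
      (subst (ℚ._< 1ℚ - t ^ℚ 2) (ℚ.+-inverseʳ (t ^ℚ 2)) (ℚ.+-monoˡ-< (ℚ.- (t ^ℚ 2)) (p⁻²<1 p))))

    -- Self-similarity: an element counted by `weight` is either a unit of the class or `p²` times
    -- another such element.
    weight-equation : (1ℚ - t) * share + t * t * weight ≡ weight
    weight-equation = trans (cong (λ a → a * share + t * t * weight) (sym r-equation)) (lemma r t share)
      where
      lemma : ∀ r t s → r * (1ℚ - t * (t * 1ℚ)) * s + t * t * (r * s) ≡ r * s
      lemma = solve-∀ ℚ-ring

    -- `k` ranges over `Fin M`, so a label comprises finitely many shells; valuations from `2M` on
    -- are left to `Negligible`.
    HasLabel : ℕ → Label N → Pred (ℤₚ p) 0ℓ
    HasLabel M (ε , c) x = ∃[ k ] ∃[ u ] x ≈P^ valuation ε (toℕ {M} k) * u × Class c (res u (suc l))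

    Negligible : ℕ → Pred (ℤₚ p) 0ℓ
    Negligible M x = P ℤ.^ (M ℕ.+ M) ∣ res x (M ℕ.+ M)

    cover-negligible : ∀ M → Line.Cover (Negligible M) (t ^ℚ (M ℕ.+ M))
    cover-negligible M = Covering.cover (ball 0ℤ (M ℕ.+ M) ∷ [])
      (λ {x} d → here (subst (P ℤ.^ (M ℕ.+ M) ∣_) (sym (ℤ.+-identityʳ (res x (M ℕ.+ M)))) d))
      (ℚ.≤-reflexive (ℚ.+-identityʳ _))

    -- The class is covered by residue classes modulo `P ^ suc l`, and multiplication by `P ^ v`
    -- turns each of them into a ball of level `v + suc l`.
    cover-shell : ∀ v c → Line.Cover (λ x → ∃[ u ] x ≈P^ v * u × Class c (res u (suc l))) (t ^ℚ v * ((1ℚ - t) * share))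
    cover-shell v c = Covering.cover (shells (reps c))
      (λ {x} (u , x≈ , cls) → Any.map⁺ (Any.map (in-shell x u x≈) (reps-cover cls)))
      (ℚ.≤-trans (ℚ.≤-reflexive (total-shells (reps c)))
        (ℚ.*-monoˡ-≤-nonNeg (t ^ℚ v) {{ℚ.nonNegative (0≤^ v 0≤t)}} (reps-size c)))
      where
      L = v ℕ.+ suc l

      shells : List ℤ → List Ball
      shells = List.map (λ r → ball (P ℤ.^ v ℤ.* r) L)

      in-shell : ∀ x u → x ≈P^ v * u → ∀ {r} → res u (suc l) ≡ r mod (P ℤ.^ suc l) → InBall x (ball (P ℤ.^ v ℤ.* r) L)
      in-shell x u x≈ {r} u≡r = ∣-diff (mod-trans (x≈ L)
        (subst (λ n → P ℤ.^ v ℤ.* res u L ≡ P ℤ.^ v ℤ.* r mod n) (sym (ℤ.^-distribˡ-+-* P v (suc l)))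
          (mod-scale (P ℤ.^ v) (mod-trans (res-+ u (suc l) v) u≡r))))

      total-shells : ∀ rs → Line.total (shells rs) ≡ t ^ℚ v * (length rs ×ℚ 1ℚ * t ^ℚ suc l)
      total-shells []       = sym (trans (cong (t ^ℚ v *_) (ℚ.*-zeroˡ (t ^ℚ suc l))) (ℚ.*-zeroʳ (t ^ℚ v)))
      total-shells (_ ∷ rs) = trans (cong₂ _+_ (^ℚ-+ t v (suc l)) (total-shells rs)) (lemma (t ^ℚ v) (t ^ℚ suc l) (length rs ×ℚ 1ℚ))
        where
        lemma : ∀ a b n → a * b + a * (n * b) ≡ a * ((1ℚ + n) * b)
        lemma = solve-∀ ℚ-ring

    -- A bound for partial sums that avoids limits: `weight` is a fixed point by `weight-equation`,
    -- and with `b` general the terms after the first form the same sum started at `b + 2`.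
    geometric : ∀ M b → ℚ-Semiring.sum {M} (λ k → t ^ℚ (b ℕ.+ (toℕ k ℕ.+ toℕ k)) * ((1ℚ - t) * share)) ≤ t ^ℚ b * weight
    geometric zero    b = 0≤* (0≤^ b 0≤t) (0≤* 0≤r share-nonNeg)
    geometric (suc M) b = begin
      t ^ℚ (b ℕ.+ 0) * V + ℚ-Semiring.sum {M} (λ k → t ^ℚ (b ℕ.+ (suc (toℕ k) ℕ.+ suc (toℕ k))) * V)
        ≡⟨ cong₂ _+_ (cong (λ n → t ^ℚ n * V) (ℕ.+-identityʳ b)) (sum-cong {M} (λ k → cong (λ n → t ^ℚ n * V) (shift b (toℕ k)))) ⟩
      t ^ℚ b * V + ℚ-Semiring.sum {M} (λ k → t ^ℚ ((2 ℕ.+ b) ℕ.+ (toℕ k ℕ.+ toℕ k)) * V)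
        ≤⟨ ℚ.+-monoʳ-≤ (t ^ℚ b * V) (geometric M (2 ℕ.+ b)) ⟩
      t ^ℚ b * V + t ^ℚ (2 ℕ.+ b) * weight   ≡⟨ lemma (t ^ℚ b) V t weight ⟩
      t ^ℚ b * (V + t * t * weight)          ≡⟨ cong (t ^ℚ b *_) weight-equation ⟩
      t ^ℚ b * weight                        ∎
      where
      open ℚ.≤-Reasoning
      V = (1ℚ - t) * share
      shift : ∀ b k → b ℕ.+ (suc k ℕ.+ suc k) ≡ (2 ℕ.+ b) ℕ.+ (k ℕ.+ k)
      shift = ℕ-Solver.solve-∀
      lemma : ∀ a V t w → a * V + (t * (t * a)) * w ≡ a * (V + t * t * w)
      lemma = solve-∀ ℚ-ring

    cover-label : ∀ M ε c → Line.Cover (HasLabel M (ε , c)) (t ^ℚ bit ε * weight)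
    cover-label M ε c = Line.cover-⊆ id (geometric M (bit ε)) (Line.cover-⋃ {M} (λ k → cover-shell (valuation ε (toℕ k)) c))

    halve : ∀ M v → v ℕ.< M ℕ.+ M → ∃[ ε ] ∃[ k ] v ≡ valuation ε (toℕ {M} k)
    halve (suc M) zero          _ = false , zero , refl
    halve (suc M) (suc zero)    _ = true , zero , refl
    halve (suc M) (suc (suc v)) (s≤s v<) with ε , k , eq ← halve M v (ℕ.≤-pred (subst (suc v ℕ.<_) (ℕ.+-suc M M) v<)) =
      ε , suc k , trans (cong (2 ℕ.+_) eq) (shift (bit ε) (toℕ k))
      where
      shift : ∀ b k → 2 ℕ.+ (b ℕ.+ (k ℕ.+ k)) ≡ b ℕ.+ (suc k ℕ.+ suc k)
      shift = ℕ-Solver.solve-∀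

    -- Finitely many residues cannot tell whether `x` is 0, so the search for the valuation stops at
    -- the bound `V`.
    exact-valuation : ∀ (x : ℤₚ p) V → P ℤ.^ V ∣ res x V ⊎
      ∃[ v ] v ℕ.< V × P ℤ.^ v ∣ res x v × ¬ (P ℤ.^ suc v ∣ res x (suc v))
    exact-valuation x zero = inj₁ (divides (res x 0) (sym (ℤ.*-identityʳ _)))
    exact-valuation x (suc V) with exact-valuation x V
    ... | inj₂ (v , v<V , d , nd) = inj₂ (v , ℕ.m<n⇒m<1+n v<V , d , nd)
    ... | inj₁ d with P ℤ.^ suc V ∣? res x (suc V)
    ...   | yes d′ = inj₁ d′
    ...   | no  nd = inj₂ (V , ℕ.≤-refl , d , nd)

    label : ∀ M (x : ℤₚ p) → Negligible M x ⊎ ∃[ ℓ ] HasLabel M ℓ x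
    label M x with exact-valuation x (M ℕ.+ M)
    ... | inj₁ d = inj₁ d
    ... | inj₂ (v , v< , d , nd) = inj₂ (((proj₁ half) , proj₁ cls) , proj₁ (proj₂ half) , proj₁ divided ,
        subst (λ v → x ≈P^ v * proj₁ divided) (proj₂ (proj₂ half)) (proj₁ (proj₂ divided)) , proj₂ cls)
      where
      half = halve M v v<
      divided = divide x v d
      u = proj₁ divided
      cls : ∃[ c ] Class c (res u (suc l))
      cls = classify (res u (suc l)) λ P∣u → nd (subst (P ℤ.^ suc v ∣_) (sym (proj₂ (proj₂ divided) 1))
        (subst (_∣ P ℤ.^ v ℤ.* res u 1) (ℤ.*-comm (P ℤ.^ v) P)
          (*-monoʳ-∣ (P ℤ.^ v) (∣-resp-mod (res-suc-mod-P u l) P∣u))))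

    labels : ∀ M {d} (x : Vector (ℤₚ p) d) → (∃[ i ] Negligible M (x i)) ⊎ ∃[ ls ] Labelled (HasLabel M) ls x
    labels M {zero}  x = inj₂ ([] , [])
    labels M {suc d} x with label M (x zero) | labels M (x ∘ suc)
    ... | inj₁ n        | _               = inj₁ (zero , n)
    ... | inj₂ _        | inj₁ (i , n)    = inj₁ (suc i , n)
    ... | inj₂ (ℓ , hl) | inj₂ (ls , hls) = inj₂ (ℓ ∷ ls , hl ∷ hls)

    labelled-lookup : ∀ {M d} {ls : Vec (Label N) d} {x} → Labelled (HasLabel M) ls x → ∀ i → HasLabel M (lookup ls i) (x i)
    labelled-lookup (hl ∷ hls) zero    = hl
    labelled-lookup (hl ∷ hls) (suc i) = labelled-lookup hls i

    module _ {M n} {ls : Vec (Label N) (suc n)} {a : Vector (ℤₚ p) (suc n)} (hls : Labelled (HasLabel M) ls a) where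

      private
        u : Vector (ℤₚ p) (suc n)
        u i = proj₁ (proj₂ (labelled-lookup hls i))

        k : Vector ℕ (suc n)
        k i = toℕ (proj₁ (labelled-lookup hls i))

        k≤M : ∀ i → k i ℕ.≤ M
        k≤M i = toℕ≤n (proj₁ (labelled-lookup hls i))

        a≈ : ∀ i → a i ≈P^ valuation (parity ls i) (k i) * u i
        a≈ i = proj₁ (proj₂ (proj₂ (labelled-lookup hls i)))

        cls : ∀ i → Class (class ls i) (res (u i) (suc l))
        cls i = proj₂ (proj₂ (proj₂ (labelled-lookup hls i)))

        iso-soluble : ∀ b → iso b ls ≡ true → Soluble p n 2 a
        iso-soluble b eq = point {ε = parity ls} {k = k} {u = u} M k≤M a≈ b (proj₁ lifted) (proj₁ (proj₂ zero-mod)) (proj₁ (proj₂ lifted)) (proj₂ (proj₂ lifted))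
          where
          zero-mod = iso-sound b ls (λ i → res (u i) (suc l)) cls eq
          j = proj₁ (proj₂ zero-mod)
          lifted = lift hensel b (parity ls) u (proj₁ zero-mod) j (proj₁ (proj₂ (proj₂ zero-mod)))
            (proj₁ (proj₂ (proj₂ (proj₂ zero-mod))))
            (λ P∣u → Class-unit (cls j) (∣-resp-mod (mod-sym (res-suc-mod-P (u j) l)) P∣u))
            (proj₂ (proj₂ (proj₂ (proj₂ zero-mod))))

      soluble : soluble? ls ≡ true → Soluble p n 2 a
      soluble eq with iso false ls in eq₀ | iso true ls in eq₁
      ... | true  | _    = iso-soluble false eq₀
      ... | false | true = iso-soluble true eq₁

      insoluble : soluble? ls ≡ false → ¬ Soluble p n 2 a
      insoluble eq = no-point {ε = parity ls} {k = k} {u = u} M k≤M a≈ l λ m b z div j par →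
        iso-complete b ls (λ i → res (u i) (m ℕ.+ suc l))
          (λ i → Class-resp (mod-sym (res-+ (u i) (suc l) m)) (cls i)) (anisotropic b) z div j par
        where
        anisotropic : ∀ b → iso b ls ≡ false
        anisotropic b with iso false ls in eq₀ | iso true ls in eq₁
        anisotropic false | false | false = eq₀
        anisotropic true  | false | false = eq₁

    -- The bound for the labelled part is the same for all `M`, while the slabs of negligible
    -- coefficients have total volume at most `ε` once `M` is chosen large enough.
    outerMeasure-tally : ∀ {d} (S : Pred (Vector (ℤₚ p) d) 0ℓ) (f : Vec (Label N) d → Bool) {q} →
      (∀ {M ls x} → Labelled (HasLabel M) ls x → S x → f ls ≡ true) →
      weight ^ℚ d * eval (tally d f) t ≤ q → OuterMeasure≤ p S q
    outerMeasure-tally {d} S f {q} S⇒f bound = outerMeasure≤ {q = q} λ ε 0<ε → covering ε (multiple-of-small-power p d ε 0<ε)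
      where
      labelled-part : ∀ M → Space.Cover (λ x → ∃[ ls ] f ls ≡ true × Labelled (HasLabel M) ls x) (weight ^ℚ d * eval (tally d f) t)
      labelled-part M = cover-labelled p {L = HasLabel M} {w = weight}
        (λ c → Line.cover-⊆ id (ℚ.≤-reflexive (ℚ.*-identityˡ weight)) (cover-label M false c))
        (λ c → Line.cover-⊆ id (ℚ.≤-reflexive (cong (_* weight) (ℚ.*-identityʳ t))) (cover-label M true c))
        f

      split : ∀ M x → S x → (∃[ ls ] f ls ≡ true × Labelled (HasLabel M) ls x) ⊎ (∃[ i ] Negligible M (x i))
      split M x s = Sum.[ inj₂ , (λ (ls , hls) → inj₁ (ls , S⇒f hls s , hls)) ]′ (labels M x)

      covering : ∀ ε → ∃[ M ] d ×ℚ (t ^ℚ (M ℕ.+ M)) ≤ ε → Space.Cover S (q + ε)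
      covering ε (M , small) = Space.cover-⊆ (λ {x} → split M x) (ℚ.+-mono-≤ bound small)
        (Space.cover-∪ (labelled-part M) (some-coordinate (cover-negligible M)))

    density : ∀ n {q} →
      weight ^ℚ suc n * eval (tally (suc n) soluble?) t ≤ q →
      weight ^ℚ suc n * eval (tally (suc n) (not ∘ soluble?)) t ≤ 1ℚ - q →
      ρ[ p ][ n , 2 ]≡ q
    density n b b′ = outerMeasure-tally (Soluble p n 2) soluble? sol b
                   , outerMeasure-tally (∁ (Soluble p n 2)) (not ∘ soluble?) insol b′
      where
      sol : ∀ {M ls x} → Labelled (HasLabel M) ls x → Soluble p n 2 x → soluble? ls ≡ true
      sol hls s = ¬-not (λ eq → insoluble hls eq s)

      insol : ∀ {M ls x} → Labelled (HasLabel M) ls x → ¬ Soluble p n 2 x → not (soluble? ls) ≡ true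
      insol hls s = cong not (¬-not (λ eq → s (soluble hls eq)))

    -- `iso` is known only through what it decides: soundness supplies a zero for the shorter form,
    -- a coordinate 0 extends it, and completeness excludes the answer `false`. The integers `u`
    -- serve as representatives of the classes.
    iso-∷ : ∀ {d} b ℓ (ls : Vec (Label N) d) (u : Vector ℤ (suc d)) → (∀ i → Class (class (ℓ ∷ ls) i) (u i)) →
      iso b ls ≡ true → iso b (ℓ ∷ ls) ≡ true
    iso-∷ b ℓ ls u cls eq = ¬-not λ eq′ →
      P∤z (iso-complete b (ℓ ∷ ls) u cls eq′ (0ℤ Vector.∷ z)
        (subst (P ℤ.^ suc l ∣_) (lemma (P ℤ.^ bit (proj₁ ℓ xor b)) (u zero) (form b (parity ls) (u ∘ suc) z)) div) (suc j) par)
      where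
      zero-mod = iso-sound b ls (u ∘ suc) (cls ∘ suc) eq
      z = proj₁ zero-mod
      j = proj₁ (proj₂ zero-mod)
      par = proj₁ (proj₂ (proj₂ zero-mod))
      P∤z = proj₁ (proj₂ (proj₂ (proj₂ zero-mod)))
      div = proj₂ (proj₂ (proj₂ (proj₂ zero-mod)))
      lemma : ∀ a u F → F ≡ a ℤ.* (u ℤ.* (0ℤ ℤ.* 0ℤ)) ℤ.+ F
      lemma = ℤ-solve-∀

    soluble?-∷ : ∀ {d} ℓ (ls : Vec (Label N) d) (u : Vector ℤ (suc d)) → (∀ i → Class (class (ℓ ∷ ls) i) (u i)) →
      soluble? ls ≡ true → soluble? (ℓ ∷ ls) ≡ true
    soluble?-∷ ℓ ls u cls eq = Sum.[ (λ e → ∨-true₁ _ (iso-∷ false ℓ ls u cls e)) , (λ e → ∨-true₂ (iso false (ℓ ∷ ls)) (iso-∷ true ℓ ls u cls e)) ]′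
      (∨-true⁻ (iso false ls) eq)

    -- Beyond five variables the first one is dropped. With exactly five, either the last four
    -- already form a soluble tuple or the finite check covers every choice of the first label.
    universal : universal? ≡ true → ∀ {d} → 5 ℕ.≤ d → (ls : Vec (Label N) d) (u : Vector ℤ d) →
      (∀ i → Class (class ls i) (u i)) → soluble? ls ≡ true
    universal univ {suc d} 5≤ (ℓ ∷ ls) u cls with ℕ.m≤n⇒m<n∨m≡n 5≤
    ... | inj₁ (s≤s 5≤d) = soluble?-∷ ℓ ls u cls (universal univ 5≤d ls (u ∘ suc) (cls ∘ suc))
    ... | inj₂ refl = Sum.[ soluble?-∷ ℓ ls u cls
                          , (λ e → every-sound {d = 1} (λ ℓ → soluble? (ℓ Vec.++ ls)) e (ℓ ∷ [])) ]′
                        (∨-true⁻ (soluble? ls) (every-sound {d = 4} (λ ls → soluble? ls ∨ every 1 (λ ℓ → soluble? (ℓ Vec.++ ls))) univ ls))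

    density-one : universal? ≡ true → ∀ n → n ℕ.≥ 4 → ρ[ p ][ n , 2 ]≡ 1ℚ
    density-one univ n n≥4 =
        outerMeasure≤ {q = 1ℚ} (λ ε 0<ε → Space.cover-⊆ (λ _ → tt)
          (ℚ.≤-trans (ℚ.≤-reflexive (sym (ℚ.+-identityʳ 1ℚ))) (ℚ.+-monoʳ-≤ 1ℚ (ℚ.<⇒≤ 0<ε))) space-cover-U)
      -- Every labelled tuple is soluble, so the complement lies in the negligible slabs; the
      -- constant test `false` records this with count 0.
      , outerMeasure-tally (∁ (Soluble p n 2)) (λ _ → false)
          (λ hls s → contradiction (soluble hls (universal univ (s≤s n≥4) _ _ (classed hls))) s)
          (ℚ.≤-reflexive (trans (cong (weight ^ℚ suc n *_) (tally-none {N} (suc n) t)) (ℚ.*-zeroʳ (weight ^ℚ suc n))))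
      where
      classed : ∀ {M d ls} {x : Vector (ℤₚ p) d} (hls : Labelled (HasLabel M) ls x) → ∀ i →
        Class (class ls i) (res (proj₁ (proj₂ (labelled-lookup hls i))) (suc l))
      classed hls i = proj₂ (proj₂ (proj₂ (labelled-lookup hls i)))

-- The case `p = 2`: units and zeros modulo 8.

module DyadicClasses where

  open Congruence
  open Covers
  open Rationals
  open DiagonalForms
  open UnitClassification
  open PadicPoints
  open import Data.Bool.Base using (Bool; true; false; not; _∧_; _∨_; _xor_; if_then_else_)
  open import Data.Bool.Properties using (xor-same)
  open import Data.Fin.Base using (Fin; zero; suc; toℕ)
  import Data.Integer.Base as ℤ
  open import Data.Integer.Base using (ℤ; +_; 0ℤ; 1ℤ; _+_; _*_; _^_)
  import Data.Integer.Properties as ℤ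
  open import Data.Integer.DivMod using (_%ℕ_; n%ℕd<d)
  open import Data.Integer.Divisibility.Signed
  open import Data.Integer.Tactic.RingSolver using (solve-∀)
  open import Data.List.Base using ([]; _∷_)
  open import Data.List.Relation.Unary.Any using (here)
  open import Data.Nat.Base as ℕ using (ℕ; zero; suc; z≤n; s≤s; _≡ᵇ_)
  import Data.Nat.DivMod as ℕ
  import Data.Nat.Properties as ℕ
  open import Data.Nat.Primality using (Prime)
  open import Data.Product.Base using (_×_; _,_; ∃-syntax; proj₁; proj₂)
  import Data.Rational.Base as ℚ
  import Data.Rational.Properties as ℚ
  open import Data.Sum.Base as Sum using (_⊎_; inj₁; inj₂)
  open import Data.Vec.Base using (Vec; []; _∷_)
  open import Data.Vec.Functional as Vector using (Vector)
  open import Function.Base using (_∘_)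
  open import Relation.Binary.PropositionalEquality
  open import Relation.Nullary.Negation using (¬_; contradiction)
  open import Relation.Nullary.Decidable.Core using (from-no; decidable-stable)

  module Two {{pr : Prime 2}} where
    open PrimeModulus pr
    open Padic pr
    open Forms pr

    8ℤ : ℤ
    8ℤ = + 8

    2∣8 : + 2 ∣ 8ℤ
    2∣8 = divides (+ 4) refl

    square-mod-8 : ∀ z → (z * z ≡ 0ℤ mod 8ℤ) ⊎ (z * z ≡ + 1 mod 8ℤ) ⊎ (z * z ≡ + 4 mod 8ℤ)
    square-mod-8 z = Sum.map step (Sum.map step step) (squares (z %ℕ 8) (n%ℕd<d z 8))
      where
      step : ∀ {s} → + (z %ℕ 8) * + (z %ℕ 8) ≡ s mod 8ℤ → z * z ≡ s mod 8ℤ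
      step = mod-trans (mod-* (residue z 8) (residue z 8))
      squares : ∀ r → r ℕ.< 8 → (+ r * + r ≡ 0ℤ mod 8ℤ) ⊎ (+ r * + r ≡ + 1 mod 8ℤ) ⊎ (+ r * + r ≡ + 4 mod 8ℤ)
      squares 0 _ = inj₁ (congruent (divides (+ 0) refl))
      squares 1 _ = inj₂ (inj₁ (congruent (divides (+ 0) refl)))
      squares 2 _ = inj₂ (inj₂ (congruent (divides (+ 0) refl)))
      squares 3 _ = inj₂ (inj₁ (congruent (divides (+ 1) refl)))
      squares 4 _ = inj₁ (congruent (divides (+ 2) refl))
      squares 5 _ = inj₂ (inj₁ (congruent (divides (+ 3) refl)))
      squares 6 _ = inj₂ (inj₂ (congruent (divides (+ 4) refl)))
      squares 7 _ = inj₂ (inj₁ (congruent (divides (+ 6) refl)))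
      squares (suc (suc (suc (suc (suc (suc (suc (suc r)))))))) (s≤s (s≤s (s≤s (s≤s (s≤s (s≤s (s≤s (s≤s ()))))))))

    -- The odd residues 1, 3, 5, 7 modulo 8, which represent the four square classes of 2-adic
    -- units.
    value : Fin 4 → ℕ
    value c = suc (2 ℕ.* toℕ c)

    Class : Fin 4 → ℤ → Set
    Class c z = z ≡ + value c mod 8ℤ

    classify : ∀ z → ¬ (+ 2 ∣ z) → ∃[ c ] Class c z
    classify z odd = cases (z %ℕ 8) (n%ℕd<d z 8) (residue z 8)
      where
      even : ∀ {r} → + 2 ∣ + r → z ≡ + r mod 8ℤ → ∃[ c ] Class c z
      even 2∣r z≡r = contradiction (∣-resp-mod (mod-sym (mod-weaken 2∣8 z≡r)) 2∣r) odd
      cases : ∀ r → r ℕ.< 8 → z ≡ + r mod 8ℤ → ∃[ c ] Class c z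
      cases 0 _ = even (divides (+ 0) refl)
      cases 1 _ z≡ = zero , z≡
      cases 2 _ = even (divides (+ 1) refl)
      cases 3 _ z≡ = suc zero , z≡
      cases 4 _ = even (divides (+ 2) refl)
      cases 5 _ z≡ = suc (suc zero) , z≡
      cases 6 _ = even (divides (+ 3) refl)
      cases 7 _ z≡ = suc (suc (suc zero)) , z≡
      cases (suc (suc (suc (suc (suc (suc (suc (suc r)))))))) (s≤s (s≤s (s≤s (s≤s (s≤s (s≤s (s≤s (s≤s ()))))))))

    Class-unit : ∀ {c z} → Class c z → ¬ (+ 2 ∣ z)
    Class-unit {c} z≡ 2∣z = odd c (∣-resp-mod (mod-weaken 2∣8 z≡) 2∣z)
      where
      odd : ∀ c → ¬ (+ 2 ∣ + value c)
      odd zero                   = from-no (+ 2 ∣? + 1)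
      odd (suc zero)             = from-no (+ 2 ∣? + 3)
      odd (suc (suc zero))       = from-no (+ 2 ∣? + 5)
      odd (suc (suc (suc zero))) = from-no (+ 2 ∣? + 7)

    -- With x = z + 2y, the equation c x² + d = 0 becomes (c z² + d)/4 + c z y + c y² = 0.
    hensel : Hensel 3
    hensel c d z 2∤c 2∤z 8∣ = x , x-zero , x-unit
      where
      f : ℤₚ 2
      f = c *ₚ (fromℤ (z * z)) +ₚ d

      4∣f : P ^ 2 ∣ res f 2
      4∣f = ∣-resp-mod (res-+ f 2 1) (∣-trans (divides (+ 2) refl) 8∣)

      divided = divide f 2 4∣f
      q = proj₁ divided

      -- This is what the third factor of 2 is for: after division by 4 the constant term is still
      -- even, as `quadratic-root` demands, and the linear coefficient `c z` is odd.
      2∣q : P ∣ res q 1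
      2∣q = subst (_∣ res q 1) refl (^-cancel-∣ 2 {1} {res q 1} (subst (P ^ 3 ∣_) (proj₂ (proj₂ divided) 1) 8∣))

      b : ℤₚ 2
      b = c *ₚ fromℤ z

      rooted = quadratic-root q b c 2∣q (∤* 2∤c 2∤z)
      y = proj₁ rooted

      x : ℤₚ 2
      x = fromℤ z +ₚ fromℤ (+ 2) *ₚ y

      x-zero : ∀ m → P ^ m ∣ res c m * (res x m * res x m) + res d m
      x-zero m = mod⇒∣ (mod-trans (≡⇒mod (lemma₁ (res c m) z (res d m) (res y m)))
        (mod-trans (mod-+ (proj₁ (proj₂ divided) m) (mod-refl {x = (+ 4) * (res c m * z * res y m + res c m * (res y m * res y m))}))
          (∣⇒mod (subst (P ^ m ∣_) (lemma₂ (res q m) (res c m * z * res y m) (res c m * (res y m * res y m)))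
            (∣n⇒∣m*n (+ 4) (proj₁ (proj₂ rooted) m))))))
        where
        lemma₁ : ∀ c z d y → c * ((z + (+ 2) * y) * (z + (+ 2) * y)) + d
          ≡ (c * (z * z) + d) + (+ 4) * (c * z * y + c * (y * y))
        lemma₁ = solve-∀
        lemma₂ : ∀ q a b → (+ 4) * (q + a + b) ≡ (+ 4) * q + (+ 4) * (a + b)
        lemma₂ = solve-∀

      x-unit : ¬ (P ∣ res x 1)
      x-unit 2∣x = 2∤z (∣m+n∣n⇒∣m {n = + 2 * res y 1} 2∣x (∣m⇒∣m*n (res y 1) ∣-refl))

    coefficient : Bool → Label 4 → ℕ
    coefficient b (ε , c) = if ε xor b then 2 ℕ.* value c else value c

    -- Looks for coordinates 0, 1 or 2 completing the residue r to 0 modulo 8;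
    -- the flag tells whether a unit coordinate of parity b has been chosen.
    search : ∀ {d} → Bool → Vec (Label 4) d → ℕ → Bool → Bool
    search b []       r flag = (r ≡ᵇ 0) ∧ flag
    search b (ℓ ∷ ls) r flag = search b ls r flag
      ∨ search b ls ((r ℕ.+ coefficient b ℓ) ℕ.% 8) (flag ∨ not (proj₁ ℓ xor b))
      ∨ search b ls ((r ℕ.+ 4 ℕ.* coefficient b ℓ) ℕ.% 8) flag

    iso : ∀ {d} → Bool → Vec (Label 4) d → Bool
    iso b ls = search b ls 0 false

    UnitCoordinate : ∀ {d} → Bool → Vec (Label 4) d → Vector ℤ d → Set
    UnitCoordinate b ls z = ∃[ j ] parity ls j ≡ b × ¬ (P ∣ z j)

    reduce : ∀ r k → + ((r ℕ.+ k) ℕ.% 8) ≡ + r + + k mod 8ℤ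
    reduce r k = mod-sym (mod-trans (≡⇒mod (sym (ℤ.pos-+ r k))) (residue (+ (r ℕ.+ k)) 8))

    monomial : ∀ b ε c u s s′ → Class c u → s ≡ + s′ mod 8ℤ →
      P ^ bit (ε xor b) * (u * s) ≡ + (s′ ℕ.* coefficient b (ε , c)) mod 8ℤ
    monomial b ε c u s s′ u≡ s≡ with ε xor b
    ... | false = mod-trans (mod-*ˡ 1ℤ (mod-* u≡ s≡))
            (≡⇒mod (trans (ℤ.*-identityˡ _) (trans (ℤ.*-comm (+ value c) (+ s′)) (sym (ℤ.pos-* s′ (value c))))))
    ... | true  = mod-trans (mod-*ˡ (P * 1ℤ) (mod-* u≡ s≡))
            (≡⇒mod (trans (lemma (+ value c) (+ s′))
              (trans (cong (+ s′ *_) (sym (ℤ.pos-* 2 (value c)))) (sym (ℤ.pos-* s′ (2 ℕ.* value c))))))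
      where
      lemma : ∀ v s → + 2 * 1ℤ * (v * s) ≡ s * (+ 2 * v)
      lemma = solve-∀

    -- The invariant of the search: the residue collected so far plus the form on the coordinates
    -- still to come does not change modulo 8 when a coordinate with square `s` is moved from one to
    -- the other.
    advance : ∀ b ℓ r s {u z} {F : ℤ} → Class (proj₂ ℓ) u → z * z ≡ + s mod 8ℤ →
      + ((r ℕ.+ s ℕ.* coefficient b ℓ) ℕ.% 8) + F ≡ + r + (P ^ bit (proj₁ ℓ xor b) * (u * (z * z)) + F) mod 8ℤ
    advance b ℓ r s {u} {z} {F} u≡ z²≡ = mod-trans
      (mod-+ (mod-trans (reduce r (s ℕ.* coefficient b ℓ))
        (mod-+ (mod-refl {x = + r}) (mod-sym (monomial b (proj₁ ℓ) (proj₂ ℓ) u (z * z) s u≡ z²≡)))) (mod-refl {x = F}))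
      (≡⇒mod (ℤ.+-assoc (+ r) (P ^ bit (proj₁ ℓ xor b) * (u * (z * z))) F))

    module _ (b : Bool) where

      search-sound : ∀ {d} (ls : Vec (Label 4) d) u r flag → (∀ i → Class (class ls i) (u i)) → search b ls r flag ≡ true →
        ∃[ z ] (+ r + form b (parity ls) u z ≡ 0ℤ mod 8ℤ) × (flag ≡ true ⊎ UnitCoordinate b ls z)
      search-sound [] u zero true cls eq = (λ ()) , mod-refl , inj₁ refl
      search-sound (ℓ ∷ ls) u r flag cls eq with ∨-true⁻ (search b ls r flag) eq
      ... | inj₁ eq₀ =
        let z , zer , unit = search-sound ls (u ∘ suc) r flag (cls ∘ suc) eq₀ in
        (0ℤ Vector.∷ z) , mod-trans (≡⇒mod (lemma (+ r) (P ^ bit (proj₁ ℓ xor b)) (u zero) (form b (parity ls) (u ∘ suc) z))) zer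
        , Sum.map₂ (λ (j , unit) → suc j , unit) unit
        where
        lemma : ∀ r a u F → r + (a * (u * (0ℤ * 0ℤ)) + F) ≡ r + F
        lemma = solve-∀
      ... | inj₂ eq′ with ∨-true⁻ (search b ls ((r ℕ.+ coefficient b ℓ) ℕ.% 8) (flag ∨ not (proj₁ ℓ xor b))) eq′
      ...   | inj₁ eq₁ =
        let z , zer , unit = search-sound ls (u ∘ suc) _ _ (cls ∘ suc) eq₁ in
        (1ℤ Vector.∷ z)
        , mod-trans (mod-sym (advance b ℓ r 1 {u zero} {1ℤ} {form b (parity ls) (u ∘ suc) z} (cls zero) mod-refl))
            (subst (λ k → + ((r ℕ.+ k) ℕ.% 8) + form b (parity ls) (u ∘ suc) z ≡ 0ℤ mod 8ℤ) (sym (ℕ.*-identityˡ (coefficient b ℓ))) zer)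
        , Sum.[ (λ flag′ → Sum.map₂ (λ even → zero , parity-zero even , from-no (+ 2 ∣? 1ℤ)) (∨-true⁻ flag flag′))
              , (λ (j , unit) → inj₂ (suc j , unit)) ]′ unit
        where
        equal : ∀ ε b → not (ε xor b) ≡ true → ε ≡ b
        equal false false _ = refl
        equal true  true  _ = refl
        parity-zero : not (proj₁ ℓ xor b) ≡ true → proj₁ ℓ ≡ b
        parity-zero = equal (proj₁ ℓ) b
      ...   | inj₂ eq₂ =
        let z , zer , unit = search-sound ls (u ∘ suc) _ _ (cls ∘ suc) eq₂ in
        (+ 2 Vector.∷ z)
        , mod-trans (mod-sym (advance b ℓ r 4 {u zero} {+ 2} {form b (parity ls) (u ∘ suc) z} (cls zero) mod-refl)) zer
        , Sum.map₂ (λ (j , unit) → suc j , unit) unit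

      -- Squares modulo 8 are 0, 1 and 4, so any zero has the same residues as one with coordinates
      -- 0, 1, 2. If the first square is 0 or 4, that coordinate is even and the required unit comes
      -- later; if it is 1, either the flag is raised or the parity is not `b`.
      search-complete : ∀ {d} (ls : Vec (Label 4) d) u r flag → r ℕ.< 8 → (∀ i → Class (class ls i) (u i)) →
        ∀ z → + r + form b (parity ls) u z ≡ 0ℤ mod 8ℤ → flag ≡ true ⊎ UnitCoordinate b ls z → search b ls r flag ≡ true
      search-complete [] u r flag r<8 cls z zer (inj₁ refl) = zero-residue r r<8 (mod⇒∣ (subst (_≡ 0ℤ mod 8ℤ) (ℤ.+-identityʳ (+ r)) zer))
        where
        zero-residue : ∀ r → r ℕ.< 8 → 8ℤ ∣ + r → (r ≡ᵇ 0) ∧ true ≡ true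
        zero-residue zero    _   _ = refl
        zero-residue (suc r) r<8 d = contradiction (ℕ.∣⇒≤ (∣⇒∣ᵤ d)) (ℕ.<⇒≱ r<8)
          where import Data.Nat.Divisibility as ℕ
      search-complete (ℓ ∷ ls) u r flag r<8 cls z zer unit = Sum.[ zero-square , Sum.[ odd-square , four-square ]′ ]′ (square-mod-8 (z zero))
        where
        F = form b (parity ls) (u ∘ suc) (z ∘ suc)
        r′ : ℕ → ℕ
        r′ s = (r ℕ.+ s ℕ.* coefficient b ℓ) ℕ.% 8

        next : ∀ s → z zero * z zero ≡ + s mod 8ℤ → + r′ s + F ≡ 0ℤ mod 8ℤ
        next s z²≡ = mod-trans (advance b ℓ r s {u zero} {z zero} {F} (cls zero) z²≡) zer

        later : ∀ s → z zero * z zero ≡ + s mod 8ℤ → P ∣ + s → flag ≡ true ⊎ UnitCoordinate b ls (z ∘ suc)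
        later s z²≡ 2∣s = Sum.map₂ drop unit
          where
          drop : UnitCoordinate b (ℓ ∷ ls) z → UnitCoordinate b ls (z ∘ suc)
          drop (zero  , _   , 2∤z) = contradiction (∣²⇒∣ {z zero} (∣-resp-mod (mod-sym (mod-weaken 2∣8 z²≡)) 2∣s)) 2∤z
          drop (suc j , par , 2∤z) = j , par , 2∤z

        r<8′ : ∀ s → r′ s ℕ.< 8
        r<8′ s = ℕ.m%n<n (r ℕ.+ s ℕ.* coefficient b ℓ) 8

        zero-square : z zero * z zero ≡ 0ℤ mod 8ℤ → search b (ℓ ∷ ls) r flag ≡ true
        zero-square z²≡ = ∨-true₁ _ (search-complete ls (u ∘ suc) r flag r<8 (cls ∘ suc) (z ∘ suc)
          (subst (λ k → + k + F ≡ 0ℤ mod 8ℤ) (trans (cong (ℕ._% 8) (ℕ.+-identityʳ r)) (ℕ.m<n⇒m%n≡m r<8)) (next 0 z²≡))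
          (later 0 z²≡ (divides (+ 0) refl)))

        odd-square : z zero * z zero ≡ + 1 mod 8ℤ → search b (ℓ ∷ ls) r flag ≡ true
        odd-square z²≡ = ∨-true₂ (search b ls r flag) (∨-true₁ _
          (search-complete ls (u ∘ suc) _ _ (ℕ.m%n<n (r ℕ.+ coefficient b ℓ) 8) (cls ∘ suc) (z ∘ suc)
            (subst (λ k → + ((r ℕ.+ k) ℕ.% 8) + F ≡ 0ℤ mod 8ℤ) (ℕ.*-identityˡ (coefficient b ℓ)) (next 1 z²≡))
            (found unit)))
          where
          found : flag ≡ true ⊎ UnitCoordinate b (ℓ ∷ ls) z → (flag ∨ not (proj₁ ℓ xor b)) ≡ true ⊎ UnitCoordinate b ls (z ∘ suc)
          found (inj₁ eq)                  = inj₁ (∨-true₁ _ eq)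
          found (inj₂ (zero  , refl , _))  = inj₁ (∨-true₂ flag (cong not (xor-same (proj₁ ℓ))))
          found (inj₂ (suc j , par , 2∤z)) = inj₂ (j , par , 2∤z)

        four-square : z zero * z zero ≡ + 4 mod 8ℤ → search b (ℓ ∷ ls) r flag ≡ true
        four-square z²≡ = ∨-true₂ (search b ls r flag) (∨-true₂ (search b ls ((r ℕ.+ coefficient b ℓ) ℕ.% 8) _)
          (search-complete ls (u ∘ suc) _ flag (r<8′ 4) (cls ∘ suc) (z ∘ suc) (next 4 z²≡) (later 4 z²≡ (divides (+ 2) refl))))

    iso-sound : ∀ {d} b (ls : Vec (Label 4) d) u → (∀ i → Class (class ls i) (u i)) → iso b ls ≡ true →
      ∃[ z ] ∃[ j ] parity ls j ≡ b × ¬ (P ∣ z j) × 8ℤ ∣ form b (parity ls) u z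
    iso-sound b ls u cls eq with search-sound b ls u 0 false cls eq
    ... | z , zer , inj₂ (j , par , 2∤z) =
      z , j , par , 2∤z , mod⇒∣ (subst (_≡ 0ℤ mod 8ℤ) (ℤ.+-identityˡ (form b (parity ls) u z)) zer)

    iso-complete : ∀ {d} b (ls : Vec (Label 4) d) u → (∀ i → Class (class ls i) (u i)) → iso b ls ≡ false →
      ∀ z → 8ℤ ∣ form b (parity ls) u z → ∀ j → parity ls j ≡ b → P ∣ z j
    iso-complete b ls u cls eq z div j par = decidable-stable (P ∣? z j) λ 2∤z →
      contradiction (trans (sym (search-complete b ls u 0 false (s≤s z≤n) cls z
        (subst (_≡ 0ℤ mod 8ℤ) (sym (ℤ.+-identityˡ (form b (parity ls) u z))) (∣⇒mod div)) (inj₂ (j , par , 2∤z)))) eq) λ ()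

    classes : UnitClasses 2
    classes = record
      { N = 4
      ; l = 2
      ; Class = Class
      ; Class-resp = λ x≡y x≡ → mod-trans (mod-sym x≡y) x≡
      ; classify = classify
      ; Class-unit = λ {c} → Class-unit {c}
      ; hensel = hensel
      ; iso = iso
      ; iso-sound = iso-sound
      ; iso-complete = iso-complete
      ; reps = λ c → + value c ∷ []
      ; reps-cover = λ z≡ → here z≡
      -- A class is one residue modulo 8, of measure `1/8 = (1 - 1/2) * 1/4`.
      ; share = + 1 ℚ./ 4
      ; share-nonNeg = ℚ.nonNegative⁻¹ _
      ; reps-size = λ _ → ℚ.≤-refl
      }

-- The case of odd `p = 2h + 1`: square classes and zeros modulo `p`.

module OddClasses where

  open Congruence
  open Covers
  open Rationals
  open DiagonalForms
  open UnitClassification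
  open PadicPoints
  open import Data.Bool.Base using (Bool; true; false; _xor_; if_then_else_)
  open import Data.Empty using (⊥-elim)
  open import Data.Fin.Base using (Fin; zero; suc; toℕ; fromℕ<; splitAt; join)
  open import Data.Fin.Properties using (toℕ-fromℕ<; toℕ<n; toℕ-injective; any?; pigeonhole; join-splitAt; <⇒≢)
  import Data.Integer.Base as ℤ
  open import Data.Integer.Base using (ℤ; +_; -_; 0ℤ; 1ℤ; _+_; _*_; _-_; _^_)
  import Data.Integer.Properties as ℤ
  open import Data.Integer.DivMod using (_%ℕ_; n%ℕd<d)
  open import Data.Integer.Divisibility.Signed
  open import Data.Integer.Tactic.RingSolver using (solve-∀)
  open import Data.List.Base as List using (List; []; _∷_; length)
  import Data.List.Properties as List
  open import Data.List.Relation.Unary.Any using (Any)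
  import Data.List.Relation.Unary.Any.Properties as Any
  open import Data.Nat.Base as ℕ using (ℕ; zero; suc; z≤n; s≤s)
  import Data.Nat.Divisibility as ℕ
  import Data.Nat.Properties as ℕ
  open import Data.Nat.Primality using (Prime; prime⇒nonZero)
  open import Data.Product.Base using (_×_; _,_; ∃-syntax; proj₁; proj₂)
  import Data.Rational.Base as ℚ
  open ℚ using (ℚ; 0ℚ; 1ℚ)
  import Data.Rational.Properties as ℚ
  open import Algebra.Properties.Monoid.Mult using (×-homo-+)
  open import Tactic.RingSolver using () renaming (solve-∀ to ℚ-solve-∀)
  open import Data.Sum.Base as Sum using (_⊎_; inj₁; inj₂)
  open import Data.Vec.Base using (Vec; []; _∷_)
  open import Data.Vec.Functional as Vector using (Vector)
  open import Function.Base using (_∘_)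
  open import Relation.Binary.PropositionalEquality
  open import Relation.Nullary.Negation using (¬_; contradiction)
  open import Relation.Nullary.Decidable.Core using (Dec; yes; no; ¬?; _×-dec_; decidable-stable)

  open ℚ-Semiring using () renaming (_×_ to _×ℚ_)

  module Odd (p : ℕ) {{pr : Prime p}} (h : ℕ) (p≡ : p ≡ suc (h ℕ.+ h)) where
    open PrimeModulus pr
    open Padic pr
    open Forms pr

    private
      nz : ℕ.NonZero p
      nz = prime⇒nonZero pr

    infix 4 _≡ₚ_ _≡ₚ?_
    _≡ₚ_ : ℤ → ℤ → Set
    x ≡ₚ y = x ≡ y mod P

    _≡ₚ?_ : ∀ x y → Dec (x ≡ₚ y)
    x ≡ₚ? y with P ∣? x - y
    ... | yes d = yes (congruent d)
    ... | no nd = no (nd ∘ ∣-diff)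

    cancelˡ : ∀ {v x y} → ¬ (P ∣ v) → v * x ≡ₚ v * y → x ≡ₚ y
    cancelˡ {v} {x} {y} P∤v eq = congruent (∣*⇒∣ʳ P∤v (subst (P ∣_) (lemma v x y) (∣-diff eq)))
      where
      lemma : ∀ v x y → v * x - v * y ≡ v * (x - y)
      lemma = solve-∀

    residueFin : ℤ → Fin p
    residueFin z = fromℕ< (n%ℕd<d z p {{nz}})

    residueFin-mod : ∀ z → z ≡ₚ + toℕ (residueFin z)
    residueFin-mod z = subst (λ r → z ≡ₚ + r) (sym (toℕ-fromℕ< (n%ℕd<d z p {{nz}}))) (residue z p {{nz}})

    Injective : ∀ {m} → (Fin m → ℤ) → Set
    Injective f = ∀ {i j} → f i ≡ₚ f j → i ≡ j

    -- Together the two families have `2h + 2 = p + 1` values, one more than there are residues, and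
    -- neither repeats a residue by itself.
    collision : (f g : Fin (suc h) → ℤ) → Injective f → Injective g → ∃[ i ] ∃[ j ] f i ≡ₚ g j
    collision f g f-inj g-inj = resolve (pigeonhole p< (residueFin ∘ value))
      where
      values : Fin (suc h) ⊎ Fin (suc h) → ℤ
      values = Sum.[ f , g ]′

      value : Fin (suc h ℕ.+ suc h) → ℤ
      value = values ∘ splitAt (suc h)

      p< : p ℕ.< suc h ℕ.+ suc h
      p< = ℕ.≤-reflexive (trans (cong suc p≡) (cong suc (sym (ℕ.+-suc h h))))

      congruent-values : ∀ {i j} → residueFin (value i) ≡ residueFin (value j) → value i ≡ₚ value j
      congruent-values {i} {j} eq = mod-trans (residueFin-mod (value i))
        (mod-trans (≡⇒mod (cong (+_ ∘ toℕ) eq)) (mod-sym (residueFin-mod (value j))))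

      split-injective : ∀ {i j} → splitAt (suc h) i ≡ splitAt (suc h) j → i ≡ j
      split-injective {i} {j} eq = trans (sym (join-splitAt (suc h) (suc h) i))
        (trans (cong (join (suc h) (suc h)) eq) (join-splitAt (suc h) (suc h) j))

      cases : ∀ s s′ → values s ≡ₚ values s′ → s ≢ s′ → ∃[ i ] ∃[ j ] f i ≡ₚ g j
      cases (inj₁ i) (inj₁ j) eq s≢s′ = contradiction (cong inj₁ (f-inj eq)) s≢s′
      cases (inj₂ i) (inj₂ j) eq s≢s′ = contradiction (cong inj₂ (g-inj eq)) s≢s′
      cases (inj₁ i) (inj₂ j) eq _    = i , j , eq
      cases (inj₂ i) (inj₁ j) eq _    = j , i , mod-sym eq

      resolve : _ → ∃[ i ] ∃[ j ] f i ≡ₚ g j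
      resolve (i , j , i<j , eq) = cases (splitAt (suc h) i) (splitAt (suc h) j) (congruent-values {i} {j} eq)
        (λ s≡s′ → <⇒≢ i<j (split-injective {i} {j} s≡s′))

    h<p : h ℕ.< p
    h<p = subst (h ℕ.<_) (sym p≡) (s≤s (ℕ.m≤m+n h h))

    ∣⇒≡0 : ∀ {n} → n ℕ.< p → P ∣ + n → n ≡ 0
    ∣⇒≡0 {zero}  _   _ = refl
    ∣⇒≡0 {suc n} n<p d = contradiction (∣⇒∣ᵤ d) (ℕ.>⇒∤ n<p)

    small-mod : ∀ {m n} → m ℕ.≤ n → n ℕ.< p → + n ≡ₚ + m → m ≡ n
    small-mod {m} {n} m≤n n<p eq = ℕ.≤-antisym m≤n (ℕ.m∸n≡0⇒m≤n
      (∣⇒≡0 (ℕ.≤-<-trans (ℕ.m∸n≤m n m) n<p)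
        (subst (P ∣_) (trans (ℤ.m-n≡m⊖n n m) (ℤ.⊖-≥ m≤n)) (∣-diff eq))))

    sq : ∀ {m} → Fin m → ℤ
    sq i = + toℕ i * + toℕ i

    difference-of-squares : ∀ {x y} → x * x ≡ₚ y * y → (x ≡ₚ y) ⊎ (P ∣ x + y)
    difference-of-squares {x} {y} eq = Sum.map₁ congruent
      (euclid (x - y) (x + y) (subst (P ∣_) (lemma x y) (∣-diff eq)))
      where
      lemma : ∀ x y → x * x - y * y ≡ (x - y) * (x + y)
      lemma = solve-∀

    -- If `i² ≡ j²` then `i ≡ j` or `p` divides `i + j`. As `i + j ≤ 2h < p`, the second case forces
    -- both to be 0.
    sq-injective : Injective (sq {suc h})
    sq-injective {i} {j} eq = toℕ-injective (Sum.[ equal , opposite ]′ (difference-of-squares eq))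
      where
      ≤h : ∀ (i : Fin (suc h)) → toℕ i ℕ.≤ h
      ≤h i = ℕ.≤-pred (toℕ<n i)
      equal : + toℕ i ≡ₚ + toℕ j → toℕ i ≡ toℕ j
      equal i≡j with ℕ.≤-total (toℕ i) (toℕ j)
      ... | inj₁ i≤j = small-mod i≤j (ℕ.≤-<-trans (≤h j) h<p) (mod-sym i≡j)
      ... | inj₂ j≤i = sym (small-mod j≤i (ℕ.≤-<-trans (≤h i) h<p) i≡j)
      opposite : P ∣ + toℕ i + + toℕ j → toℕ i ≡ toℕ j
      opposite d = trans (ℕ.m+n≡0⇒m≡0 (toℕ i) sum≡0) (sym (ℕ.m+n≡0⇒n≡0 (toℕ i) sum≡0))
        where
        sum≡0 : toℕ i ℕ.+ toℕ j ≡ 0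
        sum≡0 = ∣⇒≡0 (subst (toℕ i ℕ.+ toℕ j ℕ.<_) (sym p≡) (s≤s (ℕ.+-mono-≤ (≤h i) (≤h j))))
          (subst (P ∣_) (sym (ℤ.pos-+ (toℕ i) (toℕ j))) d)

    scaled-sq-injective : ∀ {v} → ¬ (P ∣ v) → Injective (λ (i : Fin (suc h)) → v * sq i)
    scaled-sq-injective P∤v eq = sq-injective (cancelˡ P∤v eq)

    unit-suc : ∀ (i : Fin h) → ¬ (P ∣ + toℕ (suc i))
    unit-suc i d with () ← ∣⇒≡0 (ℕ.≤-<-trans (toℕ<n i) h<p) d

    -- Every unit is ± j with 1 ≤ j ≤ h.
    unit-square : ∀ {s} → ¬ (P ∣ s) → ∃[ i ] s * s ≡ₚ sq {suc h} (suc i)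
    unit-square {s} P∤s = cases ((s %ℕ p) {{nz}}) (n%ℕd<d s p {{nz}}) (residue s p {{nz}})
      where
      index : ∀ {s r} → ¬ (P ∣ s) → r ℕ.≤ h → s ≡ₚ + r → ∃[ i ] s * s ≡ₚ sq {suc h} (suc i)
      index {s} {zero}  P∤s _   s≡0 = contradiction (mod⇒∣ s≡0) P∤s
      index {s} {suc r} P∤s r<h s≡r = fromℕ< r<h ,
        subst (λ k → s * s ≡ₚ + suc k * + suc k) (sym (toℕ-fromℕ< r<h)) (mod-* s≡r s≡r)
      cases : ∀ r → r ℕ.< p → s ≡ₚ + r → ∃[ i ] s * s ≡ₚ sq {suc h} (suc i)
      cases r r<p s≡r with r ℕ.≤? h
      ... | yes r≤h = index P∤s r≤h s≡r
      ... | no  r≰h = proj₁ found , mod-trans (≡⇒mod (lemma s)) (proj₂ found)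
        where
        p∸r≤h : p ℕ.∸ r ℕ.≤ h
        p∸r≤h = subst (λ n → n ℕ.∸ r ℕ.≤ h) (sym p≡)
          (ℕ.≤-trans (ℕ.∸-monoʳ-≤ (suc (h ℕ.+ h)) (ℕ.≰⇒> r≰h)) (ℕ.≤-reflexive (ℕ.m+n∸m≡n (suc h) h)))
        -s≡ : - s ≡ₚ + (p ℕ.∸ r)
        -s≡ = mod-trans (mod-neg s≡r) (congruent (divides (- 1ℤ) (trans
          (cong (_-_ (- (+ r))) (trans (sym (ℤ.⊖-≥ (ℕ.<⇒≤ r<p))) (sym (ℤ.m-n≡m⊖n p r))))
          (lemma′ (+ r) P))))
          where
          lemma′ : ∀ r P → - r - (P - r) ≡ - 1ℤ * P
          lemma′ = solve-∀
        found = index { - s} (λ d → P∤s (subst (P ∣_) (ℤ.neg-involutive s) (∣m⇒∣-m d))) p∸r≤h -s≡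
        lemma : ∀ s → s * s ≡ (- s) * (- s)
        lemma = solve-∀

    Square : ℤ → Set
    Square u = ∃[ s ] u ≡ₚ s * s

    square? : ∀ u → Dec (Square u)
    square? u with any? {n = p} (λ i → u ≡ₚ? sq i)
    ... | yes (i , u≡) = yes (+ toℕ i , u≡)
    ... | no none = no λ (s , u≡) → none (residueFin s , mod-trans u≡ (mod-* (residueFin-mod s) (residueFin-mod s)))

    Square-resp : ∀ {u v} → u ≡ₚ v → Square u → Square v
    Square-resp u≡v (s , u≡) = s , mod-trans (mod-sym u≡v) u≡

    Square-scale : ∀ {u v} s → u ≡ₚ v * (s * s) → Square v → Square u
    Square-scale s u≡ (a , v≡) = a * s , mod-trans u≡ (mod-trans (mod-* v≡ mod-refl) (≡⇒mod (lemma a s)))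
      where
      lemma : ∀ a s → (a * a) * (s * s) ≡ (a * s) * (a * s)
      lemma = solve-∀

    divide-square : ∀ {u v s} → ¬ (P ∣ s) → u ≡ₚ v * (s * s) → ∃[ r ] v ≡ₚ u * (r * r)
    divide-square {u} {v} {s} P∤s u≡ with r , sr≡1 ← inverse P∤s = r , mod-trans
      (≡⇒mod (lemma₁ v)) (mod-trans (mod-* (mod-refl {x = v}) (mod-sym (mod-* sr≡1 sr≡1)))
        (mod-trans (≡⇒mod (lemma₂ v s r)) (mod-* (mod-sym u≡) mod-refl)))
      where
      lemma₁ : ∀ v → v ≡ v * (1ℤ * 1ℤ)
      lemma₁ = solve-∀
      lemma₂ : ∀ v s r → v * ((s * r) * (s * r)) ≡ (v * (s * s)) * (r * r)
      lemma₂ = solve-∀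

    Square-unscale : ∀ {u v} s → ¬ (P ∣ s) → u ≡ₚ v * (s * s) → Square u → Square v
    Square-unscale {u} {v} s P∤s u≡ = Square-scale {v} {u} (proj₁ divided) (proj₂ divided)
      where
      divided = divide-square {u} {v} {s} P∤s u≡

    unit-root : ∀ {u v s} → ¬ (P ∣ u) → u ≡ₚ v * (s * s) → ¬ (P ∣ s)
    unit-root {u} {v} {s} P∤u u≡ P∣s = P∤u (∣-resp-mod (mod-sym u≡) (∣n⇒∣m*n v (∣m⇒∣m*n s P∣s)))

    -- The squares and the products of v with the nonzero squares exhaust the residues.
    nonsquare-ratio : ∀ {u v} → ¬ (P ∣ v) → ¬ Square u → ¬ Square v → ∃[ s ] u ≡ₚ v * (s * s)
    nonsquare-ratio {u} {v} P∤v u-nonsq v-nonsq with any? {n = h} (λ i → u ≡ₚ? v * sq {suc h} (suc i))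
    ... | yes (i , u≡) = + toℕ (suc i) , u≡
    ... | no none = meet (collision sq g sq-injective g-injective)
      where
      -- If `u` is not `v` times a nonzero square, these `h + 1` values are distinct. None of them
      -- is a square, so they cannot meet the `h + 1` squares, against `collision`.
      g : Fin (suc h) → ℤ
      g zero    = u
      g (suc i) = v * sq {suc h} (suc i)

      g-injective : Injective g
      g-injective {zero}  {zero}  eq = refl
      g-injective {zero}  {suc j} eq = contradiction (j , eq) none
      g-injective {suc i} {zero}  eq = contradiction (i , mod-sym eq) none
      g-injective {suc i} {suc j} eq = scaled-sq-injective P∤v {suc i} {suc j} eq

      meet : ∃[ i ] ∃[ j ] sq {suc h} i ≡ₚ g j → ∃[ s ] u ≡ₚ v * (s * s)
      meet (i , zero  , eq) = contradiction (+ toℕ i , mod-sym eq) u-nonsq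
      meet (i , suc j , eq) = contradiction
        (Square-unscale (+ toℕ (suc j)) (unit-suc j) eq (+ toℕ i , mod-refl)) v-nonsq

    Class : Fin 2 → ℤ → Set
    Class zero       u = ¬ (P ∣ u) × Square u
    Class (suc zero) u = ¬ (P ∣ u) × ¬ Square u

    Class-unit : ∀ {c u} → Class c u → ¬ (P ∣ u)
    Class-unit {zero}     = proj₁
    Class-unit {suc zero} = proj₁

    Class-resp : ∀ {c u v} → u ≡ₚ v → Class c u → Class c v
    Class-resp {zero}     u≡v (P∤u , sqr) = P∤u ∘ ∣-resp-mod (mod-sym u≡v) , Square-resp u≡v sqr
    Class-resp {suc zero} u≡v (P∤u , nsq) = P∤u ∘ ∣-resp-mod (mod-sym u≡v) , nsq ∘ Square-resp (mod-sym u≡v)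

    classify : ∀ u → ¬ (P ∣ u) → ∃[ c ] Class c u
    classify u P∤u with square? u
    ... | yes s = zero , P∤u , s
    ... | no ns = suc zero , P∤u , ns

    class-ratio : ∀ c {u v} → Class c u → Class c v → ∃[ s ] u ≡ₚ v * (s * s)
    class-ratio zero {u} {v} (P∤u , a , u≡) (P∤v , b , v≡) =
      let r , 1≡ = divide-square {v} {1ℤ} {b} (unit-root {v} {1ℤ} P∤v v≡1*) v≡1* in
      a * r , mod-trans u≡ (mod-trans (≡⇒mod (lemma₁ (a * a)))
        (mod-trans (mod-* (mod-refl {x = a * a}) 1≡) (≡⇒mod (lemma₂ a v r))))
      where
      v≡1* : v ≡ₚ 1ℤ * (b * b)
      v≡1* = mod-trans v≡ (≡⇒mod (sym (ℤ.*-identityˡ (b * b))))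
      lemma₁ : ∀ a → a ≡ a * 1ℤ
      lemma₁ = solve-∀
      lemma₂ : ∀ a v r → (a * a) * (v * (r * r)) ≡ v * ((a * r) * (a * r))
      lemma₂ = solve-∀
    class-ratio (suc zero) (_ , u-nonsq) (P∤v , v-nonsq) = nonsquare-ratio P∤v u-nonsq v-nonsq

    ratio-class : ∀ {c c′ u v s} → Class c u → Class c′ v → u ≡ₚ v * (s * s) → c ≡ c′
    ratio-class {zero}     {zero}     _ _ _ = refl
    ratio-class {suc zero} {suc zero} _ _ _ = refl
    ratio-class {zero}     {suc zero} {u} {v} {s} (P∤u , sqr) (_ , nsq) u≡ =
      contradiction (Square-unscale s (unit-root {u} {v} {s} P∤u u≡) u≡ sqr) nsq
    ratio-class {suc zero} {zero}     {s = s} (_ , nsq) (_ , sqr) u≡ = contradiction (Square-scale s u≡ sqr) nsq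

    flip : Fin 2 → Fin 2
    flip zero       = suc zero
    flip (suc zero) = zero

    -1-unit : ¬ (P ∣ - 1ℤ)
    -1-unit d = p∤1 (∣m⇒∣-m d)

    -1-class : ∃[ c ] Class c (- 1ℤ)
    -1-class = classify (- 1ℤ) -1-unit

    -- Multiplication by -1 on the two square classes; the first argument is the class of -1.
    negate : Fin 2 → Fin 2 → Fin 2
    negate zero       c = c
    negate (suc zero) c = flip c

    neg-unit : ∀ {u} → ¬ (P ∣ u) → ¬ (P ∣ - u)
    neg-unit {u} P∤u d = P∤u (subst (P ∣_) (ℤ.neg-involutive u) (∣m⇒∣-m d))

    Class-negate : ∀ ν c {u} → Class ν (- 1ℤ) → Class c u → Class (negate ν c) (- u)
    Class-negate zero zero {u} (_ , w , -1≡) (P∤u , sqr) = neg-unit P∤u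
      , Square-scale w (mod-trans (≡⇒mod (lemma u)) (mod-*ˡ u -1≡)) sqr
      where
      lemma : ∀ u → - u ≡ u * (- 1ℤ)
      lemma = solve-∀
    Class-negate zero (suc zero) {u} (_ , w , -1≡) (P∤u , nsq) = neg-unit P∤u
      , λ sqr → nsq (Square-scale w (mod-trans (≡⇒mod (lemma u)) (mod-*ˡ (- u) -1≡)) sqr)
      where
      lemma : ∀ u → u ≡ (- u) * (- 1ℤ)
      lemma = solve-∀
    Class-negate (suc zero) zero {u} (_ , nsq) (P∤u , a , u≡) = neg-unit P∤u
      , λ sqr → nsq (Square-unscale a
          (unit-root {u} {1ℤ} {a} P∤u (mod-trans u≡ (≡⇒mod (sym (ℤ.*-identityˡ (a * a))))))
          (mod-trans (mod-neg u≡) (≡⇒mod (lemma (a * a)))) sqr)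
      where
      lemma : ∀ a → - a ≡ - 1ℤ * a
      lemma = solve-∀
    Class-negate (suc zero) (suc zero) {u} -1-cls (P∤u , nsq) = neg-unit P∤u , negated
      where
      negated : Square (- u)
      negated with s , u≡ ← nonsquare-ratio -1-unit nsq (proj₂ -1-cls) =
        s , mod-trans (mod-neg u≡) (≡⇒mod (lemma (s * s)))
        where
        lemma : ∀ a → - (- 1ℤ * a) ≡ a
        lemma = solve-∀

    -- With x = z + y, the equation c x² + d = 0 becomes (c z² + d) + 2 c z y + c y² = 0.
    hensel : Hensel 1
    hensel c d z P∤c P∤z P∣ = x , x-zero , x-unit
      where
      q b : ℤₚ p
      q = c *ₚ fromℤ (z * z) +ₚ d
      b = fromℤ (+ 2) *ₚ (c *ₚ fromℤ z)

      P∤2 : ¬ (P ∣ + 2)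
      P∤2 d = contradiction (∣⇒∣ᵤ d) (ℕ.>⇒∤ (2<p h p≡))
        where
        2<p : ∀ h → p ≡ suc (h ℕ.+ h) → 2 ℕ.< p
        2<p zero    refl = contradiction ∣-refl p∤1
        2<p (suc h) refl = s≤s (s≤s (ℕ.≤-trans (s≤s z≤n) (ℕ.m≤n+m (suc h) h)))

      rooted = quadratic-root q b c (subst (_∣ res q 1) (ℤ.^-identityʳ P) P∣) (∤* P∤2 (∤* P∤c P∤z))
      y = proj₁ rooted

      x : ℤₚ p
      x = fromℤ z +ₚ y

      x-zero : ∀ m → P ^ m ∣ res c m * (res x m * res x m) + res d m
      x-zero m = subst (P ^ m ∣_) (lemma (res c m) z (res d m) (res y m)) (proj₁ (proj₂ rooted) m)
        where
        lemma : ∀ c z d y → (c * (z * z) + d) + (+ 2) * (c * z) * y + c * (y * y) ≡ c * ((z + y) * (z + y)) + d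
        lemma = solve-∀

      x-unit : ¬ (P ∣ res x 1)
      x-unit P∣x = P∤z (∣m+n∣n⇒∣m {n = res y 1} P∣x (proj₂ (proj₂ rooted)))

    same : Fin 2 → Fin 2 → Bool
    same zero       zero       = true
    same (suc zero) (suc zero) = true
    same _          _          = false

    same⇒≡ : ∀ c c′ → same c c′ ≡ true → c ≡ c′
    same⇒≡ zero       zero       _ = refl
    same⇒≡ (suc zero) (suc zero) _ = refl

    same-refl : ∀ c → same c c ≡ true
    same-refl zero       = refl
    same-refl (suc zero) = refl

    select : ∀ {d} → Bool → Vec (Label 2) d → List (Fin 2)
    select b []             = []
    select b ((ε , c) ∷ ls) = if ε xor b then select b ls else c ∷ select b ls

    diag : ∀ {k} → Vector ℤ k → Vector ℤ k → ℤ
    diag v y = ∑ (λ i → v i * (y i * y i))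

    HasUnit : ∀ {k} → Vector ℤ k → Set
    HasUnit y = ∃[ i ] ¬ (P ∣ y i)

    UnitCoordinate : ∀ {d} → Bool → Vec (Label 2) d → Vector ℤ d → Set
    UnitCoordinate b ls z = ∃[ j ] parity ls j ≡ b × ¬ (P ∣ z j)

    -- Modulo p, the form G, with unit coordinates given by U, is diagonal with
    -- unit coefficients in the classes L.
    record Reduced {d} (L : List (Fin 2)) (G : Vector ℤ d → ℤ) (U : Vector ℤ d → Set) : Set where
      field
        v      : Vector ℤ (length L)
        cls    : ∀ i → Class (List.lookup L i) (v i)
        expand : ∀ y → ∃[ z ] G z ≡ₚ diag v y × (HasUnit y → U z)
        shrink : ∀ z → ∃[ y ] G z ≡ₚ diag v y × (U z → HasUnit y)

    -- A coefficient divisible by `p` vanishes modulo `p`, so its coordinate is forgotten in one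
    -- direction and set to 0 in the other.
    skip : ∀ {d L G U V} u → Reduced {d} L G U →
      (∀ {z} → U (z ∘ suc) → V z) → (∀ {z} → V z → U (z ∘ suc)) →
      Reduced {suc d} L (λ z → P ^ 1 * (u * (z zero * z zero)) + G (z ∘ suc)) V
    skip {G = G} u R U⇒V V⇒U = record
      { v = v
      ; cls = cls
      ; expand = λ y → let z , eq , unit = expand y in
          (0ℤ Vector.∷ z) , mod-trans (ignore 0ℤ (G z)) eq , (λ hu → U⇒V (unit hu))
      ; shrink = λ z → let y , eq , unit = shrink (z ∘ suc) in
          y , mod-trans (ignore (z zero) (G (z ∘ suc))) eq , (λ vz → unit (V⇒U vz))
      }
      where
      open Reduced R
      ignore : ∀ x g → P ^ 1 * (u * (x * x)) + g ≡ₚ g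
      ignore x g = congruent (divides (u * (x * x)) (lemma P (u * (x * x)) g))
        where
        lemma : ∀ P a g → P * 1ℤ * a + g - g ≡ a * P
        lemma = solve-∀

    keep : ∀ {d L c G U V} u → Class c u → Reduced {d} L G U →
      (∀ {z} → ¬ (P ∣ z zero) → V z) → (∀ {z} → U (z ∘ suc) → V z) →
      (∀ {z} → V z → ¬ (P ∣ z zero) ⊎ U (z ∘ suc)) →
      Reduced {suc d} (c ∷ L) (λ z → P ^ 0 * (u * (z zero * z zero)) + G (z ∘ suc)) V
    keep {L = L} {c = c} {G = G} {V = V} u u-cls R unit⇒V U⇒V V⇒U = record
      { v = u Vector.∷ v
      ; cls = λ { zero → u-cls ; (suc i) → cls i }
      ; expand = λ y → let z , eq , unit = expand (y ∘ suc) in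
          (y zero Vector.∷ z) , keep-mod (y zero) eq , expand-unit y z unit
      ; shrink = λ z → let y , eq , unit = shrink (z ∘ suc) in
          (z zero Vector.∷ y) , keep-mod (z zero) eq
          , (λ vz → Sum.[ (λ P∤z → zero , P∤z) , (λ uz → let i , P∤y = unit uz in suc i , P∤y) ]′ (V⇒U vz))
      }
      where
      open Reduced R
      keep-mod : ∀ x {a b} → a ≡ₚ b → P ^ 0 * (u * (x * x)) + a ≡ₚ u * (x * x) + b
      keep-mod x eq = mod-+ (≡⇒mod (ℤ.*-identityˡ (u * (x * x)))) eq
      expand-unit : ∀ y z → (HasUnit (y ∘ suc) → _) → HasUnit y → V (y zero Vector.∷ z)
      expand-unit y z unit (zero  , P∤y) = unit⇒V P∤y
      expand-unit y z unit (suc i , P∤y) = U⇒V (unit (i , P∤y))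

    reduction : ∀ {d} b (ls : Vec (Label 2) d) u → (∀ i → Class (class ls i) (u i)) →
      Reduced (select b ls) (form b (parity ls) u) (UnitCoordinate b ls)
    reduction b [] u cls = record
      { v = λ () ; cls = λ () ; expand = λ _ → (λ ()) , mod-refl , λ () ; shrink = λ _ → (λ ()) , mod-refl , λ () }
    reduction {suc d} b ((ε , c) ∷ ls) u cls = step ε b (cls zero) (reduction b ls (u ∘ suc) (cls ∘ suc))
      where
      here-or-later : ∀ ε b (z : Vector ℤ (suc d)) →
        UnitCoordinate b ((ε , c) ∷ ls) z → ¬ (P ∣ z zero) ⊎ UnitCoordinate b ls (z ∘ suc)
      here-or-later ε b z (zero  , _   , P∤z) = inj₁ P∤z
      here-or-later ε b z (suc j , par , P∤z) = inj₂ (j , par , P∤z)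

      later : ∀ ε b (z : Vector ℤ (suc d)) → UnitCoordinate b ls (z ∘ suc) → UnitCoordinate b ((ε , c) ∷ ls) z
      later ε b z (j , par , P∤z) = suc j , par , P∤z

      not-here : ∀ ε b (z : Vector ℤ (suc d)) → ε ≢ b → UnitCoordinate b ((ε , c) ∷ ls) z → UnitCoordinate b ls (z ∘ suc)
      not-here ε b z ε≢b (zero  , ε≡b , _)   = contradiction ε≡b ε≢b
      not-here ε b z ε≢b (suc j , par , P∤z) = j , par , P∤z

      -- The parities are generalised so that they can be matched: only for concrete `ε` and `b` do
      -- `select` and the exponent in `form` compute.
      step : ∀ ε b → Class c (u zero) →
        Reduced (select b ls) (form b (parity ls) (u ∘ suc)) (UnitCoordinate b ls) →
        Reduced (select b ((ε , c) ∷ ls)) (form b (parity ((ε , c) ∷ ls)) u) (UnitCoordinate b ((ε , c) ∷ ls))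
      step false false u-cls R =
        keep (u zero) u-cls R (λ P∤z → zero , refl , P∤z) (λ {z} → later false false z) (λ {z} → here-or-later false false z)
      step true  true  u-cls R =
        keep (u zero) u-cls R (λ P∤z → zero , refl , P∤z) (λ {z} → later true true z) (λ {z} → here-or-later true true z)
      step false true  u-cls R = skip (u zero) R (λ {z} → later false true z) (λ {z} → not-here false true z λ ())
      step true  false u-cls R = skip (u zero) R (λ {z} → later true false z) (λ {z} → not-here true false z λ ())

    -- Solubility of the diagonal form with classes L; ν is the class of -1.
    zero? : Fin 2 → List (Fin 2) → Bool
    zero? ν []               = false
    zero? ν (_ ∷ [])         = false
    zero? ν (c ∷ c′ ∷ [])    = same (negate ν c) c′
    zero? ν (_ ∷ _ ∷ _ ∷ _)  = true

    -- Two coefficients: equal classes of `- v₀` and `v₁` make `- v₀ / v₁` a square. Three or more: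
    -- the third coordinate is 1, later ones are 0, and `v₀ x²` and `- v₂ - v₁ y²` each take `h + 1`
    -- values, so they meet.
    zero-sound : ∀ {ν} → Class ν (- 1ℤ) → ∀ L v → (∀ i → Class (List.lookup L i) (v i)) → zero? ν L ≡ true →
      ∃[ y ] diag v y ≡ₚ 0ℤ × HasUnit y
    zero-sound {ν} ν-cls (c ∷ c′ ∷ []) v cls eq =
      (1ℤ Vector.∷ s Vector.∷ λ ())
      , mod-trans (mod-+ (mod-refl {x = v zero * (1ℤ * 1ℤ)}) (mod-+ (mod-sym (proj₂ ratio)) mod-refl)) (≡⇒mod (lemma (v zero)))
      , zero , p∤1
      where
      ratio : ∃[ s ] - v zero ≡ₚ v (suc zero) * (s * s)
      ratio = class-ratio c′ {v = v (suc zero)}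
        (subst (λ c → Class c (- v zero)) (same⇒≡ (negate ν c) c′ eq) (Class-negate ν c ν-cls (cls zero))) (cls (suc zero))
      s = proj₁ ratio
      lemma : ∀ v → v * (1ℤ * 1ℤ) + (- v + 0ℤ) ≡ 0ℤ
      lemma = solve-∀
    zero-sound ν-cls (c₀ ∷ c₁ ∷ c₂ ∷ L) v cls eq =
      (x Vector.∷ y Vector.∷ 1ℤ Vector.∷ λ _ → 0ℤ)
      , mod-trans (mod-+ (proj₂ (proj₂ met)) (≡⇒mod (cong (λ r → v₁ * (y * y) + (v₂ * (1ℤ * 1ℤ) + r)) (diag-zero (λ i → v (suc (suc (suc i))))))))
          (≡⇒mod (lemma v₁ v₂ (y * y)))
      , suc (suc zero) , p∤1
      where
      v₀ = v zero
      v₁ = v (suc zero)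
      v₂ = v (suc (suc zero))

      unit₀ : ¬ (P ∣ v₀)
      unit₀ = Class-unit {c₀} (cls zero)
      unit₁ : ¬ (P ∣ v₁)
      unit₁ = Class-unit {c₁} (cls (suc zero))

      g : Fin (suc h) → ℤ
      g j = - v₂ - v₁ * sq j

      g-injective : Injective g
      g-injective {i} {j} eq = scaled-sq-injective unit₁ {i} {j}
        (mod-trans (≡⇒mod (lemma₁ v₂ (v₁ * sq i))) (mod-trans (mod-+ (mod-refl {x = - v₂}) (mod-neg eq)) (≡⇒mod (sym (lemma₁ v₂ (v₁ * sq j))))))
        where
        lemma₁ : ∀ a b → b ≡ - a + - (- a - b)
        lemma₁ = solve-∀

      met : ∃[ i ] ∃[ j ] v₀ * sq i ≡ₚ g j
      met = collision (λ i → v₀ * sq i) g (λ {i} {j} → scaled-sq-injective unit₀ {i} {j}) g-injective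

      x y : ℤ
      x = + toℕ (proj₁ met)
      y = + toℕ (proj₁ (proj₂ met))

      diag-zero : ∀ {k} (v : Vector ℤ k) → diag v (λ _ → 0ℤ) ≡ 0ℤ
      diag-zero {zero}  v = refl
      diag-zero {suc k} v = trans (cong₂ _+_ (ℤ.*-zeroʳ (v zero)) (diag-zero (v ∘ suc))) refl

      lemma : ∀ v₁ v₂ s → (- v₂ - v₁ * s) + (v₁ * s + (v₂ * (1ℤ * 1ℤ) + 0ℤ)) ≡ 0ℤ
      lemma = solve-∀

    -- In two variables, if `p` divided `y₀` it would divide `y₁` as well. So `y₀` is invertible,
    -- `- v₀ ≡ v₁ (y₁ / y₀)²`, and the classes agree, contrary to the test.
    zero-complete : ∀ {ν} → Class ν (- 1ℤ) → ∀ L v → (∀ i → Class (List.lookup L i) (v i)) → zero? ν L ≡ false →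
      ∀ y → diag v y ≡ₚ 0ℤ → ¬ HasUnit y
    zero-complete ν-cls (c ∷ []) v cls eq y zer (zero , P∤y) =
      P∤y (∣²⇒∣ {y zero} (∣*⇒∣ʳ (Class-unit {c} (cls zero)) (subst (P ∣_) (ℤ.+-identityʳ _) (mod⇒∣ zer))))
    zero-complete {ν} ν-cls (c ∷ c′ ∷ []) v cls eq y zer unit =
      contradiction (trans (sym (same-refl c′)) (trans (cong (λ c → same c c′) (sym classes-equal)) eq)) λ ()
      where
      y₀ = y zero
      y₁ = y (suc zero)
      v₀ = v zero
      v₁ = v (suc zero)

      opposite : v₁ * (y₁ * y₁) ≡ₚ - v₀ * (y₀ * y₀)
      opposite = mod-trans (≡⇒mod (lemma v₀ (y₀ * y₀) (v₁ * (y₁ * y₁))))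
        (mod-trans (mod-+ zer (mod-refl {x = - v₀ * (y₀ * y₀)})) (≡⇒mod (ℤ.+-identityˡ (- v₀ * (y₀ * y₀)))))
        where
        lemma : ∀ v s b → b ≡ (v * s + (b + 0ℤ)) + - v * s
        lemma = solve-∀

      P∤y₀ : ¬ (P ∣ y₀)
      P∤y₀ P∣y₀ = no-unit unit
        where
        P∣y₁ : P ∣ y₁
        P∣y₁ = ∣²⇒∣ {y₁} (∣*⇒∣ʳ (Class-unit {c′} (cls (suc zero)))
          (∣-resp-mod (mod-sym opposite) (∣n⇒∣m*n (- v₀) (∣m⇒∣m*n y₀ P∣y₀))))
        no-unit : ¬ HasUnit y
        no-unit (zero     , nd) = nd P∣y₀
        no-unit (suc zero , nd) = nd P∣y₁

      r = proj₁ (inverse P∤y₀)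

      ratio : - v₀ ≡ₚ v₁ * ((y₁ * r) * (y₁ * r))
      ratio = mod-trans (≡⇒mod (lemma₁ (- v₀)))
        (mod-trans (mod-*ˡ (- v₀) (mod-sym (mod-* (proj₂ (inverse P∤y₀)) (proj₂ (inverse P∤y₀)))))
        (mod-trans (≡⇒mod (lemma₂ (- v₀) y₀ r))
        (mod-trans (mod-* (mod-sym opposite) (mod-refl {x = r * r})) (≡⇒mod (sym (lemma₂ v₁ y₁ r))))))
        where
        lemma₁ : ∀ v → v ≡ v * (1ℤ * 1ℤ)
        lemma₁ = solve-∀
        lemma₂ : ∀ v y r → v * ((y * r) * (y * r)) ≡ (v * (y * y)) * (r * r)
        lemma₂ = solve-∀

      classes-equal : negate ν c ≡ c′
      classes-equal = ratio-class {negate ν c} {c′} {s = y₁ * r} (Class-negate ν c ν-cls (cls zero)) (cls (suc zero)) ratio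

    -- A nonsquare unit `v` yields the representatives `v j²` of the second class. Its existence is
    -- decided by search; in the negative case the class is empty and the empty list covers it,
    -- which the upper bound on the number of representatives permits.
    Nonsquare : Fin p → Set
    Nonsquare i = ¬ (P ∣ + toℕ i) × ¬ Square (+ toℕ i)

    nonsquare? : Dec (∃[ i ] Nonsquare i)
    nonsquare? = any? (λ i → ¬? (P ∣? + toℕ i) ×-dec ¬? (square? (+ toℕ i)))

    half : ℚ
    half = + 1 ℚ./ 2

    -- From `p = 1 + 2h` follows `h / p = (1 - 1/p) / 2`: each class takes at most half of the
    -- units.
    size : ∀ {k} → k ℕ.≤ h → k ×ℚ 1ℚ ℚ.* p⁻¹ p ^ℚ 1 ℚ.≤ (1ℚ ℚ.- p⁻¹ p) ℚ.* half
    size {k} k≤h = ℚ.≤-trans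
      (ℚ.*-monoʳ-≤-nonNeg (p⁻¹ p ^ℚ 1) {{ℚ.nonNegative (0≤^ 1 (Measure.0≤t p))}} (×-mono-≤ k≤h))
      (ℚ.≤-reflexive (begin
        H ℚ.* (p⁻¹ p ℚ.* 1ℚ)                                 ≡⟨ lemma H (p⁻¹ p) half ⟩
        ((1ℚ ℚ.+ (H ℚ.+ H)) ℚ.* p⁻¹ p ℚ.- p⁻¹ p) ℚ.* half ℚ.+ H ℚ.* p⁻¹ p ℚ.* (1ℚ ℚ.- (half ℚ.+ half))
          ≡⟨ cong₂ (λ a b → (a ℚ.- p⁻¹ p) ℚ.* half ℚ.+ b) p*t (ℚ.*-zeroʳ (H ℚ.* p⁻¹ p)) ⟩
        (1ℚ ℚ.- p⁻¹ p) ℚ.* half ℚ.+ 0ℚ                       ≡⟨ ℚ.+-identityʳ _ ⟩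
        (1ℚ ℚ.- p⁻¹ p) ℚ.* half                              ∎))
      where
      open ≡-Reasoning
      H = h ×ℚ 1ℚ
      p*t : (1ℚ ℚ.+ (H ℚ.+ H)) ℚ.* p⁻¹ p ≡ 1ℚ
      p*t = trans (cong (ℚ._* p⁻¹ p) (trans (cong (1ℚ ℚ.+_) (sym (×-homo-+ ℚ.+-0-monoid 1ℚ h h)))
        (cong (_×ℚ 1ℚ) (sym p≡)))) (p*p⁻¹ p)
      -- The solver treats `half` as a variable `e`, so the identity carries the correction term
      -- with `1 - (e + e)`, which evaluates to 0 at `half`.
      lemma : ∀ H t e → H ℚ.* (t ℚ.* 1ℚ) ≡
        ((1ℚ ℚ.+ (H ℚ.+ H)) ℚ.* t ℚ.- t) ℚ.* e ℚ.+ H ℚ.* t ℚ.* (1ℚ ℚ.- (e ℚ.+ e))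
      lemma = ℚ-solve-∀ ℚ-ring

    -- The class of -1 is a parameter, so that for each of its two literal values `iso` computes on
    -- labels, with `p` still a variable.
    module _ (ν : Fin 2) (ν-cls : Class ν (- 1ℤ)) (nonsquare? : Dec (∃[ i ] Nonsquare i)) where

      iso : ∀ {d} → Bool → Vec (Label 2) d → Bool
      iso b ls = zero? ν (select b ls)

      P¹∣ : ∀ {x} → P ∣ x → P ^ 1 ∣ x
      P¹∣ {x} = subst (_∣ x) (sym (ℤ.^-identityʳ P))

      P¹∣⁻ : ∀ {x} → P ^ 1 ∣ x → P ∣ x
      P¹∣⁻ {x} = subst (_∣ x) (ℤ.^-identityʳ P)

      iso-sound : ∀ {d} b (ls : Vec (Label 2) d) u → (∀ i → Class (class ls i) (u i)) → iso b ls ≡ true →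
        ∃[ z ] ∃[ j ] parity ls j ≡ b × ¬ (P ∣ z j) × P ^ 1 ∣ form b (parity ls) u z
      iso-sound b ls u cls eq = proj₁ expanded , proj₁ unit , proj₁ (proj₂ unit) , proj₂ (proj₂ unit)
        , P¹∣ (mod⇒∣ (mod-trans (proj₁ (proj₂ expanded)) (proj₁ (proj₂ zer))))
        where
        open Reduced (reduction b ls u cls) renaming (cls to v-cls)
        zer = zero-sound {ν} ν-cls (select b ls) v v-cls eq
        expanded = expand (proj₁ zer)
        unit = proj₂ (proj₂ expanded) (proj₂ (proj₂ zer))

      iso-complete : ∀ {d} b (ls : Vec (Label 2) d) u → (∀ i → Class (class ls i) (u i)) → iso b ls ≡ false →
        ∀ z → P ^ 1 ∣ form b (parity ls) u z → ∀ j → parity ls j ≡ b → P ∣ z j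
      iso-complete b ls u cls eq z div j par = decidable-stable (P ∣? z j) λ P∤z →
        zero-complete {ν} ν-cls (select b ls) v v-cls eq (proj₁ shrunk)
          (mod-trans (mod-sym (proj₁ (proj₂ shrunk))) (∣⇒mod (P¹∣⁻ div)))
          (proj₂ (proj₂ shrunk) (j , par , P∤z))
        where
        open Reduced (reduction b ls u cls) renaming (cls to v-cls)
        shrunk = shrink z

      nonsquare-reps : Dec (∃[ i ] Nonsquare i) → List ℤ
      nonsquare-reps (yes (i , _)) = List.tabulate {n = h} (λ j → + toℕ i * sq {suc h} (suc j))
      nonsquare-reps (no _)        = []

      reps : Fin 2 → List ℤ
      reps zero       = List.tabulate {n = h} (λ j → sq {suc h} (suc j))
      reps (suc zero) = nonsquare-reps nonsquare?

      to¹ : ∀ {x y} → x ≡ₚ y → x ≡ y mod (P ^ 1)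
      to¹ (congruent d) = congruent (P¹∣ d)

      covered-by : ∀ {n z} (f : Fin n → ℤ) i → z ≡ₚ f i → Any (λ r → z ≡ r mod (P ^ 1)) (List.tabulate f)
      covered-by {z = z} f i z≡ = Any.tabulate⁺ {P = λ r → z ≡ r mod (P ^ 1)} {f = f} i (to¹ z≡)

      scaled-covered : ∀ {v z} → ¬ (P ∣ z) → ∃[ s ] z ≡ₚ v * (s * s) →
        Any (λ r → z ≡ r mod (P ^ 1)) (List.tabulate {n = h} (λ j → v * sq {suc h} (suc j)))
      scaled-covered {v} {z} P∤z (s , z≡) =
        covered-by (λ j → v * sq {suc h} (suc j)) (proj₁ j) (mod-trans z≡ (mod-*ˡ v (proj₂ j)))
        where
        j = unit-square {s} (unit-root {z} {v} {s} P∤z z≡)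

      reps-cover : ∀ {c z} → Class c z → Any (λ r → z ≡ r mod (P ^ 1)) (reps c)
      reps-cover {zero} {z} (P∤z , s , z≡) = covered-by {z = z} (λ j → sq {suc h} (suc j)) (proj₁ j) (mod-trans z≡ (proj₂ j))
        where
        j = unit-square {s} (unit-root {z} {1ℤ} {s} P∤z (mod-trans z≡ (≡⇒mod (sym (ℤ.*-identityˡ (s * s))))))
      reps-cover {suc zero} {z} (P∤z , nsq) = find nonsquare?
        where
        find : ∀ d → Any (λ r → z ≡ r mod (P ^ 1)) (nonsquare-reps d)
        find (no none) = ⊥-elim (none (residueFin z
          , (λ d → P∤z (∣-resp-mod (mod-sym (residueFin-mod z)) d))
          , (λ sqr → nsq (Square-resp (mod-sym (residueFin-mod z)) sqr))))
        find (yes (i , P∤i , i-nsq)) = scaled-covered {+ toℕ i} P∤z (nonsquare-ratio {z} {+ toℕ i} P∤i nsq i-nsq)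

      classes : UnitClasses p
      classes = record
        { N = 2
        ; l = 0
        ; Class = Class
        ; Class-resp = λ {c} (congruent d) → Class-resp {c} (congruent (P¹∣⁻ d))
        ; classify = classify
        ; Class-unit = λ {c} → Class-unit {c}
        ; hensel = hensel
        ; iso = iso
        ; iso-sound = iso-sound
        ; iso-complete = iso-complete
        ; reps = reps
        ; reps-cover = λ {c} → reps-cover {c}
        ; share = half
        ; share-nonNeg = ℚ.nonNegative⁻¹ half
        ; reps-size = reps-size
        }
        where
        nonsquare-size : ∀ d → length (nonsquare-reps d) ℕ.≤ h
        nonsquare-size (yes _) = ℕ.≤-reflexive (List.length-tabulate _)
        nonsquare-size (no _)  = z≤n
        reps-size : ∀ c → length (reps c) ×ℚ 1ℚ ℚ.* p⁻¹ p ^ℚ 1 ℚ.≤ (1ℚ ℚ.- p⁻¹ p) ℚ.* half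
        reps-size zero       = size {length (reps zero)} (ℕ.≤-reflexive (List.length-tabulate {n = h} (λ j → sq {suc h} (suc j))))
        reps-size (suc zero) = size {length (reps (suc zero))} (nonsquare-size nonsquare?)

-- Counts and densities for `p = 2`.

module DyadicDensity where

  open Covers
  open Rationals
  open UnitClassification
  open DyadicClasses
  open import Data.Bool.Base using (not; true)
  open import Data.List.Base using ([]; _∷_)
  open import Data.Integer.Base using (+_)
  open import Data.Nat.Base using (_≥_)
  open import Data.Nat.Primality using (Prime)
  open import Data.Rational.Base using (ℚ; 1ℚ; _*_; _/_)
  import Data.Rational.Properties as ℚ
  open import Function.Base using (_∘_)
  open import Relation.Binary.PropositionalEquality

  module _ {{pr : Prime 2}} where
    open Two {{pr}} using (classes)
    open UnitClasses {2} {{pr}} classes using (soluble?)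
    open Density 2 {{pr}} classes using (density; density-one; weight)

    tally-3 : tally 3 soluble? ≡ 48 ∷ 96 ∷ 96 ∷ 48 ∷ []
    tally-3 = refl

    tally-3′ : tally 3 (not ∘ soluble?) ≡ 16 ∷ 96 ∷ 96 ∷ 16 ∷ []
    tally-3′ = refl

    -- Here `r = 2/3` and `weight = 1/6`. The soluble count at `t = 1/2` is
    -- `48 + 48 + 24 + 6 = 126`, and `126 / 6³ = 7/12`.
    conic : ρ[ 2 ][ 2 , 2 ]≡ (+ 7 / 12)
    conic = density 2
      (ℚ.≤-reflexive (trans (cong (λ f → weight ^ℚ 3 * eval f (p⁻¹ 2)) tally-3) refl))
      (ℚ.≤-reflexive (trans (cong (λ f → weight ^ℚ 3 * eval f (p⁻¹ 2)) tally-3′) refl))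

    tally-4 : tally 4 soluble? ≡ 240 ∷ 1024 ∷ 1344 ∷ 1024 ∷ 240 ∷ []
    tally-4 = refl

    tally-4′ : tally 4 (not ∘ soluble?) ≡ 16 ∷ 0 ∷ 192 ∷ 0 ∷ 16 ∷ []
    tally-4′ = refl

    -- The soluble count at `t = 1/2` is `240 + 512 + 336 + 128 + 15 = 1231`, and `6⁴ = 1296`.
    quadric : ρ[ 2 ][ 3 , 2 ]≡ (+ 1231 / 1296)
    quadric = density 3
      (ℚ.≤-reflexive (trans (cong (λ f → weight ^ℚ 4 * eval f (p⁻¹ 2)) tally-4) refl))
      (ℚ.≤-reflexive (trans (cong (λ f → weight ^ℚ 4 * eval f (p⁻¹ 2)) tally-4′) refl))

    universal : UnitClasses.universal? {2} {{pr}} classes ≡ true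
    universal = refl

    higher : ∀ n → n ≥ 4 → ρ[ 2 ][ n , 2 ]≡ 1ℚ
    higher = density-one universal

-- Counts and densities for odd `p`.

module OddDensities where

  open Covers
  open Rationals
  open DiagonalForms
  open UnitClassification
  open OddClasses
  open PadicPoints
  open import Data.Bool.Base using (true; not)
  open import Data.Fin.Base using (Fin; zero; suc)
  open import Data.List.Base using ([]; _∷_)
  import Data.Integer.Base as ℤ
  open import Data.Integer.Base using (+_)
  open import Data.Nat.Base as ℕ using (ℕ; suc)
  import Data.Nat.Properties as ℕ
  import Data.Nat.DivMod as ℕ
  import Data.Nat.Divisibility as ℕ
  open import Data.Nat.Primality using (Prime; prime⇒irreducible)
  open import Data.Product.Base using (_×_; _,_; proj₁; proj₂; ∃-syntax)
  open import Data.Sum.Base using (inj₂)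
  open import Data.Rational.Base using (ℚ; 0ℚ; 1ℚ; _+_; _-_; _*_; _÷_; _/_)
  import Data.Rational.Properties as ℚ
  open import Function.Base using (_∘_)
  open import Relation.Binary.PropositionalEquality
  open import Relation.Nullary.Negation using (contradiction)
  open import Relation.Nullary.Decidable.Core using (Dec)
  open import Tactic.RingSolver using (solve-∀)

  open ℚ-Semiring using () renaming (_×_ to _×ℚ_)

  -- The polynomial is `8 (1 + t)³ - 12 t (1 + t)`: all labellings minus the insoluble ones. In
  -- terms of `s = r (1 + t)` the claim becomes a ring identity within reach of the solver, and
  -- `s = 1` is substituted afterwards.
  conic-identity : ∀ r t → r * (1ℚ + t) ≡ 1ℚ →
    (r * (+ 1 / 2)) ^ℚ 3 * eval (8 ∷ 12 ∷ 12 ∷ 8 ∷ []) t ≡ 1ℚ - (+ 3 / 2) * t * r ^ℚ 2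
  conic-identity r t s≡1 = trans (lemma r t)
    (trans (cong (λ s → s * (s * s) - (+ 3 / 2) * t * (r * (r * 1ℚ)) * s) s≡1)
      (cong (_-_ 1ℚ) (ℚ.*-identityʳ ((+ 3 / 2) * t * (r * (r * 1ℚ))))))
    where
    lemma : ∀ r t → let w = r * (+ 1 / 2); s = r * (1ℚ + t) in
      w * (w * (w * 1ℚ)) * (8 ×ℚ 1ℚ + t * (12 ×ℚ 1ℚ + t * (12 ×ℚ 1ℚ + t * (8 ×ℚ 1ℚ + t * 0ℚ))))
        ≡ s * (s * s) - (+ 3 / 2) * t * (r * (r * 1ℚ)) * s
    lemma = solve-∀ ℚ-ring

  conic-identity′ : ∀ r t → r * (1ℚ + t) ≡ 1ℚ →
    (r * (+ 1 / 2)) ^ℚ 3 * eval (0 ∷ 12 ∷ 12 ∷ 0 ∷ []) t ≡ 1ℚ - (1ℚ - (+ 3 / 2) * t * r ^ℚ 2)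
  conic-identity′ r t s≡1 = trans (lemma r t)
    (cong (λ s → 1ℚ - (1ℚ - (+ 3 / 2) * t * (r * (r * s)))) s≡1)
    where
    lemma : ∀ r t → let w = r * (+ 1 / 2); s = r * (1ℚ + t) in
      w * (w * (w * 1ℚ)) * (0ℚ + t * (12 ×ℚ 1ℚ + t * (12 ×ℚ 1ℚ + t * (0ℚ + t * 0ℚ))))
        ≡ 1ℚ - (1ℚ - (+ 3 / 2) * t * (r * (r * s)))
    lemma = solve-∀ ℚ-ring

  -- The polynomial is `16 (1 + t)⁴ - 24 t²`, and `(r / 2)⁴` turns the two terms into `s⁴` and
  -- `(3/2) t² r⁴`.
  quadric-identity : ∀ r t → r * (1ℚ + t) ≡ 1ℚ →
    (r * (+ 1 / 2)) ^ℚ 4 * eval (16 ∷ 64 ∷ 72 ∷ 64 ∷ 16 ∷ []) t ≡ 1ℚ - (+ 3 / 2) * t ^ℚ 2 * r ^ℚ 4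
  quadric-identity r t s≡1 = trans (lemma r t)
    (cong (λ s → s * (s * (s * s)) - (+ 3 / 2) * (t * (t * 1ℚ)) * (r * (r * (r * (r * 1ℚ))))) s≡1)
    where
    lemma : ∀ r t → let w = r * (+ 1 / 2); s = r * (1ℚ + t) in
      w * (w * (w * (w * 1ℚ))) * (16 ×ℚ 1ℚ + t * (64 ×ℚ 1ℚ + t * (72 ×ℚ 1ℚ + t * (64 ×ℚ 1ℚ + t * (16 ×ℚ 1ℚ + t * 0ℚ)))))
        ≡ s * (s * (s * s)) - (+ 3 / 2) * (t * (t * 1ℚ)) * (r * (r * (r * (r * 1ℚ))))
    lemma = solve-∀ ℚ-ring

  quadric-identity′ : ∀ r t →
    (r * (+ 1 / 2)) ^ℚ 4 * eval (0 ∷ 0 ∷ 24 ∷ 0 ∷ 0 ∷ []) t ≡ 1ℚ - (1ℚ - (+ 3 / 2) * t ^ℚ 2 * r ^ℚ 4)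
  quadric-identity′ = lemma
    where
    lemma : ∀ r t → let w = r * (+ 1 / 2) in
      w * (w * (w * (w * 1ℚ))) * (0ℚ + t * (0ℚ + t * (24 ×ℚ 1ℚ + t * (0ℚ + t * (0ℚ + t * 0ℚ)))))
        ≡ 1ℚ - (1ℚ - (+ 3 / 2) * (t * (t * 1ℚ)) * (r * (r * (r * (r * 1ℚ)))))
    lemma = solve-∀ ℚ-ring

  odd⇒suc-double : ∀ p → Prime p → p ≢ 2 → ∃[ h ] p ≡ suc (h ℕ.+ h)
  odd⇒suc-double p pr p≢2 with p ℕ.% 2 in eq | ℕ.m%n<n p 2
  ... | 0 | _ with prime⇒irreducible pr (ℕ.m%n≡0⇒n∣m p 2 eq)
  ...   | inj₂ 2≡p = contradiction (sym 2≡p) p≢2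
  odd⇒suc-double p pr p≢2 | 1 | _ = p ℕ./ 2 , trans (ℕ.m≡m%n+[m/n]*n p 2)
    (cong₂ ℕ._+_ eq (trans (ℕ.*-comm (p ℕ./ 2) 2) (cong (p ℕ./ 2 ℕ.+_) (ℕ.+-identityʳ (p ℕ./ 2)))))
  odd⇒suc-double p pr p≢2 | suc (suc _) | ℕ.s≤s (ℕ.s≤s ())

  module OddDensity (p : ℕ) {{pr : Prime p}} (h : ℕ) (p≡ : p ≡ suc (h ℕ.+ h)) where
    private
      module O = Odd p {{pr}} h p≡

    module _ (ν : Fin 2) (ν-cls : O.Class ν (ℤ.- ℤ.1ℤ)) (d : Dec (∃[ i ] O.Nonsquare i)) where
      open UnitClasses {p} {{pr}} (O.classes ν ν-cls d) using (soluble?; universal?)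

      Counts : Set
      Counts = (tally 3 soluble? ≡ 8 ∷ 12 ∷ 12 ∷ 8 ∷ []) × (tally 3 (not ∘ soluble?) ≡ 0 ∷ 12 ∷ 12 ∷ 0 ∷ [])
        × (tally 4 soluble? ≡ 16 ∷ 64 ∷ 72 ∷ 64 ∷ 16 ∷ []) × (tally 4 (not ∘ soluble?) ≡ 0 ∷ 0 ∷ 24 ∷ 0 ∷ 0 ∷ [])
        × (universal? ≡ true)

    -- Three coefficients of equal parity are always soluble. With three in all, one or two odd
    -- labels leave a pair and a single: of these 24 labellings the half whose pair has no zero is
    -- insoluble. With four, only two pairs can fail, both at once: a quarter of 96. For either `ν`
    -- exactly one class completes a given class to a soluble pair. Among five, three share a
    -- parity.
    counts : ∀ ν ν-cls d → Counts ν ν-cls d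
    counts zero       _ _ = refl , refl , refl , refl , refl
    counts (suc zero) _ _ = refl , refl , refl , refl , refl

    module _ (ν : Fin 2) (ν-cls : O.Class ν (ℤ.- ℤ.1ℤ)) (d : Dec (∃[ i ] O.Nonsquare i)) where
      open Density p {{pr}} (O.classes ν ν-cls d) using (density; density-one; r; weight; r*[1+t])

      private
        C : Counts ν ν-cls d
        C = counts ν ν-cls d

        scaled : Poly → ℕ → ℚ
        scaled f n = weight ^ℚ n * eval f (p⁻¹ p)

      conic : ρ[ p ][ 2 , 2 ]≡ (1ℚ - (+ 3 / 2) * p⁻¹ p * r ^ℚ 2)
      conic = density 2
        (ℚ.≤-reflexive (trans (cong (λ f → scaled f 3) (proj₁ C)) (conic-identity r (p⁻¹ p) r*[1+t])))
        (ℚ.≤-reflexive (trans (cong (λ f → scaled f 3) (proj₁ (proj₂ C))) (conic-identity′ r (p⁻¹ p) r*[1+t])))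

      quadric : ρ[ p ][ 3 , 2 ]≡ (1ℚ - (+ 3 / 2) * p⁻¹ p ^ℚ 2 * r ^ℚ 4)
      quadric = density 3
        (ℚ.≤-reflexive (trans (cong (λ f → scaled f 4) (proj₁ (proj₂ (proj₂ C)))) (quadric-identity r (p⁻¹ p) r*[1+t])))
        (ℚ.≤-reflexive (trans (cong (λ f → scaled f 4) (proj₁ (proj₂ (proj₂ (proj₂ C))))) (quadric-identity′ r (p⁻¹ p))))

      higher : ∀ n → n ℕ.≥ 4 → ρ[ p ][ n , 2 ]≡ 1ℚ
      higher = density-one (proj₂ (proj₂ (proj₂ (proj₂ C))))

  odd-densities : ∀ p {{pr : Prime p}} → p ≢ 2 →
      (ρ[ p ][ 2 , 2 ]≡ (1ℚ - (+ 3 / 2) * p⁻¹ p * ((1ℚ - p⁻¹ p) ÷ (1ℚ - p⁻¹ p ^ℚ 2)) ^ℚ 2))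
    × (ρ[ p ][ 3 , 2 ]≡ (1ℚ - (+ 3 / 2) * p⁻¹ p ^ℚ 2 * ((1ℚ - p⁻¹ p) ÷ (1ℚ - p⁻¹ p ^ℚ 2)) ^ℚ 4))
    × (∀ n → n ℕ.≥ 4 → ρ[ p ][ n , 2 ]≡ 1ℚ)
  odd-densities p {{pr}} p≢2 = densities (Odd.-1-class p h p≡) (Odd.nonsquare? p h p≡)
    where
    h = proj₁ (odd⇒suc-double p pr p≢2)
    p≡ = proj₂ (odd⇒suc-double p pr p≢2)
    densities : ∃[ ν ] Odd.Class p h p≡ ν (ℤ.- ℤ.1ℤ) → Dec (∃[ i ] Odd.Nonsquare p h p≡ i) → _
    densities (ν , ν-cls) d = conic ν ν-cls d , quadric ν ν-cls d , higher ν ν-cls d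
      where open OddDensity p h p≡

-- The theorem, by cases on whether `p` is 2.

open import Data.Nat.Base using (ℕ; _≥_)
open import Data.Nat.Primality using (Prime)
open import Data.Integer.Base using (+_)
open import Data.Rational.Base using (ℚ; 1ℚ; _-_; _*_; _÷_; _/_)
open import Data.Product.Base using (_×_; _,_; proj₁; proj₂)
open import Data.Nat.Properties using (_≟_)
open import Relation.Binary.PropositionalEquality using (_≡_; _≢_; refl)
open import Relation.Nullary.Decidable.Core using (Dec; yes; no)

theorem1p3 : (p : ℕ) {{pr : Prime p}} →
    ((p ≡ 2 → ρ[ p ][ 2 , 2 ]≡ (+ 7 / 12)) ×
    (p ≢ 2 → ρ[ p ][ 2 , 2 ]≡
    (1ℚ - (+ 3 / 2) * p⁻¹ p * ((1ℚ - p⁻¹ p) ÷ (1ℚ - p⁻¹ p ^ℚ 2)) ^ℚ 2)))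
    ×
    ((p ≡ 2 → ρ[ p ][ 3 , 2 ]≡ (+ 1231 / 1296)) ×
    (p ≢ 2 → ρ[ p ][ 3 , 2 ]≡
    (1ℚ - (+ 3 / 2) * p⁻¹ p ^ℚ 2 * ((1ℚ - p⁻¹ p) ÷ (1ℚ - p⁻¹ p ^ℚ 2)) ^ℚ 4)))
    ×
    (∀ n → n ≥ 4 → ρ[ p ][ n , 2 ]≡ 1ℚ)
theorem1p3 p {{pr}} =
    ((λ { refl → DyadicDensity.conic }) , (λ p≢2 → proj₁ (odd p≢2)))
  , ((λ { refl → DyadicDensity.quadric }) , (λ p≢2 → proj₁ (proj₂ (odd p≢2))))
  , higher (p ≟ 2)
  where
  odd = OddDensities.odd-densities p

  higher : Dec (p ≡ 2) → ∀ n → n ≥ 4 → ρ[ p ][ n , 2 ]≡ 1ℚ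
  higher (yes refl) = DyadicDensity.higher
  higher (no  p≢2)  = proj₂ (proj₂ (odd p≢2))
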